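{- Let $\Pi$ be an arbitrary projective plane of order $p^2$, where $p\geq 7$ is prime, and let $d^\perp$ be the minimum (non-zero) weight of $\mathrm{C}(\Pi)^\perp$. Then $d^\perp=2p^2-2p+2$, or $d^\perp=2p^2-2p+4$, or $d^\perp\geq 2p^2-2p+5$. Furthermore: (1) if $d^\perp=2p^2-2p+2$, then every code word of minimum weight of $\mathrm{C}(\Pi)^\perp$ is of the form $\lambda(v_1-v_2)$ with $\lambda\in\mathbb{F}_p^*$ and $v_1,v_2$ the incidence vectors of (the point sets of) two disjoint projective planes of order $p-1$ embedded in $\Pi$; (2) if $d^\perp=2p^2-2p+4$, then every code word of minimum weight of $\mathrm{C}(\Pi)^\perp$ is of the form $\lambda(v_1-v_2)$ with $\lambda\in\mathbb{F}_p^*$ and $v_1,v_2$ the incidence vectors of (the point sets of) two disjoint antipodal planes of order $p-1$ embedded in $\Pi$. Finally, if $\Pi$ contains a Baer subplane (a subplane of order $p$), then $d^\perp\leq 2p^2-p$.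
   Context: For a projective plane $\Pi$ of order $q=p^h$ ($p$ prime), $\mathrm{C}(\Pi)$ is the $p$-ary code of $\Pi$: the $\mathbb{F}_p$-span of the incidence vectors of the lines of $\Pi$, viewed as vectors in $\mathbb{F}_p^{q^2+q+1}$ indexed by the points of $\Pi$. Its dual $\mathrm{C}(\Pi)^\perp$ is the set of vectors $v$ with $\sum_{P\in\ell}v_P=0$ in $\mathbb{F}_p$ for every line $\ell$ of $\Pi$. The weight of a vector is the number of non-zero positions. An antipodal plane of order $s\geq 2$ is a partial linear space (point set $\mathcal{P}$, line set $\mathcal{L}$, each line a subset of $\mathcal{P}$ of size at least $2$, two distinct points on at most one line) with $|\mathcal{P}|=|\mathcal{L}|=s^2+s+2$, every line containing $s+1$ points and every point on $s+1$ lines. An incidence structure $(\mathcal{P},\mathcal{L})$ is embedded in a projective plane $\Pi$ if there are injective maps from $\mathcal{P}$ to the points of $\Pi$ and from $\mathcal{L}$ to the lines of $\Pi$ preserving both incidence and non-incidence. -}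

module Defs where

open import Data.Nat using (ℕ; zero; suc; _+_; _*_; _∸_; _≤_; NonZero)
open import Data.Nat.DivMod using (_mod_)
open import Data.Nat.Divisibility using (_∣_)
open import Data.Fin using (Fin; toℕ) renaming (zero to fzero; suc to fsuc)
open import Data.Bool using (Bool; true; false; if_then_else_; T)
open import Data.Product using (Σ; ∃; ∃-syntax; _×_; _,_)
open import Relation.Binary.PropositionalEquality using (_≡_; _≢_)
open import Relation.Nullary using (¬_)
open import Function.Definitions using (Injective)

sumFin : ∀ {n} → (Fin n → ℕ) → ℕ
sumFin {zero}  f = 0
sumFin {suc n} f = f fzero + sumFin (λ i → f (fsuc i))

countFin : ∀ {n} → (Fin n → Bool) → ℕ
countFin f = sumFin (λ i → if f i then 1 else 0)

-- Projective planes of order n.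
-- Points and lines are both indexed by Fin (n² + n + 1);
-- I P ℓ = true  means  point P is incident with line ℓ.

planeSize : ℕ → ℕ
planeSize n = n * n + n + 1

Collinear : ∀ {m} → (Fin m → Fin m → Bool) → Fin m → Fin m → Fin m → Set
Collinear I P Q R = ∃[ ℓ ] (T (I P ℓ) × T (I Q ℓ) × T (I R ℓ))

record ProjectivePlane (n : ℕ) : Set where
  field
    I : Fin (planeSize n) → Fin (planeSize n) → Bool
    joinExists : ∀ P Q → P ≢ Q → ∃[ ℓ ] (T (I P ℓ) × T (I Q ℓ))
    joinUnique : ∀ P Q → P ≢ Q → ∀ ℓ m →
                 T (I P ℓ) → T (I Q ℓ) → T (I P m) → T (I Q m) → ℓ ≡ m
    meetExists : ∀ ℓ m → ℓ ≢ m → ∃[ P ] (T (I P ℓ) × T (I P m))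
    meetUnique : ∀ ℓ m → ℓ ≢ m → ∀ P Q →
                 T (I P ℓ) → T (I P m) → T (I Q ℓ) → T (I Q m) → P ≡ Q
    quadrangle : ∃[ A ] ∃[ B ] ∃[ C ] ∃[ D ]
                 (A ≢ B × A ≢ C × A ≢ D × B ≢ C × B ≢ D × C ≢ D ×
                  ¬ Collinear I A B C × ¬ Collinear I A B D ×
                  ¬ Collinear I A C D × ¬ Collinear I B C D)
    lineSize : ∀ ℓ → countFin (λ P → I P ℓ) ≡ suc n

-- Antipodal planes of order s (partial linear spaces).
-- |P| = |L| = s² + s + 2, lines have s+1 points, points on s+1 lines,
-- two distinct points on at most one line.  (Since s+1 ≥ 2, distinct
-- lines have distinct point sets, so lines may be given abstractly.)

antipodalSize : ℕ → ℕ
antipodalSize s = s * s + s + 2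

record AntipodalPlane (s : ℕ) : Set where
  field
    I : Fin (antipodalSize s) → Fin (antipodalSize s) → Bool
    lineSize  : ∀ ℓ → countFin (λ P → I P ℓ) ≡ suc s
    pointDeg  : ∀ P → countFin (λ ℓ → I P ℓ) ≡ suc s
    partialLinear : ∀ P Q → P ≢ Q → ∀ ℓ m →
                 T (I P ℓ) → T (I Q ℓ) → T (I P m) → T (I Q m) → ℓ ≡ m

record Embedding {m N : ℕ} (I' : Fin m → Fin m → Bool)
                 (I : Fin N → Fin N → Bool) : Set where
  field
    pt    : Fin m → Fin N
    ln    : Fin m → Fin N
    ptInj : Injective _≡_ _≡_ pt
    lnInj : Injective _≡_ _≡_ ln
    incid : ∀ x y → I (pt x) (ln y) ≡ I' x y

IsPointSetOf : ∀ {m N} {I' : Fin m → Fin m → Bool} {I : Fin N → Fin N → Bool} →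
               Embedding I' I → (Fin N → Bool) → Set
IsPointSetOf {N = N} e S =
  (∀ P → T (S P) → ∃[ x ] (Embedding.pt e x ≡ P)) ×
  (∀ x → T (S (Embedding.pt e x)))

module Fp (p : ℕ) .{{_ : NonZero p}} where
  infixl 6 _-ₚ_
  infixl 7 _·ₚ_
  _-ₚ_ : Fin p → Fin p → Fin p
  a -ₚ b = (toℕ a + (p ∸ toℕ b)) mod p
  _·ₚ_ : Fin p → Fin p → Fin p
  a ·ₚ b = (toℕ a * toℕ b) mod p
  indic : Bool → Fin p
  indic b = (if b then 1 else 0) mod p

Word : ℕ → ℕ → Set
Word p N = Fin N → Fin p

InDual : ∀ {n} (p : ℕ) → ProjectivePlane n → Word p (planeSize n) → Set
InDual p Π c = ∀ ℓ → p ∣ sumFin (λ P → if ProjectivePlane.I Π P ℓ then toℕ (c P) else 0)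

weight : ∀ {p N} → Word p N → ℕ
weight c = countFin (λ P → nz (toℕ (c P)))
  where nz : ℕ → Bool
        nz zero    = false
        nz (suc _) = true

NonZeroWord : ∀ {p N} → Word p N → Set
NonZeroWord c = ∃[ P ] (toℕ (c P) ≢ 0)

IsMinDualWeight : ∀ {n} (p : ℕ) → ProjectivePlane n → ℕ → Set
IsMinDualWeight p Π d =
  (∃[ c ] (InDual p Π c × NonZeroWord c × weight c ≡ d)) ×
  (∀ c → InDual p Π c → NonZeroWord c → d ≤ weight c)

IsMinWordOfWeight : ∀ {n} (p : ℕ) → ProjectivePlane n → ℕ → Word p (planeSize n) → Set
IsMinWordOfWeight p Π d c = InDual p Π c × NonZeroWord c × weight c ≡ d

IsScaledDifference : (p : ℕ) .{{_ : NonZero p}} → ∀ {N} →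
                     Word p N → Fin p → (Fin N → Bool) → (Fin N → Bool) → Set
IsScaledDifference p c lam S₁ S₂ = ∀ P → c P ≡ lam ·ₚ (indic (S₁ P) -ₚ indic (S₂ P))
  where open Fp p

FormDisjointProjPlanes : (p : ℕ) .{{_ : NonZero p}} → ∀ {n} →
  ProjectivePlane n → ℕ → Word p (planeSize n) → Set
FormDisjointProjPlanes p Π s c =
  Σ (Fin p) λ lam → Σ (ProjectivePlane s) λ A → Σ (ProjectivePlane s) λ B →
  Σ (Embedding (ProjectivePlane.I A) (ProjectivePlane.I Π)) λ e₁ →
  Σ (Embedding (ProjectivePlane.I B) (ProjectivePlane.I Π)) λ e₂ →
  ∃[ S₁ ] ∃[ S₂ ]
    (toℕ lam ≢ 0 × IsPointSetOf e₁ S₁ × IsPointSetOf e₂ S₂ ×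
     (∀ P → ¬ (T (S₁ P) × T (S₂ P))) × IsScaledDifference p c lam S₁ S₂)

FormDisjointAntipodal : (p : ℕ) .{{_ : NonZero p}} → ∀ {n} →
  ProjectivePlane n → ℕ → Word p (planeSize n) → Set
FormDisjointAntipodal p Π s c =
  Σ (Fin p) λ lam → Σ (AntipodalPlane s) λ A → Σ (AntipodalPlane s) λ B →
  Σ (Embedding (AntipodalPlane.I A) (ProjectivePlane.I Π)) λ e₁ →
  Σ (Embedding (AntipodalPlane.I B) (ProjectivePlane.I Π)) λ e₂ →
  ∃[ S₁ ] ∃[ S₂ ]
    (toℕ lam ≢ 0 × IsPointSetOf e₁ S₁ × IsPointSetOf e₂ S₂ ×
     (∀ P → ¬ (T (S₁ P) × T (S₂ P))) × IsScaledDifference p c lam S₁ S₂)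

HasSubplaneOfOrder : ∀ {n} → ProjectivePlane n → ℕ → Set
HasSubplaneOfOrder Π k =
  Σ (ProjectivePlane k) λ B → Embedding (ProjectivePlane.I B) (ProjectivePlane.I Π)

{-# OPTIONS --safe #-}

-- Let c be a dual code word of weight w over a plane of order q = p². Lift its values to 0, …, p - 1.
-- On every line the lifted values sum to a positive multiple of p (if the line meets the support), so
-- summing over the lines through a point of value 1 bounds the total from below; adding the bound for
-- -c gives w = 2q - 2p + 2 + e with e = E + E' ≥ 0, where E and E' measure how far lines through points
-- of value 1 and -1 are from having sum exactly p. Most further steps are inequalities for a single
-- line, summed over the lines through a point.
--
-- Let e ≤ 2, scale c so that 1 is a value, and suppose that ±1 are not the only values. If r ≥ 3 is the
-- least value other than 0 and 1, then almost all lines joining the classes r and -1 consist of one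
-- point of value r and r points of value -1, and counting from both ends is contradictory. If 2 is a
-- value, then each class has about 2p points and almost all lines have at most three points of the
-- support, so the values are closed under addition and every residue is a value. Then the class sizes
-- exceed their lower bounds by a small amount κ ≥ 0, and comparing the classes a and -2a shows that κ
-- vanishes at ±2a if it does at ±a. A line through a point of value a with sum greater than p would
-- then have more points of the values a, -2a, 4a, -8a, 16a than points of the support altogether. So κ
-- never vanishes, which contradicts the total weight except for p = 7, where the values of κ along the
-- orbit of 2 cannot add up to the required total.
--
-- With values ±1 only, E = E', and for E = 0 the points of value 1 with the lines meeting them in p
-- points form a projective plane of order p - 1, while for E = 1 they form an antipodal plane. If B is a
-- Baer subplane and ℓ a line of B, every line meets both B and ℓ in 1 mod p points, so the difference of
-- their incidence vectors is a dual code word of weight 2p² - p.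

module Submission where

open import Defs
open import Data.Nat
open import Data.Nat.Properties
open import Data.Nat.DivMod
open import Data.Nat.Divisibility
open import Data.Nat.Primality using (Prime; euclidsLemma; prime⇒irreducible)
open import Data.Nat.Coprimality using (prime⇒coprime; coprime-Bézout)
open import Data.Nat.GCD using (module Bézout)
open import Data.Nat.Tactic.RingSolver using (solve-∀; solve)
open import Data.Fin using (Fin; toℕ; fromℕ<) renaming (zero to fzero; suc to fsuc)
import Data.Fin.Properties as FinP
open import Data.Bool using (Bool; true; false; if_then_else_; T; _∧_)
open import Data.Product using (∃-syntax; _×_; _,_; proj₁; proj₂)
open import Data.Sum using (_⊎_; inj₁; inj₂; [_,_]′)
open import Data.Empty using (⊥; ⊥-elim)
open import Data.Unit using (tt)
open import Data.List using (List; []; _∷_)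
open import Relation.Binary.Definitions using (tri<; tri≈; tri>)
open import Relation.Nullary using (¬_; yes; no; Dec)
open import Relation.Binary.PropositionalEquality

-- A word and its negative are treated together because their quotients on a line add up to the
-- number of support points there. An inequality between quotients thus becomes one between
-- quantities whose sums over the lines through a point are known exactly. The range e ≤ 2 means
-- weight at most 2p² - 2p + 4; weight 2p² - 2p + 3 drops out at the very end, because values ±1
-- force E = E' and e is then even. The obstacle is a word that takes every value: p - 1 classes of
-- about 2p points do add up to about 2p² - 2p, so rough counting cannot exclude it, and κ, which is
-- at most 3, has to be followed exactly. The classes a and -2a are compared because a line with two
-- points of value a and one of value -2a is a tight case of the inequality that links them. The
-- descent runs through the five residues a, -2a, 4a, -8a, 16a, as four classes could still share a
-- line with four points of the support. The bound p ≥ 7 keeps these residues distinct and gives the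
-- linear estimates their slack.

infixl 6 _⊕_
infixr 7 _⊗_
infixl 7 _⊙_

_⊕_ : ∀ {a b c d} → a ≤ b → c ≤ d → a + c ≤ b + d
_⊕_ = +-mono-≤

_⊗_ : ∀ n {a b} → a ≤ b → n * a ≤ n * b
n ⊗ h = *-monoʳ-≤ n h

_⊙_ : ∀ {a b} → a ≤ b → ∀ n → a * n ≤ b * n
h ⊙ n = *-monoˡ-≤ n h

-- Certificate for linear arithmetic without subtraction: `A ≤ B` is a sum of hypotheses with chosen
-- multipliers, `n` is the slack left over, and the equation is a ring identity for the solver.
-- `≤-absurd` is the same device for contradictions.
≤-from-sum : ∀ {A B C D} n → A ≤ B → C + B + n ≡ D + A → C ≤ D
≤-from-sum {A} {B} {C} {D} n A≤B eq = +-cancelʳ-≤ B C D (begin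
  C + B      ≤⟨ m≤m+n (C + B) n ⟩
  C + B + n  ≡⟨ eq ⟩
  D + A      ≤⟨ +-monoʳ-≤ D A≤B ⟩
  D + B      ∎)
  where open ≤-Reasoning

≤-absurd : ∀ {A B} n → A ≤ B → A ≡ suc (B + n) → ⊥
≤-absurd {A} {B} n A≤B eq = 1+n≰n (begin
  suc (B + n) ≡⟨ eq ⟨
  A           ≤⟨ A≤B ⟩
  B           ≤⟨ m≤m+n B n ⟩
  B + n       ∎)
  where open ≤-Reasoning

lit : ∀ {m n} {_ : T (m ≤ᵇ n)} → m ≤ n
lit {m} {n} {t} = ≤ᵇ⇒≤ m n t

bit : Bool → ℕ
bit b = if b then 1 else 0

bit-T : ∀ {b} → T b → bit b ≡ 1
bit-T {true} _ = refl

bit-¬T : ∀ {b} → ¬ T b → bit b ≡ 0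
bit-¬T {true}  h = ⊥-elim (h tt)
bit-¬T {false} h = refl

bit≤1 : ∀ b → bit b ≤ 1
bit≤1 true  = ≤-refl
bit≤1 false = z≤n

bit-pos : ∀ {b} → 1 ≤ bit b → T b
bit-pos {true} _ = tt

T? : ∀ b → Dec (T b)
T? true  = yes tt
T? false = no λ ()

-- Sums over Fin

sum-cong : ∀ {n} {f g : Fin n → ℕ} → (∀ i → f i ≡ g i) → sumFin f ≡ sumFin g
sum-cong {zero}  h = refl
sum-cong {suc n} h = cong₂ _+_ (h fzero) (sum-cong (λ i → h (fsuc i)))

sum-mono : ∀ {n} {f g : Fin n → ℕ} → (∀ i → f i ≤ g i) → sumFin f ≤ sumFin g
sum-mono {zero}  h = z≤n
sum-mono {suc n} h = +-mono-≤ (h fzero) (sum-mono (λ i → h (fsuc i)))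

interchange : ∀ a b c d → a + b + (c + d) ≡ a + c + (b + d)
interchange = solve-∀

sum-+ : ∀ {n} (f g : Fin n → ℕ) → sumFin (λ i → f i + g i) ≡ sumFin f + sumFin g
sum-+ {zero}  f g = refl
sum-+ {suc n} f g = trans (cong (f fzero + g fzero +_) (sum-+ (λ i → f (fsuc i)) (λ i → g (fsuc i))))
                          (interchange (f fzero) (g fzero) _ _)

sum-*ˡ : ∀ {n} c (f : Fin n → ℕ) → sumFin (λ i → c * f i) ≡ c * sumFin f
sum-*ˡ {zero}  c f = sym (*-zeroʳ c)
sum-*ˡ {suc n} c f = trans (cong (c * f fzero +_) (sum-*ˡ c (λ i → f (fsuc i))))
                           (sym (*-distribˡ-+ c (f fzero) _))

sum-const : ∀ n c → sumFin {n} (λ _ → c) ≡ n * c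
sum-const zero    c = refl
sum-const (suc n) c = cong (c +_) (sum-const n c)

sum-zero : ∀ {n} {f : Fin n → ℕ} → (∀ i → f i ≡ 0) → sumFin f ≡ 0
sum-zero {n} h = trans (sum-cong h) (trans (sum-const n 0) (*-zeroʳ n))

sum-swap : ∀ {m n} (f : Fin m → Fin n → ℕ) →
           sumFin (λ i → sumFin (λ j → f i j)) ≡ sumFin (λ j → sumFin (λ i → f i j))
sum-swap {zero}  {n} f = sym (sum-zero {n} (λ _ → refl))
sum-swap {suc m} f = trans (cong (sumFin (f fzero) +_) (sum-swap (λ i → f (fsuc i))))
                           (sym (sum-+ (f fzero) (λ j → sumFin (λ i → f (fsuc i) j))))

term≤sum : ∀ {n} (f : Fin n → ℕ) i → f i ≤ sumFin f
term≤sum f fzero    = m≤m+n _ _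
term≤sum f (fsuc i) = ≤-trans (term≤sum (λ j → f (fsuc j)) i) (m≤n+m _ _)

sum-pos : ∀ {n} (f : Fin n → ℕ) → 1 ≤ sumFin f → ∃[ i ] 1 ≤ f i
sum-pos {suc n} f h with f fzero in eq
... | suc v = fzero , subst (1 ≤_) (sym eq) (s≤s z≤n)
... | zero with sum-pos (λ i → f (fsuc i)) h
...   | i , le = fsuc i , le

-- Used when a summed estimate turns out to be tight: the estimate is then tight on each single
-- line.
≤-sum-eq : ∀ {n} {f g : Fin n → ℕ} → (∀ i → f i ≤ g i) → sumFin g ≤ sumFin f → ∀ i → f i ≡ g i
≤-sum-eq {suc n} {f} {g} le h = go
  where
  le' = sum-mono (λ i → le (fsuc i))
  head : g fzero ≤ f fzero
  head = +-cancelʳ-≤ _ _ _ (≤-trans (+-monoʳ-≤ (g fzero) le') h)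
  tail : sumFin (λ i → g (fsuc i)) ≤ sumFin (λ i → f (fsuc i))
  tail = +-cancelˡ-≤ _ _ _ (≤-trans (+-monoˡ-≤ _ (le fzero)) h)
  go : ∀ i → f i ≡ g i
  go fzero    = ≤-antisym (le fzero) head
  go (fsuc i) = ≤-sum-eq (λ i → le (fsuc i)) tail i

δ : ℕ → ℕ → ℕ
δ a b = bit (a ≡ᵇ b)

δ-≡ : ∀ {a b} → a ≡ b → δ a b ≡ 1
δ-≡ {a} refl = bit-T (≡⇒≡ᵇ a a refl)

δ-≢ : ∀ {a b} → a ≢ b → δ a b ≡ 0
δ-≢ {a} {b} h = bit-¬T (λ t → h (≡ᵇ⇒≡ a b t))

δ≤1 : ∀ a b → δ a b ≤ 1
δ≤1 a b with a ≟ b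
... | yes e = ≤-reflexive (δ-≡ e)
... | no ne = subst (_≤ 1) (sym (δ-≢ ne)) z≤n

δ-pos : ∀ {a b} → 1 ≤ δ a b → a ≡ b
δ-pos {a} {b} h with a ≟ b
... | yes e = e
... | no ne = ⊥-elim (1+n≰n (subst (1 ≤_) (δ-≢ ne) h))

δ-cong : ∀ {a b c d} → (a ≡ b → c ≡ d) → (c ≡ d → a ≡ b) → δ a b ≡ δ c d
δ-cong {a} {b} {c} {d} f g with a ≟ b
... | yes e = trans (δ-≡ e) (sym (δ-≡ (f e)))
... | no ne = trans (δ-≢ ne) (sym (δ-≢ (λ e → ne (g e))))

δF : ∀ {n} → Fin n → Fin n → ℕ
δF i j = δ (toℕ i) (toℕ j)

sum-δF : ∀ {n} (j : Fin n) (h : Fin n → ℕ) → sumFin (λ i → δF i j * h i) ≡ h j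
sum-δF {suc n} fzero    h = trans (cong₂ _+_ (*-identityˡ (h fzero)) (sum-zero {n} (λ i → refl))) (+-identityʳ _)
sum-δF {suc n} (fsuc j) h = sum-δF j (λ i → h (fsuc i))

sum-δF1 : ∀ {n} (j : Fin n) → sumFin (λ i → δF i j) ≡ 1
sum-δF1 {n} j = trans (sum-cong {n} (λ i → sym (*-identityʳ _))) (sum-δF j (λ _ → 1))

sum-δ : ∀ n {v} → v < n → sumFin {n} (λ i → δ v (toℕ i)) ≡ 1
sum-δ n {v} v<n = trans (sum-cong {n} (λ i → δ-cong {v}
    (λ e → sym (trans (FinP.toℕ-fromℕ< v<n) e)) (λ e → sym (trans e (FinP.toℕ-fromℕ< v<n)))))
  (sum-δF1 (fromℕ< v<n))

nz : ℕ → ℕ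
nz zero    = 0
nz (suc _) = 1

nz≤1 : ∀ v → nz v ≤ 1
nz≤1 zero    = z≤n
nz≤1 (suc _) = ≤-refl

nz-pos : ∀ {v} → 1 ≤ v → nz v ≡ 1
nz-pos {suc v} _ = refl

nz-pos⁻¹ : ∀ {v} → 1 ≤ nz v → 1 ≤ v
nz-pos⁻¹ {suc v} _ = s≤s z≤n

sum-single : ∀ {n} (f : Fin n → ℕ) → sumFin (λ i → nz (f i)) ≡ 1 → ∃[ i ] (f i ≡ sumFin f)
sum-single {suc n} f h with f fzero in eq
... | zero with sum-single (λ i → f (fsuc i)) h
...   | i , e = fsuc i , e
sum-single {suc n} f h | suc v = fzero , trans eq (sym (trans (cong (suc v +_) rest) (+-identityʳ _)))
  where
  rest : sumFin (λ i → f (fsuc i)) ≡ 0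
  rest = sum-zero (λ i → n≤0⇒n≡0 (≮⇒≥ (λ pos → 1+n≰n (≤-trans (≤-reflexive (sym (nz-pos pos)))
    (≤-trans (term≤sum (λ i → nz (f (fsuc i))) i) (≤-reflexive (suc-injective h)))))))

-- Sums weighted by a set, and linear combinations

wsum : ∀ {n} → (Fin n → Bool) → (Fin n → ℕ) → ℕ
wsum S f = sumFin (λ i → bit (S i) * f i)

wsum-cong : ∀ {n} (S : Fin n → Bool) {f g : Fin n → ℕ} → (∀ i → f i ≡ g i) → wsum S f ≡ wsum S g
wsum-cong S h = sum-cong (λ i → cong (bit (S i) *_) (h i))

wsum-mono : ∀ {n} (S : Fin n → Bool) {f g : Fin n → ℕ} → (∀ i → T (S i) → f i ≤ g i) → wsum S f ≤ wsum S g
wsum-mono S {f} {g} h = sum-mono go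
  where
  go : ∀ i → bit (S i) * f i ≤ bit (S i) * g i
  go i with S i | h i
  ... | true  | le = +-monoˡ-≤ 0 (le tt)
  ... | false | _  = z≤n

wsum-eq : ∀ {n} (S : Fin n → Bool) {f g : Fin n → ℕ} → (∀ i → T (S i) → f i ≤ g i) →
          wsum S g ≤ wsum S f → ∀ i → T (S i) → f i ≡ g i
wsum-eq S {f} {g} h le i t = trans (sym (*-identityˡ (f i))) (trans (subst (λ b → b * f i ≡ b * g i) (bit-T t)
    (≤-sum-eq go le i)) (*-identityˡ (g i)))
  where
  go : ∀ i → bit (S i) * f i ≤ bit (S i) * g i
  go i with S i | h i
  ... | true  | le = +-monoˡ-≤ 0 (le tt)
  ... | false | _  = z≤n

wsum-1 : ∀ {n} (S : Fin n → Bool) → wsum S (λ _ → 1) ≡ countFin S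
wsum-1 S = sum-cong (λ i → *-identityʳ (bit (S i)))

term≤wsum : ∀ {n} (S : Fin n → Bool) (f : Fin n → ℕ) i → T (S i) → f i ≤ wsum S f
term≤wsum S f i t = ≤-trans (≤-reflexive (sym (trans (cong (_* f i) (bit-T t)) (*-identityˡ (f i)))))
                            (term≤sum (λ i → bit (S i) * f i) i)

wsum-pos : ∀ {n} (S : Fin n → Bool) (f : Fin n → ℕ) → 1 ≤ wsum S f → ∃[ i ] (T (S i) × 1 ≤ f i)
wsum-pos S f h with sum-pos (λ i → bit (S i) * f i) h
... | i , le with S i in eq
...   | true  = i , subst T (sym eq) tt , subst (1 ≤_) (*-identityˡ (f i)) le

-- A linear combination Σ aⱼ fⱼ is given as a list, so that both sides of an inequality
-- between functions can be summed at once.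
comb : {A : Set} → List (ℕ × (A → ℕ)) → A → ℕ
comb []             x = 0
comb ((a , f) ∷ fs) x = a * f x + comb fs x

wcomb : ∀ {n} → (Fin n → Bool) → List (ℕ × (Fin n → ℕ)) → ℕ
wcomb S []             = 0
wcomb S ((a , f) ∷ fs) = a * wsum S f + wcomb S fs

wsum-+ : ∀ {n} (S : Fin n → Bool) (f g : Fin n → ℕ) → wsum S (λ i → f i + g i) ≡ wsum S f + wsum S g
wsum-+ S f g = trans (sum-cong (λ i → *-distribˡ-+ (bit (S i)) (f i) (g i)))
                     (sum-+ (λ i → bit (S i) * f i) (λ i → bit (S i) * g i))

*-swap : ∀ a b c → a * (b * c) ≡ b * (a * c)
*-swap = solve-∀

wsum-*ˡ : ∀ {n} (S : Fin n → Bool) c (f : Fin n → ℕ) → wsum S (λ i → c * f i) ≡ c * wsum S f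
wsum-*ˡ S c f = trans (sum-cong (λ i → *-swap (bit (S i)) c (f i))) (sum-*ˡ c (λ i → bit (S i) * f i))

wsum-comb : ∀ {n} (S : Fin n → Bool) fs → wsum S (comb fs) ≡ wcomb S fs
wsum-comb S []             = sum-zero (λ i → *-zeroʳ (bit (S i)))
wsum-comb S ((a , f) ∷ fs) = trans (wsum-+ S (λ i → a * f i) (comb fs)) (cong₂ _+_ (wsum-*ˡ S a f) (wsum-comb S fs))

comb-mono : ∀ {n} (S : Fin n → Bool) fs gs → (∀ i → T (S i) → comb fs i ≤ comb gs i) → wcomb S fs ≤ wcomb S gs
comb-mono S fs gs h = subst₂ _≤_ (wsum-comb S fs) (wsum-comb S gs) (wsum-mono S h)

comb-eq : ∀ {n} (S : Fin n → Bool) fs gs → (∀ i → T (S i) → comb fs i ≤ comb gs i) →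
          wcomb S gs ≤ wcomb S fs → ∀ i → T (S i) → comb fs i ≡ comb gs i
comb-eq S fs gs h le = wsum-eq S h (subst₂ _≤_ (sym (wsum-comb S gs)) (sym (wsum-comb S fs)) le)

δF-≢ : ∀ {n} {i j : Fin n} → i ≢ j → δF i j ≡ 0
δF-≢ h = δ-≢ (λ e → h (FinP.toℕ-injective e))

-- Removing one index from a sum

without : ∀ {n} → Fin n → (Fin n → ℕ) → Fin n → ℕ
without i f j = (1 ∸ δF j i) * f j

without-self : ∀ {n} (i : Fin n) f → without i f i ≡ 0
without-self i f = cong (λ d → (1 ∸ d) * f i) (δ-≡ {toℕ i} refl)

without-other : ∀ {n} {i j : Fin n} f → j ≢ i → without i f j ≡ f j
without-other {i = i} {j} f h = trans (cong (λ d → (1 ∸ d) * f j) (δF-≢ h)) (*-identityˡ (f j))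

without≤ : ∀ {n} (i : Fin n) f j → without i f j ≤ f j
without≤ i f j = ≤-trans (*-monoˡ-≤ (f j) (m∸n≤m 1 (δF j i))) (≤-reflexive (*-identityˡ (f j)))

without-pos : ∀ {n} (i : Fin n) f j → 1 ≤ without i f j → j ≢ i × without i f j ≡ f j
without-pos i f j h with j FinP.≟ i
... | yes refl = ⊥-elim (1+n≰n (subst (1 ≤_) (without-self i f) h))
... | no ne    = ne , without-other f ne

sum-without : ∀ {n} (i : Fin n) f → f i + sumFin (without i f) ≡ sumFin f
sum-without {n} i f = trans (cong (_+ sumFin (without i f)) (sym (sum-δF i f)))
  (trans (sym (sum-+ (λ j → δF j i * f j) (without i f))) (sum-cong {n} go))
  where
  go : ∀ j → δF j i * f j + without i f j ≡ f j
  go j with j FinP.≟ i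
  ... | yes refl = trans (cong₂ _+_ (cong (_* f i) (δ-≡ {toℕ i} refl)) (without-self i f))
                         (trans (+-identityʳ (1 * f i)) (*-identityˡ (f i)))
  ... | no ne    = cong₂ _+_ (cong (_* f j) (δF-≢ ne)) (without-other f ne)

nz-without : ∀ {n} (i : Fin n) f j → nz (without i f j) ≡ without i (λ j → nz (f j)) j
nz-without i f j with j FinP.≟ i
... | yes refl = trans (cong nz (without-self i f)) (sym (without-self i (λ j → nz (f j))))
... | no ne    = trans (cong nz (without-other f ne)) (sym (without-other (λ j → nz (f j)) ne))

sum-nz-without : ∀ {n} (i : Fin n) f → nz (f i) + sumFin (λ j → nz (without i f j)) ≡ sumFin (λ j → nz (f j))
sum-nz-without {n} i f = trans (cong (nz (f i) +_) (sum-cong {n} (nz-without i f))) (sum-without i (λ j → nz (f j)))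

countFin≡1 : ∀ {n} (S : Fin n → Bool) i → T (S i) → (∀ j → T (S j) → j ≡ i) → countFin S ≡ 1
countFin≡1 {n} S i t uniq = trans (sum-cong {n} go) (sum-δF1 i)
  where
  go : ∀ j → bit (S j) ≡ δF j i
  go j with T? (S j)
  ... | yes tj = trans (bit-T tj) (sym (δ-≡ (cong toℕ (uniq j tj))))
  ... | no ¬tj = trans (bit-¬T ¬tj) (sym (δF-≢ {i = j} {i} (λ { refl → ¬tj t })))

bit-∧ : ∀ a b → bit a * bit b ≡ bit (a ∧ b)
bit-∧ true  true  = refl
bit-∧ true  false = refl
bit-∧ false b     = refl

∧-intro : ∀ {a b} → T a → T b → T (a ∧ b)
∧-intro {true} {true} _ _ = tt

∧-elim : ∀ {a b} → T (a ∧ b) → T a × T b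
∧-elim {true} {true} _ = tt , tt

-- Double counting in a projective plane of order q

module PlaneCounting {q : ℕ} .{{_ : NonZero q}} (Π : ProjectivePlane q) where
  open ProjectivePlane Π public

  N : ℕ
  N = planeSize q

  Pt : Set
  Pt = Fin N

  joinCount : ∀ {P Q} → P ≢ Q → wsum (I P) (λ ℓ → bit (I Q ℓ)) ≡ 1
  joinCount {P} {Q} P≢Q with joinExists P Q P≢Q
  ... | ℓ , Pℓ , Qℓ = trans (sum-cong {N} (λ m → bit-∧ (I P m) (I Q m)))
    (countFin≡1 (λ m → I P m ∧ I Q m) ℓ (∧-intro Pℓ Qℓ)
      (λ m t → joinUnique P Q P≢Q m ℓ (proj₁ (∧-elim t)) (proj₂ (∧-elim {I P m} t)) Pℓ Qℓ))

  bit-idem : ∀ b → bit b * bit b ≡ bit b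
  bit-idem true  = refl
  bit-idem false = refl

  wsum-self : ∀ P → wsum (I P) (λ ℓ → bit (I P ℓ)) ≡ countFin (I P)
  wsum-self P = sum-cong {N} (λ ℓ → bit-idem (I P ℓ))

  private
    arith-deg : ∀ d q → d + (q * q + q + 1) ≡ d * suc q + 1 → q * d ≡ q * suc q
    arith-deg d q e = +-cancelˡ-≡ (d + 1) _ _ (trans (e1 d q) (trans (sym e) (e2 d q)))
      where
      e1 : ∀ d q → d + 1 + q * d ≡ d * suc q + 1
      e1 = solve-∀
      e2 : ∀ d q → d + (q * q + q + 1) ≡ d + 1 + q * suc q
      e2 = solve-∀

  -- The axioms give line sizes only. With d the degree of P, the pairs (Q, ℓ) with P and Q on ℓ
  -- number d (q + 1) by lines; by points, Q = P contributes d and every other Q contributes 1.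
  pointDegree : ∀ P → countFin (I P) ≡ suc q
  pointDegree P = *-cancelˡ-≡ _ _ q (arith-deg _ q (trans lhs rhs))
    where
    d = countFin (I P)
    row : ∀ Q → wsum (I P) (λ ℓ → bit (I Q ℓ)) + δF Q P ≡ 1 + δF Q P * d
    row Q with Q FinP.≟ P
    ... | yes refl = trans (cong₂ _+_ (wsum-self P) (δ-≡ {toℕ P} refl))
                      (trans (+-comm d 1) (cong (1 +_) (sym (trans (cong (_* d) (δ-≡ {toℕ P} refl)) (*-identityˡ d)))))
    ... | no ne    = trans (cong₂ _+_ (joinCount (λ e → ne (sym e))) (δF-≢ ne)) (cong (λ x → 1 + x * d) (sym (δF-≢ ne)))
    total : sumFin (λ Q → wsum (I P) (λ ℓ → bit (I Q ℓ))) ≡ d * suc q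
    total = trans (sum-swap (λ Q ℓ → bit (I P ℓ) * bit (I Q ℓ)))
      (trans (sum-cong {N} (λ ℓ → trans (sum-*ˡ (bit (I P ℓ)) (λ Q → bit (I Q ℓ)))
         (trans (cong (bit (I P ℓ) *_) (lineSize ℓ)) (*-comm (bit (I P ℓ)) (suc q)))))
        (trans (sum-*ˡ (suc q) (λ ℓ → bit (I P ℓ))) (*-comm (suc q) d)))
    rhs : sumFin (λ Q → 1 + δF Q P * d) ≡ d * suc q + 1
    rhs = trans (sum-cong {N} (λ Q → sym (row Q)))
            (trans (sum-+ (λ Q → wsum (I P) (λ ℓ → bit (I Q ℓ))) (λ Q → δF Q P)) (cong₂ _+_ total (sum-δF1 P)))
    lhs : d + (q * q + q + 1) ≡ sumFin (λ Q → 1 + δF Q P * d)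
    lhs = trans (+-comm d _) (sym (trans (sum-+ {N} (λ _ → 1) (λ Q → δF Q P * d))
            (cong₂ _+_ (trans (sum-const (planeSize q) 1) (*-identityʳ _)) (sum-δF P (λ _ → d)))))

  pts : Pt → Pt → Bool
  pts ℓ Q = I Q ℓ

  onLine : Pt → (Pt → ℕ) → ℕ
  onLine ℓ = wsum (pts ℓ)

  through : Pt → (Pt → ℕ) → ℕ
  through P = wsum (I P)

  through-1 : ∀ P → through P (λ _ → 1) ≡ suc q
  through-1 P = trans (wsum-1 (I P)) (pointDegree P)

  -- A point other than P lies on one line through P, while P itself lies on q + 1. This identity
  -- turns each inequality for a single line into one between class sizes, weight and excess.
  through-onLine : ∀ P h → through P (λ ℓ → onLine ℓ h) ≡ sumFin h + q * h P
  through-onLine P h = trans (sum-cong {N} (λ ℓ → sym (sum-*ˡ (bit (I P ℓ)) (λ Q → bit (I Q ℓ) * h Q))))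
    (trans (sum-swap (λ ℓ Q → bit (I P ℓ) * (bit (I Q ℓ) * h Q)))
    (trans (sum-cong {N} row)
    (trans (sum-+ h (λ Q → δF Q P * (q * h Q))) (cong (sumFin h +_) (sum-δF P (λ Q → q * h Q))))))
    where
    pull : ∀ a b c → a * (b * c) ≡ c * (a * b)
    pull = solve-∀
    row : ∀ Q → sumFin (λ ℓ → bit (I P ℓ) * (bit (I Q ℓ) * h Q)) ≡ h Q + δF Q P * (q * h Q)
    row Q = trans (sum-cong {N} (λ ℓ → pull (bit (I P ℓ)) (bit (I Q ℓ)) (h Q)))
      (trans (sum-*ˡ (h Q) (λ ℓ → bit (I P ℓ) * bit (I Q ℓ))) go)
      where
      go : h Q * wsum (I P) (λ ℓ → bit (I Q ℓ)) ≡ h Q + δF Q P * (q * h Q)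
      go with Q FinP.≟ P
      ... | yes refl = trans (cong (h Q *_) (trans (wsum-self P) (pointDegree P)))
              (trans (*-comm (h Q) (suc q)) (cong (h Q +_) (sym (trans (cong (_* (q * h Q)) (δ-≡ {toℕ Q} refl)) (*-identityˡ _)))))
      ... | no ne = trans (cong (h Q *_) (joinCount (λ e → ne (sym e))))
              (trans (*-identityʳ (h Q)) (sym (trans (cong (λ x → h Q + x * (q * h Q)) (δF-≢ ne)) (+-identityʳ (h Q)))))

  sum-incidence : ∀ (S F : Pt → ℕ) → sumFin (λ ℓ → onLine ℓ S * F ℓ) ≡ sumFin (λ P → S P * through P F)
  sum-incidence S F = trans (sum-cong {N} (λ ℓ → trans (*-comm (onLine ℓ S) (F ℓ)) (sym (sum-*ˡ (F ℓ) (λ P → bit (I P ℓ) * S P)))))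
    (trans (sum-swap (λ ℓ P → F ℓ * (bit (I P ℓ) * S P)))
      (sum-cong {N} (λ P → trans (sum-cong {N} (λ ℓ → pull (F ℓ) (bit (I P ℓ)) (S P)))
        (sum-*ˡ (S P) (λ ℓ → bit (I P ℓ) * F ℓ)))))
    where
    pull : ∀ a b c → a * (b * c) ≡ c * (b * a)
    pull = solve-∀

-- Arithmetic of residues modulo p

%-≡⇒∣∸ : ∀ {a b} p .{{_ : NonZero p}} → a % p ≡ b % p → p ∣ b ∸ a
%-≡⇒∣∸ {a} {b} p e = divides (b / p ∸ a / p) (trans (cong₂ _∸_ (trans (m≡m%n+[m/n]*n b p) (cong (_+ b / p * p) (sym e))) (m≡m%n+[m/n]*n a p))
  (trans ([m+n]∸[m+o]≡n∸o (a % p) (b / p * p) (a / p * p)) (sym (*-distribʳ-∸ p (b / p) (a / p)))))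

p∤small : ∀ {p v} → 1 ≤ v → v < p → ¬ p ∣ v
p∤small {p} {suc v} _ v<p d = <⇒≱ v<p (∣⇒≤ d)

pos-or-0 : ∀ v → v ≡ 0 ⊎ 1 ≤ v
pos-or-0 zero    = inj₁ refl
pos-or-0 (suc v) = inj₂ (s≤s z≤n)

module Residues (p : ℕ) .{{_ : NonZero p}} (pr : Prime p) (1<p : 1 < p) where

  *-inj-≤ : ∀ {c v x} → ¬ p ∣ c → x < p → v ≤ x → (c * v) % p ≡ (c * x) % p → v ≡ x
  *-inj-≤ {c} {v} {x} p∤c x<p v≤x e with euclidsLemma c (x ∸ v) pr (subst (p ∣_) (sym (*-distribˡ-∸ c x v)) (%-≡⇒∣∸ p e))
  ... | inj₁ d = ⊥-elim (p∤c d)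
  ... | inj₂ d with pos-or-0 (x ∸ v)
  ...   | inj₁ z   = ≤-antisym v≤x (m∸n≡0⇒m≤n z)
  ...   | inj₂ pos = ⊥-elim (p∤small pos (≤-<-trans (m∸n≤m x v) x<p) d)

  *-inj : ∀ {c v x} → ¬ p ∣ c → v < p → x < p → (c * v) % p ≡ (c * x) % p → v ≡ x
  *-inj {c} {v} {x} p∤c v<p x<p e with ≤-total v x
  ... | inj₁ le = *-inj-≤ {c} p∤c x<p le e
  ... | inj₂ le = sym (*-inj-≤ {c} p∤c v<p le (sym e))

  0<p : 0 < p
  0<p = ≤-trans (s≤s z≤n) 1<p

  nz-scale : ∀ {c v} → ¬ p ∣ c → v < p → nz ((c * v) % p) ≡ nz v
  nz-scale {c} {zero}  p∤c v<p = cong nz (trans (cong (_% p) (*-zeroʳ c)) (m<n⇒m%n≡m 0<p))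
  nz-scale {c} {suc v} p∤c v<p with pos-or-0 ((c * suc v) % p)
  ... | inj₂ pos = nz-pos pos
  ... | inj₁ e with euclidsLemma c (suc v) pr (m%n≡0⇒n∣m (c * suc v) p e)
  ...   | inj₁ d = ⊥-elim (p∤c d)
  ...   | inj₂ d = ⊥-elim (p∤small (s≤s z≤n) v<p d)

  inverse : ∀ {j} → 1 ≤ j → j < p → ∃[ c ] (c * j) % p ≡ 1
  inverse {suc j} _ j<p with coprime-Bézout (prime⇒coprime pr j<p)
  ... | Bézout.-+ x y eq = y , trans (cong (_% p) (sym eq)) (trans ([m+kn]%n≡m%n 1 x p) (m<n⇒m%n≡m 1<p))
  ... | Bézout.+- x y eq with y * suc j in eq′
  ...   | zero  = ⊥-elim (<⇒≢ 1<p (sym (∣1⇒≡1 (divides x eq))))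
  -- In this Bézout case y times the given residue is 1 + u, congruent to -1. The inverse is thus
  -- -y, written y (1 + u); the product is (1 + u)² = 1 + u (2 + u), where 2 + u = x p.
  ...   | suc u = y * suc u , trans (cong (_% p) sq) (trans ([m+kn]%n≡m%n 1 (u * x) p) (m<n⇒m%n≡m 1<p))
    where
    e1 : ∀ y u j → y * u * j ≡ u * (y * j)
    e1 = solve-∀
    e2 : ∀ u → suc u * suc u ≡ 1 + u * (1 + suc u)
    e2 = solve-∀
    sq : y * suc u * suc j ≡ 1 + u * x * p
    sq = trans (e1 y (suc u) (suc j)) (trans (cong (suc u *_) eq′) (trans (e2 u)
           (cong suc (trans (cong (u *_) eq) (sym (*-assoc u x p))))))

  inverse-unit : ∀ {c j} → (c * j) % p ≡ 1 → ¬ p ∣ c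
  inverse-unit {c} {j} e (divides k refl) = 1+n≢0 (trans (sym e) (trans (cong (_% p) (*-comm (k * p) j))
    (trans (cong (_% p) (sym (*-assoc j k p))) (m*n%n≡0 (j * k) p))))

  negv : ℕ → ℕ
  negv zero    = 0
  negv (suc v) = p ∸ suc v

  negv-< : ∀ {v} → v < p → negv v < p
  negv-< {zero}  _   = 0<p
  negv-< {suc v} v<p = ∸-monoʳ-< {p} (s≤s z≤n) (<⇒≤ v<p)

  negv-+ : ∀ {v} → v < p → v + negv v ≡ p * nz v
  negv-+ {zero}  _   = sym (*-zeroʳ p)
  negv-+ {suc v} v<p = trans (m+[n∸m]≡n (<⇒≤ v<p)) (sym (*-identityʳ p))

  negv-pos : ∀ {v} → 1 ≤ v → negv v ≡ p ∸ v
  negv-pos {suc v} _ = refl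

  nz-negv : ∀ {v} → v < p → nz (negv v) ≡ nz v
  nz-negv {zero}  _   = refl
  nz-negv {suc v} v<p = nz-pos (m<n⇒0<n∸m v<p)

  p∸-inv : ∀ {j} → j < p → p ∸ (p ∸ j) ≡ j
  p∸-inv j<p = m∸[m∸n]≡n (<⇒≤ j<p)

  δ-negv : ∀ {v j} → v < p → 1 ≤ j → j < p → δ (negv v) j ≡ δ v (p ∸ j)
  δ-negv {zero}  {suc j} _ _ j<p = trans (δ-≢ {0} {suc j} (λ ())) (sym (δ-≢ (λ e → <⇒≢ (m<n⇒0<n∸m j<p) e)))
  δ-negv {suc v} v<p _ j<p = δ-cong (λ e → trans (sym (p∸-inv v<p)) (cong (p ∸_) e))
                                    (λ e → trans (cong (p ∸_) e) (p∸-inv j<p))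

  δ-scale : ∀ {c v x y} → ¬ p ∣ c → v < p → x < p → (c * x) % p ≡ y → δ ((c * v) % p) y ≡ δ v x
  δ-scale {c} p∤c v<p x<p refl = δ-cong (*-inj {c} p∤c v<p x<p) (λ e → cong (λ z → (c * z) % p) e)

-- Dual code words lifted to natural numbers

nz-bit* : ∀ b v → nz (bit b * v) ≡ bit b * nz v
nz-bit* true  v = trans (cong nz (*-identityˡ v)) (sym (*-identityˡ (nz v)))
nz-bit* false v = refl

bit*-pos : ∀ b v → 1 ≤ bit b * v → T b × bit b * v ≡ v
bit*-pos true v _ = tt , *-identityˡ v

module DualWords (p : ℕ) .{{_ : NonZero p}} (pr : Prime p) (7≤p : 7 ≤ p) (Π : ProjectivePlane (p * p)) where

  1<p : 1 < p
  1<p = ≤-trans lit 7≤p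

  open PlaneCounting {p * p} {{m*n≢0 p p}} Π public
  open Residues p pr 1<p public

  q : ℕ
  q = p * p

  record DualWord : Set where
    field
      val   : Pt → ℕ
      val<p : ∀ Q → val Q < p
      quo   : Pt → ℕ
      dual  : ∀ ℓ → onLine ℓ val ≡ quo ℓ * p

  open DualWord public

  mkWord : (v : Pt → ℕ) → (∀ Q → v Q < p) → (∀ ℓ → p ∣ onLine ℓ v) → DualWord
  mkWord v v<p d = record
    { val = v ; val<p = v<p ; quo = λ ℓ → quotient (d ℓ) ; dual = λ ℓ → _∣_.equality (d ℓ) }

  is : DualWord → ℕ → Pt → ℕ
  is W j Q = δ (val W Q) j

  supp : DualWord → Pt → ℕ
  supp W Q = nz (val W Q)

  cnt : DualWord → ℕ → Pt → ℕ
  cnt W j ℓ = onLine ℓ (is W j)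

  size : DualWord → Pt → ℕ
  size W ℓ = onLine ℓ (supp W)

  cls : DualWord → ℕ → ℕ
  cls W j = sumFin (is W j)

  wt : DualWord → ℕ
  wt W = sumFin (supp W)

  tot : DualWord → ℕ
  tot W = sumFin (val W)

  Has : DualWord → ℕ → Set
  Has W j = ∃[ P ] val W P ≡ j

  has-cls : ∀ {W j} → Has W j → 1 ≤ cls W j
  has-cls {W} {j} (P , e) = ≤-trans (≤-reflexive (sym (δ-≡ e))) (term≤sum (is W j) P)

  cls-has : ∀ {W j} → 1 ≤ cls W j → Has W j
  cls-has {W} {j} h with sum-pos (is W j) h
  ... | P , le = P , δ-pos le

  has? : ∀ W j → Dec (Has W j)
  has? W j with pos-or-0 (cls W j)
  ... | inj₂ pos = yes (cls-has {W} pos)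
  ... | inj₁ z   = no (λ h → 1+n≰n (subst (1 ≤_) z (has-cls {W} h)))

  through-cnt : ∀ W j P → through P (cnt W j) ≡ cls W j + q * δ (val W P) j
  through-cnt W j P = through-onLine P (is W j)

  through-size : ∀ W P → through P (size W) ≡ wt W + q * nz (val W P)
  through-size W P = through-onLine P (supp W)

  through-quo : ∀ W P → through P (quo W) * p ≡ tot W + q * val W P
  through-quo W P = trans (*-comm _ p) (trans (sym (wsum-*ˡ (I P) p (quo W)))
    (trans (wsum-cong (I P) (λ ℓ → trans (*-comm p (quo W ℓ)) (sym (dual W ℓ)))) (through-onLine P (val W))))

  cnt-pos : ∀ W {P ℓ j} → T (I P ℓ) → val W P ≡ j → 1 ≤ cnt W j ℓ
  cnt-pos W {P} {ℓ} {j} t e = ≤-trans (≤-reflexive (sym (δ-≡ e))) (term≤wsum (pts ℓ) (is W j) P t)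

  cnt-point : ∀ W {j ℓ} → 1 ≤ cnt W j ℓ → ∃[ P ] (T (I P ℓ) × val W P ≡ j)
  cnt-point W {j} {ℓ} h with wsum-pos (pts ℓ) (is W j) h
  ... | P , t , le = P , t , δ-pos le

  quo-pos : ∀ W {P ℓ} → T (I P ℓ) → 1 ≤ val W P → 1 ≤ quo W ℓ
  quo-pos W {P} {ℓ} t h with quo W ℓ | dual W ℓ
  ... | suc _ | _ = s≤s z≤n
  ... | zero  | e = ⊥-elim (1+n≰n (≤-trans h (≤-trans (term≤wsum (pts ℓ) (val W) P t) (≤-reflexive e))))

  -- The negated word and scaled words

  abstract
    neg-dual : ∀ W ℓ → p ∣ onLine ℓ (λ Q → negv (val W Q))
    neg-dual W ℓ = ∣m+n∣m⇒∣n (subst (p ∣_) (sym neg-sum) (m∣m*n (size W ℓ))) (divides (quo W ℓ) (dual W ℓ))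
      where
      neg-sum : onLine ℓ (val W) + onLine ℓ (λ Q → negv (val W Q)) ≡ p * size W ℓ
      neg-sum = trans (sym (wsum-+ (pts ℓ) (val W) (λ Q → negv (val W Q))))
        (trans (wsum-cong (pts ℓ) (λ Q → negv-+ (val<p W Q))) (wsum-*ˡ (pts ℓ) p (supp W)))

  neg : DualWord → DualWord
  neg W = mkWord (λ Q → negv (val W Q)) (λ Q → negv-< (val<p W Q)) (neg-dual W)

  quo-neg : ∀ W ℓ → quo W ℓ + quo (neg W) ℓ ≡ size W ℓ
  quo-neg W ℓ = *-cancelʳ-≡ _ _ p (trans (*-distribʳ-+ p (quo W ℓ) (quo (neg W) ℓ))
    (trans (cong₂ _+_ (sym (dual W ℓ)) (sym (dual (neg W) ℓ)))
    (trans (sym (wsum-+ (pts ℓ) (val W) (val (neg W))))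
    (trans (wsum-cong (pts ℓ) (λ Q → negv-+ (val<p W Q)))
    (trans (wsum-*ˡ (pts ℓ) p (supp W)) (*-comm p (size W ℓ)))))))

  tot-neg : ∀ W → tot W + tot (neg W) ≡ p * wt W
  tot-neg W = trans (sym (sum-+ (val W) (val (neg W)))) (trans (sum-cong {N} (λ Q → negv-+ (val<p W Q)))
    (sum-*ˡ p (supp W)))

  size-neg : ∀ W ℓ → size (neg W) ℓ ≡ size W ℓ
  size-neg W ℓ = wsum-cong (pts ℓ) (λ Q → nz-negv (val<p W Q))

  wt-neg : ∀ W → wt (neg W) ≡ wt W
  wt-neg W = sum-cong {N} (λ Q → nz-negv (val<p W Q))

  cnt-neg : ∀ W {j} ℓ → 1 ≤ j → j < p → cnt (neg W) j ℓ ≡ cnt W (p ∸ j) ℓ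
  cnt-neg W ℓ 1≤j j<p = wsum-cong (pts ℓ) (λ Q → δ-negv (val<p W Q) 1≤j j<p)

  cls-neg : ∀ W {j} → 1 ≤ j → j < p → cls (neg W) j ≡ cls W (p ∸ j)
  cls-neg W 1≤j j<p = sum-cong {N} (λ Q → δ-negv (val<p W Q) 1≤j j<p)

  has-neg : ∀ W {j} → 1 ≤ j → Has W j → Has (neg W) (p ∸ j)
  has-neg W 1≤j (P , refl) = P , negv-pos 1≤j

  abstract
    scale-dual : ∀ c W ℓ → p ∣ onLine ℓ (λ Q → (c * val W Q) % p)
    scale-dual c W ℓ = ∣m+n∣m⇒∣n (divides (c * quo W ℓ) split) (n∣m*n (onLine ℓ (λ Q → (c * val W Q) / p)))
      where
      split : onLine ℓ (λ Q → (c * val W Q) / p) * p + onLine ℓ (λ Q → (c * val W Q) % p) ≡ c * quo W ℓ * p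
      split = trans (cong (_+ onLine ℓ (λ Q → (c * val W Q) % p)) (trans (*-comm _ p)
            (trans (sym (wsum-*ˡ (pts ℓ) p (λ Q → (c * val W Q) / p))) (wsum-cong (pts ℓ) (λ Q → *-comm p ((c * val W Q) / p))))))
        (trans (+-comm _ (onLine ℓ (λ Q → (c * val W Q) % p)))
        (trans (sym (wsum-+ (pts ℓ) (λ Q → (c * val W Q) % p) (λ Q → (c * val W Q) / p * p)))
        (trans (wsum-cong (pts ℓ) (λ Q → sym (m≡m%n+[m/n]*n (c * val W Q) p)))
        (trans (wsum-*ˡ (pts ℓ) c (val W)) (trans (cong (c *_) (dual W ℓ)) (sym (*-assoc c (quo W ℓ) p)))))))

  scale : ℕ → DualWord → DualWord
  scale c W = mkWord (λ Q → (c * val W Q) % p) (λ Q → m%n<n (c * val W Q) p) (scale-dual c W)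

  wt-scale : ∀ {c} W → ¬ p ∣ c → wt (scale c W) ≡ wt W
  wt-scale {c} W p∤c = sum-cong {N} (λ Q → nz-scale {c} p∤c (val<p W Q))

  cls-scale : ∀ {c x y} W → ¬ p ∣ c → x < p → (c * x) % p ≡ y → cls (scale c W) y ≡ cls W x
  cls-scale {c} W p∤c x<p e = sum-cong {N} (λ Q → δ-scale {c} p∤c (val<p W Q) x<p e)

  -- The last point of a short line

  second-point : ∀ W {P ℓ} → size W ℓ ≡ 2 → T (I P ℓ) → 1 ≤ val W P →
                 ∃[ R ] (T (I R ℓ) × val W R ≡ p ∸ val W P)
  second-point W {P} {ℓ} sz t pos = R , proj₁ gR , trans (sym (proj₂ gR)) (trans (sym (proj₂ wR)) eqR)
    where
    g : Pt → ℕ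
    g Q = bit (I Q ℓ) * val W Q
    gP : g P ≡ val W P
    gP = trans (cong (_* val W P) (bit-T t)) (*-identityˡ _)
    one : sumFin (λ Q → nz (without P g Q)) ≡ 1
    one = suc-injective (trans (cong (_+ sumFin (λ Q → nz (without P g Q))) (sym (trans (cong nz gP) (nz-pos pos))))
      (trans (sum-nz-without P g) (trans (sum-cong {N} (λ Q → nz-bit* (I Q ℓ) (val W Q))) sz)))
    single = sum-single (without P g) one
    R = proj₁ single
    -- The quotients of the word and of its negative are both positive and add up to the size 2.
    quo1 : quo W ℓ ≡ 1
    quo1 = ≤-antisym (+-cancelʳ-≤ 1 _ _ (≤-trans (+-monoʳ-≤ (quo W ℓ) npos) (≤-reflexive (trans (quo-neg W ℓ) sz)))) (quo-pos W t pos)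
      where
      npos : 1 ≤ quo (neg W) ℓ
      npos = quo-pos (neg W) t (nz-pos⁻¹ (≤-reflexive (sym (trans (nz-negv (val<p W P)) (nz-pos pos)))))
    rest : sumFin (without P g) ≡ p ∸ val W P
    rest = trans (sym (m+n∸m≡n (val W P) _)) (cong (_∸ val W P) (trans (cong (_+ sumFin (without P g)) (sym gP))
      (trans (sum-without P g) (trans (dual W ℓ) (trans (cong (_* p) quo1) (*-identityˡ p))))))
    eqR = trans (proj₂ single) rest
    wR = without-pos P g R (subst (1 ≤_) (sym eqR) (m<n⇒0<n∸m (val<p W P)))
    gR = bit*-pos (I R ℓ) (val W R) (subst (1 ≤_) (trans (sym eqR) (proj₂ wR)) (m<n⇒0<n∸m (val<p W P)))

  third-point : ∀ W {P Q ℓ} → size W ℓ ≡ 3 → P ≢ Q → T (I P ℓ) → T (I Q ℓ) → 1 ≤ val W P → 1 ≤ val W Q →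
                ∃[ R ] (val W P + (val W Q + val W R) ≡ quo W ℓ * p)
  third-point W {P} {Q} {ℓ} sz P≢Q tP tQ posP posQ = R , trans (cong₂ _+_ (sym gP) (cong₂ _+_ (sym hQ) (trans valR (proj₂ single))))
      (trans (cong (g P +_) (sum-without Q h)) (trans (sum-without P g) (dual W ℓ)))
    where
    g h : Pt → ℕ
    g R = bit (I R ℓ) * val W R
    h = without P g
    gP : g P ≡ val W P
    gP = trans (cong (_* val W P) (bit-T tP)) (*-identityˡ _)
    hQ : h Q ≡ val W Q
    hQ = trans (without-other g (λ e → P≢Q (sym e))) (trans (cong (_* val W Q) (bit-T tQ)) (*-identityˡ _))
    nzs : sumFin (λ R → nz (g R)) ≡ 3
    nzs = trans (sum-cong {N} (λ R → nz-bit* (I R ℓ) (val W R))) sz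
    two : sumFin (λ R → nz (h R)) ≡ 2
    two = suc-injective (trans (cong (_+ sumFin (λ R → nz (h R))) (sym (trans (cong nz gP) (nz-pos posP)))) (trans (sum-nz-without P g) nzs))
    one : sumFin (λ R → nz (without Q h R)) ≡ 1
    one = suc-injective (trans (cong (_+ sumFin (λ R → nz (without Q h R))) (sym (trans (cong nz hQ) (nz-pos posQ)))) (trans (sum-nz-without Q h) two))
    single = sum-single (without Q h) one
    R = proj₁ single
    pos : 1 ≤ without Q h R
    pos with pos-or-0 (without Q h R)
    ... | inj₂ le = le
    ... | inj₁ z  = ⊥-elim (1+n≢0 (trans (sym one) (sum-zero {N} (λ S → cong nz (n≤0⇒n≡0 (≤-trans
           (term≤sum (without Q h) S) (≤-reflexive (trans (sym (proj₂ single)) z))))))))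
    w1 = without-pos Q h R pos
    w2 = without-pos P g R (subst (1 ≤_) (proj₂ w1) pos)
    w3 = bit*-pos (I R ℓ) (val W R) (subst (1 ≤_) (trans (proj₂ w1) (proj₂ w2)) pos)
    valR : val W R ≡ without Q h R
    valR = sym (trans (proj₂ w1) (trans (proj₂ w2) (proj₂ w3)))

-- Excesses and the resulting bounds on class sizes

private
  arith-j : ∀ t p j → t * p + p * p * j ≡ (t + j * p) * p
  arith-j = solve-∀

  arith-q : ∀ g q j → g + q * suc j ≡ g + q * 1 + q * j
  arith-q = solve-∀

  arith-Esum : ∀ {G G' w p E E'} → G + p * p ≡ (suc (p * p) + E) * p → G' + p * p ≡ (suc (p * p) + E') * p →
               G + G' ≡ p * w → p * (w + 2 * p) ≡ p * (2 * (p * p) + 2 + (E + E'))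
  arith-Esum {G} {G'} {w} {p} {E} {E'} e1 e2 e3 = trans (*-distribˡ-+ p w (2 * p)) (trans (cong (_+ p * (2 * p)) (sym e3))
    (trans (a1 G G' p) (trans (cong₂ _+_ e1 e2) (a2 p E E'))))
    where
    a1 : ∀ G G' p → G + G' + p * (2 * p) ≡ (G + p * p) + (G' + p * p)
    a1 = solve-∀
    a2 : ∀ p E E' → (suc (p * p) + E) * p + (suc (p * p) + E') * p ≡ p * (2 * (p * p) + 2 + (E + E'))
    a2 = solve-∀

  arith-3lines : ∀ {A B w} q → A ≡ suc q → B ≡ w + q * 1 → 3 * A + 0 ≤ 1 * B + 0 → w ≤ 2 * q + 2 → ⊥
  arith-3lines {w = w} q refl refl le le' = ≤-absurd 0 (le ⊕ le') (solve (w ∷ q ∷ []))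

  arith-f : ∀ {A B C D} q E w s → A ≡ suc q + E + 0 → B ≡ suc q → C ≡ w + q * 1 → D ≡ s + q * 0 →
            1 * A + (2 * B + 0) ≤ 1 * C + (1 * D + 0) → E + (2 * q + 3) ≤ w + s
  arith-f q E w s refl refl refl refl le = ≤-from-sum 0 le (solve (q ∷ E ∷ w ∷ s ∷ []))

  -- r = 1 + r₁, p = 1 + p₁: a line with m points of value p₁ and mᵣ ≥ 1 points of value r.
  arith-b : ∀ {m mr t} p₁ r₁ → suc r₁ ≤ p₁ → p₁ * m + (suc r₁ * mr + 0) ≤ t * suc p₁ → 1 ≤ mr → r₁ * m + suc r₁ ≤ suc r₁ * t
  arith-b {m} {mr} {t} p₁ r₁ r≤p₁ le 1≤mr with m <? suc r₁
  ... | yes m<r with t ≤? m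
  ...   | yes t≤m = ⊥-elim (≤-absurd (r₁ ∸ m) (≤-trans (le ⊕ (t≤m ⊙ (suc p₁) ⊕ (suc r₁) ⊗ 1≤mr)) ≤-refl)
                     (trans (cong (λ z → p₁ * m + (suc z * mr + 0) + (t * suc p₁ + suc z * 1)) (sym (m+[n∸m]≡n (s≤s⁻¹ m<r))))
                       (trans (e m (r₁ ∸ m) mr t p₁) (cong (λ z → suc (t * suc p₁ + (m * suc p₁ + suc z * mr) + (r₁ ∸ m))) (m+[n∸m]≡n (s≤s⁻¹ m<r))))))
    where
    e : ∀ m d mr t p₁ → p₁ * m + (suc (m + d) * mr + 0) + (t * suc p₁ + suc (m + d) * 1)
                      ≡ suc (t * suc p₁ + (m * suc p₁ + suc (m + d) * mr) + d)
    e = solve-∀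
  ...   | no t≰m = ≤-from-sum m ((suc r₁) ⊗ (≰⇒> t≰m)) (solve (m ∷ r₁ ∷ t ∷ []))
  arith-b {m} {mr} {t} p₁ r₁ r≤p₁ le 1≤mr | no m≮r with suc r₁ * t <? r₁ * m + suc r₁
  ... | no ¬lt = ≮⇒≥ ¬lt
  ... | yes lt with m≤n⇒∃[o]m+o≡n (≮⇒≥ m≮r) | m≤n⇒∃[o]m+o≡n r≤p₁
  ...   | d , refl | g , refl = ⊥-elim (≤-absurd (suc g * d + suc r₁ + g) ((suc r₁) ⊗ (le ⊕ (suc r₁) ⊗ 1≤mr) ⊕ lt ⊙ (suc (suc r₁ + g))) (solve (r₁ ∷ d ∷ g ∷ mr ∷ t ∷ [])))

  arith-bsum : ∀ {A B C q E p r s} → A ≡ s + q * 0 → B ≡ suc q → C ≡ suc q + E + r * p →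
               r * A + (suc r * B + 0) ≤ suc r * C + 0 → r * s ≤ suc r * (E + r * p)
  arith-bsum {q = q} {E} {p} {r} {s} refl refl refl le = ≤-from-sum 0 le (solve (q ∷ E ∷ p ∷ r ∷ s ∷ []))

  last-one : ∀ {p x} → 1 ≤ p → p ∸ 1 + x ≡ p → x ≡ 1
  last-one {p} {x} 1≤p e = +-cancelˡ-≡ (p ∸ 1) _ _ (trans e (sym (m∸n+n≡m 1≤p)))

module Excesses (p : ℕ) .{{_ : NonZero p}} (pr : Prime p) (7≤p : 7 ≤ p) (Π : ProjectivePlane (p * p)) where
  open DualWords p pr 7≤p Π public

  p-1 : ℕ
  p-1 = p ∸ 1

  suc-p-1 : suc p-1 ≡ p
  suc-p-1 = m+[n∸m]≡n 0<p

  1<p-1 : 1 < p-1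
  1<p-1 = s≤s⁻¹ (≤-trans (≤-trans lit 7≤p) (≤-reflexive (sym suc-p-1)))

  p-1<p : p-1 < p
  p-1<p = ≤-reflexive suc-p-1

  -- If W takes the value 1, then Σ (quo W ℓ ∸ 1) over the lines ℓ through a point of value 1.
  exc : DualWord → ℕ
  exc W = (tot W + q) / p ∸ suc q

  lines≤through-quo : ∀ W {P} → 1 ≤ val W P → suc q ≤ through P (quo W)
  lines≤through-quo W {P} pos = ≤-trans (≤-reflexive (sym (through-1 P))) (wsum-mono (I P) (λ ℓ t → quo-pos W t pos))

  private
    through-quo-1 : ∀ W {P} → val W P ≡ 1 → through P (quo W) * p ≡ tot W + q * 1
    through-quo-1 W {P} e = trans (through-quo W P) (cong (λ v → tot W + q * v) e)

    exc-through : ∀ W {P} → val W P ≡ 1 → through P (quo W) ≡ suc q + exc W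
    exc-through W {P} e = sym (trans (cong (λ z → suc q + (z ∸ suc q)) (trans (cong (_/ p)
      (trans (cong (tot W +_) (sym (*-identityʳ q))) (sym (through-quo-1 W e)))) (m*n/n≡m (through P (quo W)) p)))
      (m+[n∸m]≡n (lines≤through-quo W (≤-reflexive (sym e)))))

  -- The sum of the quotients times p is `tot W + q * val W P`, and q = p p. So the sum depends on P
  -- through its value only and rises by p with every unit of that value.
  exc-quo : ∀ W → Has W 1 → ∀ {P j} → val W P ≡ suc j → through P (quo W) ≡ suc q + exc W + j * p
  exc-quo W (P₁ , e₁) {P} {j} e = *-cancelʳ-≡ _ _ p (trans (through-quo W P) (trans (cong (λ v → tot W + q * v) e)
    (trans (arith-q (tot W) q j) (trans (cong (_+ q * j) (trans (sym (through-quo-1 W e₁)) (cong (_* p) (exc-through W e₁))))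
    (arith-j (suc q + exc W) p j)))))

  exc-tot : ∀ W → Has W 1 → tot W + q ≡ (suc q + exc W) * p
  exc-tot W (P₁ , e₁) = trans (cong (tot W +_) (sym (*-identityʳ q))) (trans (sym (through-quo-1 W e₁)) (cong (_* p) (exc-through W e₁)))

  weight-exc : ∀ W → Has W 1 → Has (neg W) 1 → wt W + 2 * p ≡ 2 * q + 2 + (exc W + exc (neg W))
  weight-exc W h h' = *-cancelˡ-≡ _ _ p (arith-Esum {tot W} {tot (neg W)} {wt W} {p} {exc W} {exc (neg W)} (exc-tot W h) (exc-tot (neg W) h') (tot-neg W))

  size≥2 : ∀ W {P ℓ} → T (I P ℓ) → 1 ≤ val W P → 2 ≤ size W ℓ
  size≥2 W {P} {ℓ} t pos = ≤-trans ((quo-pos W t pos) ⊕ (quo-pos (neg W) t npos)) (≤-reflexive (quo-neg W ℓ))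
    where
    npos : 1 ≤ val (neg W) P
    npos = nz-pos⁻¹ (≤-reflexive (sym (trans (nz-negv (val<p W P)) (nz-pos pos))))

  -- If -j is not a value, no line through a point of value j has just two support points. Three on
  -- each of the q + 1 lines give weight at least 2q + 3.
  has-opposite : ∀ W {j} → wt W ≤ 2 * q + 2 → 1 ≤ j → Has W j → Has W (p ∸ j)
  has-opposite W {j} small 1≤j (P , refl) with has? W (p ∸ j)
  ... | yes h = h
  ... | no ¬h = ⊥-elim (arith-3lines q (through-1 P) (trans (through-size W P) (cong (λ z → wt W + q * z) (nz-pos 1≤j)))
                 (comb-mono (I P) ((3 , (λ _ → 1)) ∷ []) ((1 , size W) ∷ []) three) small)
    where
    go : ∀ ℓ k → T (I P ℓ) → size W ℓ ≡ k → 2 ≤ k → 3 ≤ k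
    go ℓ (suc (suc (suc k))) _ _  _ = lit
    go ℓ 2                   t eq _ = ⊥-elim (¬h (let (R , _ , e) = second-point W {P} {ℓ} eq t 1≤j in R , e))
    go ℓ 1                   _ _  (s≤s ())
    three : ∀ ℓ → T (I P ℓ) → 3 * 1 + 0 ≤ 1 * size W ℓ + 0
    three ℓ t = ≤-trans (go ℓ (size W ℓ) t refl (size≥2 W t 1≤j)) (≤-reflexive (sym (trans (+-identityʳ _) (*-identityˡ _))))

  val-1⇒neg : ∀ W {P} → val W P ≡ 1 → val (neg W) P ≡ p-1
  val-1⇒neg W e = cong negv e

  -- If the negated values on ℓ sum to p only, then P already supplies p - 1, and the missing 1 must
  -- be a single point of value -1 in W.
  line-opposite : ∀ W {P ℓ} → T (I P ℓ) → val W P ≡ 1 → 2 ≤ quo (neg W) ℓ + cnt W p-1 ℓ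
  line-opposite W {P} {ℓ} t e with quo (neg W) ℓ in eq
  ... | suc (suc _) = lit
  ... | zero = ⊥-elim (1+n≰n (≤-trans (quo-pos (neg W) t (≤-trans (<⇒≤ 1<p-1) (≤-reflexive (sym (val-1⇒neg W e))))) (≤-reflexive eq)))
  ... | suc zero = s≤s (≤-trans (cnt-pos (neg W) {proj₁ found} {ℓ} (proj₁ gR) valR) (≤-reflexive (cnt-neg W ℓ ≤-refl 1<p)))
    where
    g : Pt → ℕ
    g Q = bit (I Q ℓ) * val (neg W) Q
    rest : sumFin (without P g) ≡ 1
    rest = last-one 0<p (trans (cong (_+ sumFin (without P g)) (sym (trans (cong (_* val (neg W) P) (bit-T t)) (trans (*-identityˡ _) (val-1⇒neg W e)))))
      (trans (sum-without P g) (trans (dual (neg W) ℓ) (trans (cong (_* p) eq) (*-identityˡ p)))))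
    found = sum-pos (without P g) (≤-reflexive (sym rest))
    w1 = without-pos P g (proj₁ found) (proj₂ found)
    gR = bit*-pos (I (proj₁ found) ℓ) (val (neg W) (proj₁ found)) (subst (1 ≤_) (proj₂ w1) (proj₂ found))
    valR : val (neg W) (proj₁ found) ≡ 1
    valR = trans (sym (trans (proj₂ w1) (proj₂ gR))) (≤-antisym (≤-trans (term≤sum (without P g) (proj₁ found)) (≤-reflexive rest)) (proj₂ found))

  -- `line-opposite` with the quotient of `neg W` eliminated by `quo-neg`; summed through P it
  -- bounds the class of -1 from below.
  line-quo : ∀ W {P ℓ} → T (I P ℓ) → val W P ≡ 1 → 1 * quo W ℓ + (2 * 1 + 0) ≤ 1 * size W ℓ + (1 * cnt W p-1 ℓ + 0)
  line-quo W {P} {ℓ} t e = ≤-from-sum 0 (line-opposite W t e)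
      (trans (a (quo W ℓ) (quo (neg W) ℓ) (cnt W p-1 ℓ)) (cong (λ z → 1 * z + (1 * cnt W p-1 ℓ + 0) + 2) (quo-neg W ℓ)))
    where
    a : ∀ x y c → 1 * x + (2 * 1 + 0) + (y + c) + 0 ≡ 1 * (x + y) + (1 * c + 0) + 2
    a = solve-∀

  through-size-1 : ∀ W {P j} → val W P ≡ suc j → through P (size W) ≡ wt W + q * 1
  through-size-1 W {P} e = trans (through-size W P) (cong (λ z → wt W + q * nz z) e)

  through-cnt-≢ : ∀ W {P} j → val W P ≢ j → through P (cnt W j) ≡ cls W j + q * 0
  through-cnt-≢ W {P} j ne = trans (through-cnt W j P) (cong (λ z → cls W j + q * z) (δ-≢ ne))

  through-cnt-≡ : ∀ W {P} j → val W P ≡ j → through P (cnt W j) ≡ cls W j + q * 1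
  through-cnt-≡ W {P} j e = trans (through-cnt W j P) (cong (λ z → cls W j + q * z) (δ-≡ e))

  exc-1 : ∀ W → ∀ {P} → val W P ≡ 1 → through P (quo W) ≡ suc q + exc W + 0
  exc-1 W {P} e = exc-quo W (P , e) e

  1≢p-1 : 1 ≢ p-1
  1≢p-1 = <⇒≢ 1<p-1

  cls-lower : ∀ W → Has W 1 → exc W + (2 * q + 3) ≤ wt W + cls W p-1
  cls-lower W (P , e) = arith-f q (exc W) (wt W) (cls W p-1) (exc-1 W e) (through-1 P) (through-size-1 W e)
    (through-cnt-≢ W p-1 (λ x → 1≢p-1 (trans (sym e) x)))
    (comb-mono (I P) ((1 , quo W) ∷ (2 , (λ _ → 1)) ∷ []) ((1 , size W) ∷ (1 , cnt W p-1) ∷ []) (λ ℓ t → line-quo W t e))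

  -- The class of -1 is viewed from a point of value r + 1. A line through it with m points of value
  -- -1 has quotient at least 1 + m r / (r + 1), while the sum of these quotients is known from
  -- `exc-quo`.
  cls-upper : ∀ W → Has W 1 → ∀ {P} r → val W P ≡ suc r → suc r < p-1 → r * cls W p-1 ≤ suc r * (exc W + r * p)
  cls-upper W h {P} r e lt = arith-bsum {q = q} {exc W} {p} {r} {cls W p-1} (through-cnt-≢ W p-1 (λ x → <⇒≢ lt (trans (sym e) x))) (through-1 P) (exc-quo W h e)
    (comb-mono (I P) ((r , cnt W p-1) ∷ (suc r , (λ _ → 1)) ∷ []) ((suc r , quo W) ∷ [])
      (λ ℓ t → ≤-trans (≤-reflexive (cong (r * cnt W p-1 ℓ +_) (trans (+-identityʳ _) (*-identityʳ (suc r)))))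
        (≤-trans (arith-b {m = cnt W p-1 ℓ} {mr = cnt W (suc r) ℓ} {t = quo W ℓ} p-1 r (<⇒≤ lt)
          (≤-trans (comb-mono (pts ℓ) ((p-1 , (is W p-1)) ∷ (suc r , (is W (suc r))) ∷ []) ((1 , val W) ∷ [])
             (λ Q _ → pointwise (val W Q)))
             (≤-reflexive (trans (+-identityʳ _) (trans (*-identityˡ _) (trans (dual W ℓ) (cong (quo W ℓ *_) (sym suc-p-1)))))))
          (cnt-pos W t e)) (≤-reflexive (sym (+-identityʳ _))))))
    where
    pointwise : ∀ v → p-1 * δ v p-1 + (suc r * δ v (suc r) + 0) ≤ 1 * v + 0
    pointwise v with v ≟ p-1
    ... | yes refl = ≤-reflexive (trans (cong₂ (λ a b → p-1 * a + (suc r * b + 0)) (δ-≡ {p-1} refl) (δ-≢ (λ x → <⇒≢ lt (sym x))))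
                       (a p-1 (suc r)))
      where
      a : ∀ x y → x * 1 + (y * 0 + 0) ≡ 1 * x + 0
      a = solve-∀
    ... | no ne with v ≟ suc r
    ...   | yes refl = ≤-reflexive (trans (cong₂ (λ a b → p-1 * a + (suc r * b + 0)) (δ-≢ ne) (δ-≡ {suc r} refl)) (a p-1 (suc r)))
      where
      a : ∀ x y → x * 0 + (y * 1 + 0) ≡ 1 * y + 0
      a = solve-∀
    ...   | no ne' = ≤-trans (≤-reflexive (trans (cong₂ (λ a b → p-1 * a + (suc r * b + 0)) (δ-≢ ne) (δ-≢ ne')) (a p-1 (suc r)))) z≤n
      where
      a : ∀ x y → x * 0 + (y * 0 + 0) ≡ 0
      a = solve-∀

  through-excess : ∀ W {P} → val W P ≡ 1 → through P (λ m → quo W m ∸ 1) ≡ exc W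
  through-excess W {P} e = +-cancelˡ-≡ (suc q) _ _ (trans (cong (_+ through P (λ m → quo W m ∸ 1)) (sym (through-1 P)))
      (trans (sym (wsum-+ (I P) (λ _ → 1) (λ m → quo W m ∸ 1)))
      (trans (≤-antisym (wsum-mono (I P) (λ m t → ≤-reflexive (m+[n∸m]≡n (pos m t)))) (wsum-mono (I P) (λ m t → ≤-reflexive (sym (m+[n∸m]≡n (pos m t))))))
      (trans (exc-1 W e) (+-identityʳ _)))))
    where
    pos : ∀ m → T (I P m) → 1 ≤ quo W m
    pos m t = quo-pos W t (≤-reflexive (sym e))

  quo-upper : ∀ W {P ℓ} → T (I P ℓ) → val W P ≡ 1 → quo W ℓ ≤ 1 + exc W
  quo-upper W {P} {ℓ} t e = ≤-trans (m≤n+m∸n (quo W ℓ) 1)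
    (+-monoʳ-≤ 1 (≤-trans (term≤wsum (I P) (λ m → quo W m ∸ 1) ℓ t) (≤-reflexive (through-excess W e))))

-- The set of values: only ±1, or every residue

private
  arith-gap : ∀ {A B C D} q w sb sa → A ≡ sb + q * 0 → B ≡ suc q → C ≡ w + q * 1 → D ≡ sa + q * 0 →
              1 * A + (9 * B + 0) ≤ 3 * C + (3 * D + 0) → sb + (6 * q + 9) ≤ 3 * w + 3 * sa
  arith-gap q w sb sa refl refl refl refl le = ≤-from-sum 0 le (solve (q ∷ w ∷ sb ∷ sa ∷ []))

  long-line : ∀ {a b k} x → 4 ≤ k → 1 ≤ a → b + a ≤ k → 1 * b + (9 * 1 + 0) ≤ 3 * k + (3 * x + 0)
  long-line {a} {b} {k} x 4≤k 1≤a le = ≤-from-sum (3 * x) (2 ⊗ 4≤k ⊕ 1≤a ⊕ le) (solve (a ∷ b ∷ k ∷ x ∷ []))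

  -- The hypotheses combine to 2p + 4 ≤ 4 (E + E') + 6E ≤ 14, hence p ≤ 5. With E = 2 the right side
  -- would be 20 and p = 7 would survive, which is why E ≤ 1 is demanded.
  arith-close : ∀ {w q E E' x sb} p → 7 ≤ p → sb + (6 * q + 9) ≤ 3 * w + 3 * x → 1 * x ≤ 2 * (E + 1 * p) → 2 * q + 3 ≤ w + sb →
                w + 2 * p ≡ 2 * q + 2 + (E + E') → E + E' ≤ 2 → E ≤ 1 → ⊥
  arith-close {w} {q} {E} {E'} {x} {sb} p 7≤p h1 h2 h3 h4 h5 h6 =
    ≤-absurd 3 (h1 ⊕ 3 ⊗ h2 ⊕ (h3 ⊕ 4 ⊗ (≤-reflexive h4)) ⊕ (4 ⊗ h5 ⊕ 6 ⊗ h6) ⊕ 2 ⊗ 7≤p)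
      (solve (w ∷ q ∷ E ∷ E' ∷ x ∷ sb ∷ p ∷ []))

  -- A line of the negated word through a point of value 1: m₁ ≥ 1 points of value 1, mᵣ of value p - r,
  -- o others, which have values between r and p; p = 2r + 1 + g, r = 1 + r₁.
  arith-tight : ∀ r₁ g {m₁ mr o t} → 1 ≤ t → 1 ≤ m₁ →
    (suc r₁ + 1 + g) * mr + (1 * m₁ + (suc r₁ * o + 0)) ≤ t * (2 * suc r₁ + 1 + g) →
    t * (2 * suc r₁ + 1 + g) ≤ (suc r₁ + 1 + g) * mr + (1 * m₁ + ((2 * suc r₁ + 1 + g) * o + 0)) →
    r₁ * mr + (suc (3 * r₁) * 1 + 0) ≤ 1 * m₁ + (3 * r₁ * t + 0)
  arith-tight r₁ g {m₁} {zero} {o} {suc zero} _ 1≤m₁ _ _ = ≤-from-sum 0 1≤m₁ (solve (r₁ ∷ m₁ ∷ []))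
  arith-tight r₁ g {m₁} {suc zero} {zero} {suc zero} _ _ _ up = ≤-from-sum 0 up (solve (r₁ ∷ g ∷ m₁ ∷ []))
  arith-tight r₁ g {m₁} {suc zero} {suc o} {suc zero} _ 1≤m₁ low _ = ⊥-elim (≤-absurd (suc r₁ * o) (low ⊕ 1≤m₁) (solve (r₁ ∷ g ∷ m₁ ∷ o ∷ [])))
  arith-tight r₁ g {m₁} {suc (suc mr)} {o} {suc zero} _ _ low _ = ⊥-elim (≤-absurd (g + (suc r₁ + 1 + g) * mr + m₁ + suc r₁ * o) low (solve (r₁ ∷ g ∷ m₁ ∷ mr ∷ o ∷ [])))
  arith-tight r₁ g {m₁} {mr} {o} {suc (suc τ)} _ 1≤m₁ low _ with mr + 3 ≤? 3 * suc (suc τ)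
  ... | yes le = ≤-from-sum 0 (r₁ ⊗ le ⊕ 1≤m₁) (solve (r₁ ∷ m₁ ∷ mr ∷ τ ∷ []))
  ... | no ¬le = ⊥-elim (≤-absurd (suc r₁ * τ + 2 * τ + 1 + g * (2 + 2 * τ) + m₁ + suc r₁ * o) (low ⊕ (suc r₁ + 1 + g) ⊗ (≰⇒> ¬le)) (solve (r₁ ∷ g ∷ m₁ ∷ mr ∷ o ∷ τ ∷ [])))

  arith-tightsum : ∀ {A B C D} q E r y x → A ≡ y + q * 0 → B ≡ suc q → C ≡ x + q * 1 → D ≡ suc q + E + 0 →
    r * A + (suc (3 * r) * B + 0) ≤ 1 * C + (3 * r * D + 0) → r * y + 1 ≤ x + 3 * r * E
  arith-tightsum q E r y x refl refl refl refl le = ≤-from-sum 0 le (solve (q ∷ E ∷ r ∷ y ∷ x ∷ []))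

  -- Here r - 1 = 2 + ρ, p = 7 + π, and x, x', y are the sizes of the classes 1, -1, r. To leading
  -- order x' ≤ r p and (r - 1) y ≤ x', so y ≤ r p / (r - 1) ≤ 3p/2, whereas x + 6p ≤ 3y with x at
  -- least about 2p needs y to be about 8p/3.
  arith-gap-final : ∀ {w q E E' x x' y} ρ π → E' + (2 * q + 3) ≤ w + x → (2 + ρ) * x' ≤ suc (2 + ρ) * (E + (2 + ρ) * (7 + π)) →
    (2 + ρ) * y + 1 ≤ x' + 3 * (2 + ρ) * E' → x + (6 * q + 9) ≤ 3 * w + 3 * y →
    w + 2 * (7 + π) ≡ 2 * q + 2 + (E + E') → E + E' ≤ 2 → ⊥
  arith-gap-final {w} {q} {E} {E'} {x} {x'} {y} ρ π hx hb hc hd hw he =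
    ≤-absurd (15 + 14 * π + 34 * ρ + 17 * (ρ * π) + 13 * (ρ * ρ) + 5 * (ρ * ρ * π) + (2 + ρ) * (2 + ρ) * E' + (27 + 33 * ρ + 9 * (ρ * ρ)) * E)
      (((2 + ρ) * (2 + ρ)) ⊗ (hd ⊕ hx ⊕ (4 ⊗ (≤-reflexive hw) ⊕ 13 ⊗ he)) ⊕ (3 * (2 + ρ)) ⊗ hc ⊕ 3 ⊗ hb)
      (e w q E E' x x' y ρ π)
    where
    e : ∀ w q E E' x x' y ρ π →
      (2 + ρ) * (2 + ρ) * (x + (6 * q + 9) + (E' + (2 * q + 3)) + (4 * (w + 2 * (7 + π)) + 13 * (E + E')))
        + 3 * (2 + ρ) * ((2 + ρ) * y + 1) + 3 * ((2 + ρ) * x')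
      ≡ suc ((2 + ρ) * (2 + ρ) * (3 * w + 3 * y + (w + x) + (4 * (2 * q + 2 + (E + E')) + 13 * 2))
        + 3 * (2 + ρ) * (x' + 3 * (2 + ρ) * E') + 3 * (suc (2 + ρ) * (E + (2 + ρ) * (7 + π)))
        + (15 + 14 * π + 34 * ρ + 17 * (ρ * π) + 13 * (ρ * ρ) + 5 * (ρ * ρ * π) + (2 + ρ) * (2 + ρ) * E' + (27 + 33 * ρ + 9 * (ρ * ρ)) * E))
    e = solve-∀

module ValueSet (p : ℕ) .{{_ : NonZero p}} (pr : Prime p) (7≤p : 7 ≤ p) (Π : ProjectivePlane (p * p)) where
  open Excesses p pr 7≤p Π public

  p-odd : ∀ a → p ≢ a + a
  p-odd a e with prime⇒irreducible pr (divides a (trans e (trans (cong (a +_) (sym (+-identityʳ a))) (*-comm 2 a))))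
  ... | inj₁ ()
  ... | inj₂ 2≡p = <⇒≱ lit (subst (7 ≤_) (sym 2≡p) 7≤p)

  Small : DualWord → Set
  Small W = wt W + 2 * p ≤ 2 * q + 4

  small⇒≤ : ∀ {W} → Small W → wt W ≤ 2 * q + 2
  small⇒≤ {W} s = ≤-from-sum 0 (s ⊕ 2 ⊗ 0<p) (e (wt W) q p)
    where
    e : ∀ w q p → w + (2 * q + 4 + 2 * p) + 0 ≡ 2 * q + 2 + (w + 2 * p + 2 * 1)
    e = solve-∀

  small-neg : ∀ {W} → Small W → Small (neg W)
  small-neg {W} s = subst (λ w → w + 2 * p ≤ 2 * q + 4) (sym (wt-neg W)) s

  small-scale : ∀ {W c} → ¬ p ∣ c → Small W → Small (scale c W)
  small-scale {W} {c} u s = subst (λ w → w + 2 * p ≤ 2 * q + 4) (sym (wt-scale {c} W u)) s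

  opposite : ∀ {W j} → Small W → 1 ≤ j → Has W j → Has W (p ∸ j)
  opposite {W} s = has-opposite W (small⇒≤ {W} s)

  has-neg-1 : ∀ {W} → Small W → Has W 1 → Has (neg W) 1
  has-neg-1 {W} s h = subst (Has (neg W)) (p∸-inv 1<p) (has-neg W (<⇒≤ 1<p-1) (opposite {W} s ≤-refl h))

  exc-sum : ∀ {W} → Small W → Has W 1 → wt W + 2 * p ≡ 2 * q + 2 + (exc W + exc (neg W))
  exc-sum {W} s h = weight-exc W h (has-neg-1 {W} s h)

  exc-sum≤2 : ∀ {W} → Small W → Has W 1 → exc W + exc (neg W) ≤ 2
  exc-sum≤2 {W} s h = +-cancelˡ-≤ (2 * q + 2) _ _ (≤-trans (≤-reflexive (sym (exc-sum {W} s h))) (≤-trans s (≤-reflexive (sym (+-assoc (2 * q) 2 2)))))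

  scale-opposite : ∀ {c j} → j < p → (c * j) % p ≡ 1 → (c * (p ∸ j)) % p ≡ p-1
  scale-opposite {c} {j} j<p e = suc-injective (trans (≤-antisym (m%n<n (c * (p ∸ j)) p) p≤) (sym suc-p-1))
    where
    eq : suc ((c * (p ∸ j)) % p) % p ≡ 0
    eq = trans (cong (λ z → (z + (c * (p ∸ j)) % p) % p) (sym e)) (trans (sym (%-distribˡ-+ (c * j) (c * (p ∸ j)) p))
         (trans (cong (_% p) (trans (sym (*-distribˡ-+ c j (p ∸ j))) (cong (c *_) (m+[n∸m]≡n (<⇒≤ j<p))))) (m*n%n≡0 c p)))
    p≤ : p ≤ suc ((c * (p ∸ j)) % p)
    p≤ = ∣⇒≤ (m%n≡0⇒n∣m _ p eq)

  cls-lower-1 : ∀ {W} → Small W → Has W 1 → exc (neg W) + (2 * q + 3) ≤ wt W + cls W 1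
  cls-lower-1 {W} s h = subst₂ (λ w x → exc (neg W) + (2 * q + 3) ≤ w + x) (wt-neg W)
    (trans (cls-neg W (<⇒≤ 1<p-1) p-1<p) (cong (cls W) (p∸-inv 1<p))) (cls-lower (neg W) (has-neg-1 {W} s h))

  cls-lower-any : ∀ {W b} → Small W → 1 ≤ b → b < p → Has W b → 2 * q + 3 ≤ wt W + cls W b
  cls-lower-any {W} {b} s 1≤b b<p (P , e) with inverse 1≤b b<p
  ... | c , inv = subst₂ (λ w x → 2 * q + 3 ≤ w + x) (wt-scale {c} W unit) (cls-scale {c} W unit b<p inv)
      (≤-trans (m≤n+m (2 * q + 3) (exc (neg (scale c W)))) (cls-lower-1 {scale c W} (small-scale {W} unit s) (P , trans (cong (λ z → (c * z) % p) e) inv)))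
    where unit = inverse-unit {c} {b} inv

  private
    sum3 : ∀ W ℓ {a b c} → a ≢ b → a ≢ c → b ≢ c → 1 ≤ a → 1 ≤ b → 1 ≤ c → cnt W a ℓ + (cnt W b ℓ + cnt W c ℓ) ≤ size W ℓ
    sum3 W ℓ {a} {b} {c} a≢b a≢c b≢c 1≤a 1≤b 1≤c = ≤-trans (≤-reflexive (e (cnt W a ℓ) (cnt W b ℓ) (cnt W c ℓ)))
      (≤-trans (comb-mono (pts ℓ) ((1 , (is W a)) ∷ (1 , (is W b)) ∷ (1 , (is W c)) ∷ [])
                 ((1 , (supp W)) ∷ []) (λ Q _ → go (val W Q)))
               (≤-reflexive (trans (+-identityʳ _) (*-identityˡ _))))
      where
      e : ∀ x y z → x + (y + z) ≡ 1 * x + (1 * y + (1 * z + 0))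
      e = solve-∀
      go : ∀ v → 1 * δ v a + (1 * δ v b + (1 * δ v c + 0)) ≤ 1 * nz v + 0
      go v with v ≟ a
      ... | yes refl rewrite δ-≡ {v} {v} refl | δ-≢ a≢b | δ-≢ a≢c | nz-pos 1≤a = ≤-refl
      ... | no na with v ≟ b
      ...   | yes refl rewrite δ-≢ na | δ-≡ {v} {v} refl | δ-≢ b≢c | nz-pos 1≤b = ≤-refl
      ...   | no nb with v ≟ c
      ...     | yes refl rewrite δ-≢ na | δ-≢ nb | δ-≡ {v} {v} refl | nz-pos 1≤c = ≤-refl
      ...     | no nc rewrite δ-≢ na | δ-≢ nb | δ-≢ nc = z≤n

  -- If a and b are values but -(a+b) is not, then points of value a and b are joined by long lines.
  gap-bound : ∀ W {P a b} → val W P ≡ a → 1 ≤ a → 1 ≤ b → a ≢ b → a + b < p → ¬ Has W (p ∸ (a + b)) →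
              cls W b + (6 * q + 9) ≤ 3 * wt W + 3 * cls W (p ∸ a)
  gap-bound W {P} {a} {b} refl 1≤a 1≤b a≢b a+b<p ¬h = arith-gap q (wt W) (cls W b) (cls W (p ∸ a))
      (through-cnt-≢ W b a≢b) (through-1 P)
      (trans (through-size W P) (cong (λ z → wt W + q * z) (nz-pos 1≤a)))
      (through-cnt-≢ W (p ∸ a) a≢p∸a)
      (comb-mono (I P) ((1 , cnt W b) ∷ (9 , (λ _ → 1)) ∷ []) ((3 , size W) ∷ (3 , cnt W (p ∸ a)) ∷ [])
        (λ ℓ t → go ℓ (size W ℓ) t refl (size≥2 W t 1≤a)))
    where
    a<p : a < p
    a<p = val<p W P
    a≢p∸a : a ≢ p ∸ a
    a≢p∸a e = p-odd a (trans (sym (m+[n∸m]≡n (<⇒≤ a<p))) (cong (a +_) (sym e)))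
    b≢p∸a : b ≢ p ∸ a
    b≢p∸a e = <⇒≢ a+b<p (trans (cong (a +_) e) (m+[n∸m]≡n (<⇒≤ a<p)))
    three : ∀ ℓ → T (I P ℓ) → size W ℓ ≡ 3 → cnt W b ℓ ≡ 0
    three ℓ t sz with pos-or-0 (cnt W b ℓ)
    ... | inj₁ z = z
    ... | inj₂ pos with cnt-point W pos
    ...   | Q , tQ , refl with third-point W sz (λ { refl → a≢b refl }) t tQ 1≤a 1≤b
    ...     | R , eq = ⊥-elim (bad (quo W ℓ) eq)
      where
      bad : ∀ k → a + (b + val W R) ≡ k * p → ⊥
      bad 0 eq = <⇒≢ 1≤a (sym (m+n≡0⇒m≡0 a eq))
      bad 1 eq = ¬h (R , trans (sym (m+n∸m≡n (a + b) (val W R))) (cong (_∸ (a + b)) (trans (+-assoc a b (val W R)) (trans eq (+-identityʳ p)))))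
      bad (suc (suc k)) eq = <⇒≱ (+-mono-< a+b<p (val<p W R)) (≤-trans (m≤m+n (p + p) (k * p))
        (≤-reflexive (sym (trans (+-assoc a b (val W R)) (trans eq (sym (+-assoc p p (k * p))))))))
    -- Size 2: the other point has value -a, so no point has value b. Size 3: a point of value b
    -- would force the third to have value -(a + b). Size k ≥ 4: at most k - 1 points of value b,
    -- and k + 8 ≤ 3k.
    go : ∀ ℓ k → T (I P ℓ) → size W ℓ ≡ k → 2 ≤ k → 1 * cnt W b ℓ + (9 * 1 + 0) ≤ 3 * size W ℓ + (3 * cnt W (p ∸ a) ℓ + 0)
    go ℓ 1 _ _ (s≤s ())
    go ℓ 2 t sz _ = subst (λ z → 1 * cnt W b ℓ + (9 * 1 + 0) ≤ 3 * z + (3 * cnt W (p ∸ a) ℓ + 0)) (sym sz)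
        (two (cnt W b ℓ) (cnt W (p ∸ a) ℓ) zero-b pos)
      where
      opp = second-point W {P} {ℓ} sz t 1≤a
      pos : 1 ≤ cnt W (p ∸ a) ℓ
      pos = cnt-pos W (proj₁ (proj₂ opp)) (proj₂ (proj₂ opp))
      zero-b : cnt W b ℓ ≡ 0
      zero-b = n≤0⇒n≡0 (≤-from-sum 0 ((cnt-pos W {P} {ℓ} t refl) ⊕ pos ⊕ (≤-trans (sum3 W ℓ a≢b a≢p∸a b≢p∸a 1≤a 1≤b (m<n⇒0<n∸m a<p)) (≤-reflexive sz)))
                 (e (cnt W a ℓ) (cnt W b ℓ) (cnt W (p ∸ a) ℓ)))
        where
        e : ∀ x y z → y + (x + z + 2) + 0 ≡ 0 + (1 + 1 + (x + (y + z)))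
        e = solve-∀
      two : ∀ x y → x ≡ 0 → 1 ≤ y → 1 * x + (9 * 1 + 0) ≤ 3 * 2 + (3 * y + 0)
      two x y refl 1≤y = +-monoʳ-≤ 6 (+-monoˡ-≤ 0 (3 ⊗ 1≤y))
    go ℓ 3 t sz _ rewrite three ℓ t sz | sz = m≤m+n 9 _
    go ℓ (suc (suc (suc (suc k)))) t sz _ = long-line {cnt W a ℓ} (cnt W (p ∸ a) ℓ) (subst (4 ≤_) (sym sz) lit)
      (cnt-pos W {P} {ℓ} t refl)
      (≤-trans (≤-trans (≤-reflexive (+-comm (cnt W b ℓ) _)) (+-monoʳ-≤ (cnt W a ℓ) (m≤m+n _ _)))
        (sum3 W ℓ a≢b a≢p∸a b≢p∸a 1≤a 1≤b (m<n⇒0<n∸m a<p)))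

  Full : DualWord → Set
  Full W = ∀ j → 1 ≤ j → j < p → Has W j

  2<p-1 : 2 < p-1
  2<p-1 = s≤s⁻¹ (≤-trans (≤-trans lit 7≤p) (≤-reflexive (sym suc-p-1)))

  private
    -- Since 2 is a value, `cls-upper` keeps the class of -1 near 2p points. Were -(b + 1) missing,
    -- `gap-bound` for 1 and b would need about 8p/3 of them.
    next : ∀ W → Small W → Has W 1 → Has W 2 → exc W ≤ 1 → ∀ b → 1 ≤ b → suc b < p → Has W b → Has W (suc b)
    next W s h1 h2 E≤1 1 _ _ _ = h2
    next W s h1 h2 E≤1 (suc (suc b)) _ lt hb with has? W (p ∸ (3 + b))
    ... | yes h = subst (Has W) (p∸-inv lt) (opposite {W} s (m<n⇒0<n∸m lt) h)
    ... | no ¬h = ⊥-elim (arith-close {wt W} {q} {exc W} {exc (neg W)} {cls W p-1} {cls W (2 + b)} p 7≤p (gap-bound W (proj₂ h1) ≤-refl (s≤s z≤n) (λ ()) lt ¬h)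
        (cls-upper W h1 1 (proj₂ h2) 2<p-1) (cls-lower-any {W} s (s≤s z≤n) (<⇒≤ lt) hb) (exc-sum {W} s h1) (exc-sum≤2 {W} s h1) E≤1)

    full-from-2 : ∀ W → Small W → Has W 1 → Has W 2 → exc W ≤ 1 → Full W
    full-from-2 W s h1 h2 E≤1 1 _ _ = h1
    full-from-2 W s h1 h2 E≤1 (suc (suc j)) _ lt = next W s h1 h2 E≤1 (suc j) (s≤s z≤n) lt (full-from-2 W s h1 h2 E≤1 (suc j) (s≤s z≤n) (<⇒≤ lt))

  full-neg⁻¹ : ∀ {W} → Full (neg W) → Full W
  full-neg⁻¹ {W} f j 1≤j j<p with f (p ∸ j) (m<n⇒0<n∸m j<p) (∸-monoʳ-< {p} 1≤j (<⇒≤ j<p))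
  ... | P , e = P , trans (sym (p∸-inv (val<p W P))) (trans (cong (p ∸_) (go (val W P) e)) (p∸-inv j<p))
    where
    go : ∀ v → negv v ≡ p ∸ j → p ∸ v ≡ p ∸ j
    go zero    e = ⊥-elim (<⇒≢ (m<n⇒0<n∸m j<p) e)
    go (suc v) e = e

  full-if-2 : ∀ W → Small W → Has W 1 → Has W 2 → Full W
  full-if-2 W s h1 h2 with exc W ≤? 1
  ... | yes le = full-from-2 W s h1 h2 le
  -- An excess of 2 uses up the whole of e, so the negated word has excess 0 and can be used
  -- instead.
  ... | no ¬le = full-neg⁻¹ {W} (full-from-2 (neg W) (small-neg {W} s) (has-neg-1 {W} s h1)
        (subst (Has (neg W)) (p∸-inv 2<p) (has-neg W (m<n⇒0<n∸m 2<p) (opposite {W} s (s≤s z≤n) h2)))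
        (≤-trans (+-cancelˡ-≤ 2 _ _ (≤-trans (+-monoˡ-≤ (exc (neg W)) (≰⇒> ¬le)) (exc-sum≤2 {W} s h1))) z≤n))
    where
    2<p : 2 < p
    2<p = ≤-trans lit 7≤p

  private
    oth : ℕ → ℕ → ℕ → ℕ
    oth a b v = nz v ∸ (δ v a + δ v b)

  -- The number g encodes r < p - r. The class sizes of 1, -1 and r are compared from three places:
  -- a point of value r (`cls-upper`), one of value -r (`gap`), and one of value -1 in the negated
  -- word (`tight-bound`).
  least-gap : ∀ W → Small W → Has W 1 → ∀ r₁ g → p ≡ 2 * suc r₁ + 1 + g → 2 ≤ r₁ → Has W (suc r₁) → (∀ j → 2 ≤ j → j < suc r₁ → ¬ Has W j) → ⊥
  least-gap W s h1 r₁ g p≡ 2≤r₁ (Pr , er) min with m≤n⇒∃[o]m+o≡n 2≤r₁ | m≤n⇒∃[o]m+o≡n 7≤p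
  ... | ρ , eρ | π , eπ = arith-gap-final {wt W} {q} {exc W} {exc (neg W)} {cls W 1} {cls W p-1} {cls W r} ρ π
      (cls-lower-1 {W} s h1)
      (subst₂ (λ a b → a * cls W p-1 ≤ suc a * (exc W + a * b)) (sym eρ) (sym eπ) (cls-upper W h1 r₁ er r<p-1))
      (subst (λ a → a * cls W r + 1 ≤ cls W p-1 + 3 * a * exc (neg W)) (sym eρ) tight-bound)
      gap
      (subst (λ a → wt W + 2 * a ≡ 2 * q + 2 + (exc W + exc (neg W))) (sym eπ) (exc-sum {W} s h1)) (exc-sum≤2 {W} s h1)
    where
    r = suc r₁
    U = neg W
    r<p : r < p
    r<p = subst (r <_) (sym p≡) (s≤s (m≤m+n r (r + 0)) ⟨≤⟩ ≤-reflexive (+-comm 1 (2 * r)) ⟨≤⟩ m≤m+n (2 * r + 1) g)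
      where
      infixl 4 _⟨≤⟩_
      _⟨≤⟩_ = ≤-trans
    p∸r : p ∸ r ≡ r + 1 + g
    p∸r = trans (cong (_∸ r) (trans p≡ (e r g))) (m+n∸m≡n r (r + 1 + g))
      where
      e : ∀ r g → 2 * r + 1 + g ≡ r + (r + 1 + g)
      e = solve-∀
    r<p-1 : r < p-1
    r<p-1 = s≤s⁻¹ (≤-trans (≤-trans (m≤m+n (2 + r) (r₁ + g)) (≤-reflexive (trans (e r₁ g) (sym p≡)))) (≤-reflexive (sym suc-p-1)))
      where
      e : ∀ r g → 2 + suc r + (r + g) ≡ 2 * suc r + 1 + g
      e = solve-∀
    gap : cls W 1 + (6 * q + 9) ≤ 3 * wt W + 3 * cls W r
    gap = subst (λ z → cls W 1 + (6 * q + 9) ≤ 3 * wt W + 3 * cls W z) (p∸-inv r<p)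
      -- With a = -r and b = 1, the residue -(a + b) is r - 1 ≥ 2, which minimality of r excludes as
      -- a value.
      (gap-bound W {proj₁ opp} {p ∸ r} {1} (proj₂ opp) (m<n⇒0<n∸m r<p) ≤-refl
        (λ e → <⇒≢ lit (trans (sym e) (trans p∸r (cong (λ z → suc z + g) (+-comm r₁ 1)))))
        lt (λ h → min r₁ 2≤r₁ ≤-refl (subst (Has W) eqr h)))
      where
      opp = opposite {W} s (s≤s z≤n) (Pr , er)
      lt : p ∸ r + 1 < p
      lt = subst₂ _<_ (cong (_+ 1) (sym p∸r)) (sym p≡) (≤-from-sum 0 (≤-trans (s≤s z≤n) 2≤r₁) (e r₁ g))
        where
        e : ∀ r g → suc (suc r + 1 + g + 1) + r + 0 ≡ 2 * suc r + 1 + g + 1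
        e = solve-∀
      eqr : p ∸ (p ∸ r + 1) ≡ r₁
      eqr = trans (sym (∸-+-assoc p (p ∸ r) 1)) (cong (_∸ 1) (p∸-inv r<p))
    opp1 = opposite {W} s ≤-refl h1
    Q = proj₁ opp1
    valU : val U Q ≡ 1
    valU = trans (cong negv (proj₂ opp1)) (trans (negv-pos (<⇒≤ 1<p-1)) (p∸-inv 1<p))
    minU : ∀ j → 2 ≤ j → j < r → ¬ Has U j
    minU j 2≤j j<r (R , e) = min j 2≤j j<r (subst (Has W) (p∸-inv (<-trans j<r r<p))
        (opposite {W} s (m<n⇒0<n∸m (<-trans j<r r<p)) (R , trans (sym (p∸-inv (val<p W R))) (cong (p ∸_) (go (val W R) e)))))
      where
      go : ∀ v → negv v ≡ j → p ∸ v ≡ j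
      go zero    e = ⊥-elim (<⇒≢ (<⇒≤ 2≤j) e)
      go (suc v) e = e
    b = p ∸ r
    b≡ : b ≡ r + 1 + g
    b≡ = p∸r
    1≢b : 1 ≢ b
    1≢b e = <⇒≢ lit (trans e (trans p∸r (cong (λ z → suc z + g) (+-comm r₁ 1))))
    1≤b : 1 ≤ b
    1≤b = m<n⇒0<n∸m r<p
    low : ∀ v → v ≡ 0 ⊎ (v ≡ 1 ⊎ r ≤ v) → (r + 1 + g) * δ v b + (1 * δ v 1 + (r * oth b 1 v + 0)) ≤ 1 * v + 0
    low v (inj₁ refl) rewrite δ-≢ (<⇒≢ 1≤b) | *-zeroʳ (r + 1 + g) | *-zeroʳ r = z≤n
    low v (inj₂ (inj₁ refl)) rewrite δ-≢ 1≢b | *-zeroʳ (r + 1 + g) | *-zeroʳ r = ≤-refl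
    low v (inj₂ (inj₂ r≤v)) with v ≟ b
    ... | yes refl rewrite δ-≡ {b} {b} refl | δ-≢ (λ x → 1≢b (sym x)) | nz-pos 1≤b | *-zeroʳ r =
          ≤-reflexive (trans (e (r + 1 + g)) (cong (λ z → 1 * z + 0) (sym b≡)))
      where
      e : ∀ x → x * 1 + 0 ≡ 1 * x + 0
      e = solve-∀
    ... | no nb rewrite δ-≢ nb | δ-≢ {v} {1} (λ x → <⇒≢ (≤-trans (s≤s (≤-trans (s≤s z≤n) 2≤r₁)) r≤v) (sym x)) | nz-pos (≤-trans (s≤s z≤n) r≤v) | *-zeroʳ (r + 1 + g) =
          ≤-trans (≤-reflexive (e r)) (+-monoˡ-≤ 0 (1 ⊗ r≤v))
      where
      e : ∀ x → x * 1 + 0 ≡ 1 * x + 0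
      e = solve-∀
    up : ∀ v → v < p → 1 * v + 0 ≤ (r + 1 + g) * δ v b + (1 * δ v 1 + ((2 * r + 1 + g) * oth b 1 v + 0))
    up v v<p with v ≟ 1
    ... | yes refl rewrite δ-≢ 1≢b | *-zeroʳ (r + 1 + g) | *-zeroʳ (2 * r + 1 + g) = ≤-refl
    ... | no n1 with v ≟ b
    ...   | yes refl rewrite δ-≡ {b} {b} refl | δ-≢ n1 | nz-pos 1≤b | *-zeroʳ (2 * r + 1 + g) =
          ≤-reflexive (trans (cong (λ z → 1 * z + 0) b≡) (e (r + 1 + g)))
      where
      e : ∀ x → 1 * x + 0 ≡ x * 1 + 0
      e = solve-∀
    ...   | no nb with pos-or-0 v
    ...     | inj₁ refl = z≤n
    ...     | inj₂ pos rewrite δ-≢ nb | δ-≢ n1 | nz-pos pos | *-zeroʳ (r + 1 + g) =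
          +-monoˡ-≤ 0 (≤-trans (≤-reflexive (*-identityˡ v)) (≤-trans (<⇒≤ v<p) (≤-reflexive (trans p≡ (sym (*-identityʳ _))))))
    cases : ∀ R → val U R ≡ 0 ⊎ (val U R ≡ 1 ⊎ r ≤ val U R)
    cases R with pos-or-0 (val U R)
    ... | inj₁ z = inj₁ z
    ... | inj₂ pos with val U R ≟ 1
    ...   | yes e = inj₂ (inj₁ e)
    ...   | no n1 with val U R <? r
    ...     | no ge  = inj₂ (inj₂ (≮⇒≥ ge))
    ...     | yes lt = ⊥-elim (minU (val U R) (≤∧≢⇒< pos (λ e → n1 (sym e))) lt (R , refl))
    toP : ∀ ℓ → 1 * onLine ℓ (val U) + 0 ≡ quo U ℓ * (2 * r + 1 + g)
    toP ℓ = trans (+-identityʳ _) (trans (*-identityˡ _) (trans (dual U ℓ) (cong (quo U ℓ *_) p≡)))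
    tight-line : ∀ ℓ → T (I Q ℓ) → r₁ * cnt U b ℓ + (suc (3 * r₁) * 1 + 0) ≤ 1 * cnt U 1 ℓ + (3 * r₁ * quo U ℓ + 0)
    tight-line ℓ t = arith-tight r₁ g {cnt U 1 ℓ} {cnt U b ℓ} {onLine ℓ (λ R → oth b 1 (val U R))} {quo U ℓ}
      (quo-pos U t (≤-reflexive (sym valU))) (cnt-pos U t valU)
      (≤-trans (comb-mono (pts ℓ) ((r + 1 + g , (is U b)) ∷ (1 , (is U 1)) ∷ (r , (λ R → oth b 1 (val U R))) ∷ [])
          ((1 , val U) ∷ []) (λ R _ → low (val U R) (cases R))) (≤-reflexive (toP ℓ)))
      (≤-trans (≤-reflexive (sym (toP ℓ))) (comb-mono (pts ℓ) ((1 , val U) ∷ [])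
         ((r + 1 + g , (is U b)) ∷ (1 , (is U 1)) ∷ (2 * r + 1 + g , (λ R → oth b 1 (val U R))) ∷ []) (λ R _ → up (val U R) (val<p U R))))
    tight-bound : r₁ * cls W r + 1 ≤ cls W p-1 + 3 * r₁ * exc U
    tight-bound = subst₂ (λ y x → r₁ * y + 1 ≤ x + 3 * r₁ * exc U) (trans (cls-neg W 1≤b (∸-monoʳ-< {p} (s≤s z≤n) (<⇒≤ r<p))) (cong (cls W) (p∸-inv r<p)))
      (cls-neg W ≤-refl 1<p)
      (arith-tightsum q (exc U) r₁ (cls U b) (cls U 1) (through-cnt-≢ U b (λ e → 1≢b (trans (sym valU) e))) (through-1 Q) (through-cnt-≡ U 1 valU) (exc-1 U valU)
        (comb-mono (I Q) ((r₁ , cnt U b) ∷ (suc (3 * r₁) , (λ _ → 1)) ∷ []) ((1 , cnt U 1) ∷ (3 * r₁ , quo U) ∷ []) tight-line))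

  least-or-none : ∀ W n → (∀ j → 2 ≤ j → j < 2 + n → ¬ Has W j) ⊎
    (∃[ r ] (2 ≤ r × r < 2 + n × Has W r × (∀ j → 2 ≤ j → j < r → ¬ Has W j)))
  least-or-none W zero = inj₁ (λ j 2≤j j<2 _ → <⇒≱ j<2 2≤j)
  least-or-none W (suc n) with least-or-none W n
  ... | inj₂ (r , 2≤r , r<n , h , min) = inj₂ (r , 2≤r , m≤n⇒m≤1+n r<n , h , min)
  ... | inj₁ none with has? W (2 + n)
  ...   | yes h = inj₂ (2 + n , lit , ≤-refl , h , none)
  ...   | no ¬h = inj₁ go
    where
    go : ∀ j → 2 ≤ j → j < 2 + suc n → ¬ Has W j
    go j 2≤j j<n with m≤n⇒m<n∨m≡n (s≤s⁻¹ j<n)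
    ... | inj₁ lt   = none j 2≤j lt
    ... | inj₂ refl = ¬h

  two-values-or-full : ∀ W → Small W → Has W 1 → (∀ Q → val W Q ≡ 0 ⊎ (val W Q ≡ 1 ⊎ val W Q ≡ p-1)) ⊎ Full W
  -- The range 2 ≤ j < 2 + (p - 3) stops just before p - 1.
  two-values-or-full W s h1 with least-or-none W (p ∸ 3)
  ... | inj₁ none = inj₁ cases
    where
    cases : ∀ Q → val W Q ≡ 0 ⊎ (val W Q ≡ 1 ⊎ val W Q ≡ p-1)
    cases Q with pos-or-0 (val W Q)
    ... | inj₁ z = inj₁ z
    ... | inj₂ pos with val W Q ≟ 1
    ...   | yes e = inj₂ (inj₁ e)
    ...   | no n1 with val W Q ≟ p-1
    ...     | yes e = inj₂ (inj₂ e)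
    ...     | no n2 = ⊥-elim (none (val W Q) (≤∧≢⇒< pos (λ e → n1 (sym e)))
                (≤-trans (≤∧≢⇒< (s≤s⁻¹ (≤-trans (val<p W Q) (≤-reflexive (sym suc-p-1)))) n2) (≤-reflexive eq)) (Q , refl))
      where
      eq : p-1 ≡ 2 + (p ∸ 3)
      eq = suc-injective (trans suc-p-1 (sym (m+[n∸m]≡n {3} (≤-trans lit 7≤p))))
  ... | inj₂ (2 , _ , _ , h2 , _) = inj₂ (full-if-2 W s h1 h2)
  ... | inj₂ (1 , s≤s () , _)
  ... | inj₂ (suc (suc (suc r₂)) , 2≤r , r<n , h , min) = ⊥-elim (least-gap W s h1 (2 + r₂) g p≡ lit h min)
    where
    r = 3 + r₂
    r<p-1 : suc r < p
    r<p-1 = ≤-trans (s≤s r<n) (≤-reflexive (m+[n∸m]≡n {3} (≤-trans lit 7≤p)))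
    r<p : r < p
    r<p = <⇒≤ r<p-1
    opp : Has W (p ∸ r)
    opp = opposite {W} s (s≤s z≤n) h
    r<p∸r : r < p ∸ r
    r<p∸r = ≤∧≢⇒< (≮⇒≥ (λ lt → min (p ∸ r) (+-cancelʳ-≤ r 2 _ (≤-trans r<p-1 (≤-reflexive (sym (m∸n+n≡m (<⇒≤ r<p)))))) lt opp))
                  (λ e → p-odd r (trans (sym (m+[n∸m]≡n (<⇒≤ r<p))) (cong (r +_) (sym e))))
    g = p ∸ r ∸ suc r
    p≡ : p ≡ 2 * r + 1 + g
    p≡ = trans (sym (m+[n∸m]≡n (<⇒≤ r<p))) (trans (cong (r +_) (sym (m+[n∸m]≡n r<p∸r))) (e r g))
      where
      e : ∀ r g → r + (suc r + g) ≡ 2 * r + 1 + g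
      e = solve-∀

-- Words that take every value: the doubling inequality and κ

wsum-true : ∀ {n} (f : Fin n → ℕ) → wsum (λ _ → true) f ≡ sumFin f
wsum-true {n} f = sum-cong {n} (λ i → *-identityˡ (f i))

private
  -- A line with m points of value 1 and n of value -2 for V = 2U, and μ points of value 1 for U;
  -- t and s are the quotients of V and U on it, and p = 7 + π.
  arith-L : ∀ π {m n t s μ} → (1 ≤ m → 1 ≤ t) → (1 ≤ m → t ≤ 3) → (1 ≤ n → 2 ≤ s + μ) →
    1 * m + ((5 + π) * n + 0) ≤ t * (7 + π) → (2 * (6 + π)) * n + ((8 + π) * m + 0) ≤ 2 * (s * (7 + π)) →
    (m ≡ 1 → n ≡ 1 → t ≡ 1 → ⊥) →
    2 * (m * n) + (4 * (m * 1) + (2 * (n * 1) + 0)) ≤ 2 * (m * m) + (2 * (m * t) + (1 * (n * s) + (1 * (n * μ) + 0)))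
  arith-L π {zero} {zero} h1 h2 h3 h4 h5 h6 = z≤n
  arith-L π {zero} {suc n} {t} {s} {μ} h1 h2 h3 h4 h5 h6 = ≤-from-sum 0 ((suc n) ⊗ (h3 (s≤s z≤n))) (solve (n ∷ t ∷ s ∷ μ ∷ []))
  arith-L π {suc m} {zero} {t} {s} {μ} h1 h2 h3 h4 h5 h6 = ≤-from-sum (2 * (m * suc m)) ((2 * suc m) ⊗ (h1 (s≤s z≤n))) (solve (m ∷ t ∷ s ∷ μ ∷ []))
  arith-L π {suc m} {suc n} {t} {s} {μ} h1 h2 h3 h4 h5 h6 with suc n + 2 ≤? suc m + t
  ... | yes le = ≤-from-sum 0 ((2 * suc m) ⊗ le ⊕ (suc n) ⊗ (h3 (s≤s z≤n))) (solve (m ∷ n ∷ t ∷ s ∷ μ ∷ []))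
  ... | no ¬le = few m n ¬le h1 h2 h4 h5 h6
    where
    -- What remains has at least m + t - 1 points of value -2. For m ≥ 2 the sum in V gives p ≤ 2t ≤
    -- 6. For m = 1 the sum in U gives s ≥ 3 if n = 2 and s ≥ 4 if n ≥ 3, because 1/2 lifts to (p +
    -- 1)/2; n = t = 1 is excluded by hypothesis.
    few : ∀ m n → ¬ (suc n + 2 ≤ suc m + t) → (1 ≤ suc m → 1 ≤ t) → (1 ≤ suc m → t ≤ 3) → 1 * suc m + ((5 + π) * suc n + 0) ≤ t * (7 + π) →
          (2 * (6 + π)) * suc n + ((8 + π) * suc m + 0) ≤ 2 * (s * (7 + π)) → (suc m ≡ 1 → suc n ≡ 1 → t ≡ 1 → ⊥) →
          2 * (suc m * suc n) + (4 * (suc m * 1) + (2 * (suc n * 1) + 0)) ≤ 2 * (suc m * suc m) + (2 * (suc m * t) + (1 * (suc n * s) + (1 * (suc n * μ) + 0)))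
    few (suc m) n ¬le h1 h2 h4 h5 h6 = ⊥-elim (≤-absurd (π + (π + 6) * m) (h4 ⊕ (5 + π) ⊗ (≰⇒> ¬le) ⊕ 2 ⊗ (h2 (s≤s z≤n))) (solve (m ∷ n ∷ t ∷ π ∷ [])))
    few zero zero ¬le h1 h2 h4 h5 h6 = ⊥-elim (h6 refl refl (≤-antisym (s≤s⁻¹ (s≤s⁻¹ (≰⇒> ¬le))) (h1 (s≤s z≤n))))
    few zero (suc zero) ¬le h1 h2 h4 h5 h6 = ≤-from-sum (2 * μ) (2 ⊗ 2≤t ⊕ 2 ⊗ 3≤s) (e t s μ)
      where
      2≤t : 2 ≤ t
      2≤t with 2 ≤? t
      ... | yes le = le
      ... | no ¬2≤t = ⊥-elim (≤-absurd (3 + π) (h4 ⊕ (s≤s⁻¹ (≰⇒> ¬2≤t)) ⊙ (7 + π)) (solve (t ∷ π ∷ [])))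
      3≤s : 3 ≤ s
      3≤s with 3 ≤? s
      ... | yes le = le
      ... | no ¬3≤s = ⊥-elim (≤-absurd (3 + π) (h5 ⊕ 2 ⊗ ((s≤s⁻¹ (≰⇒> ¬3≤s)) ⊙ (7 + π))) (solve (s ∷ π ∷ [])))
      e : ∀ t s μ → 2 * (1 * 2) + (4 * (1 * 1) + (2 * (2 * 1) + 0)) + (2 * t + 2 * s) + 2 * μ
        ≡ 2 * (1 * 1) + (2 * (1 * t) + (1 * (2 * s) + (1 * (2 * μ) + 0))) + (2 * 2 + 2 * 3)
      e = solve-∀
    few zero (suc (suc n)) ¬le h1 h2 h4 h5 h6 = ≤-from-sum (suc (suc (suc n)) * μ) (2 ⊗ (h1 (s≤s z≤n)) ⊕ (3 + n) ⊗ 4≤s) (e n t s μ)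
      where
      4≤s : 4 ≤ s
      4≤s with 4 ≤? s
      ... | yes le = le
      ... | no ¬4≤s = ⊥-elim (≤-absurd (1 + π + 2 * (6 + π) * n) (h5 ⊕ 2 ⊗ ((s≤s⁻¹ (≰⇒> ¬4≤s)) ⊙ (7 + π))) (solve (s ∷ n ∷ π ∷ [])))
      e : ∀ n t s μ → 2 * (1 * (3 + n)) + (4 * (1 * 1) + (2 * ((3 + n) * 1) + 0)) + (2 * t + (3 + n) * s) + (3 + n) * μ
        ≡ 2 * (1 * 1) + (2 * (1 * t) + (1 * ((3 + n) * s) + (1 * ((3 + n) * μ) + 0))) + (2 * 1 + (3 + n) * 4)
      e = solve-∀

  arith-D : ∀ {x y y' q p r e B E F κb κa κb'} → q + 1 + F + r * p + y ≡ 2 * q + 2 + κb' → x + E ≡ B + e + κa → y' ≡ B + F + κb →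
    2 * (x * (y' + q * 0)) + (4 * (x * suc q) + (2 * (y' * suc q) + 0)) ≤
      2 * (x * (x + q * 1)) + (2 * (x * (suc q + E + 0)) + (1 * (y' * (suc q + F + r * p)) + (1 * (y' * (y + q * 0)) + 0))) →
    2 * x * (F + κb + 1) ≤ y' * κb' + 2 * x * (e + κa)
  arith-D {x} {y} {y'} {q} {p} {r} {e} {B} {E} {F} {κb} {κa} {κb'} h1 h2 h3 le =
    +-cancelʳ-≤ (2 * x * (B + 2 * q + 1) + y' * (2 * q + 2)) _ _ (≤-trans (≤-reflexive lhs) (≤-trans le (≤-reflexive rhs)))
    where
    l1 : ∀ x y' q → 2 * x * (y' + 2 * q + 2) + y' * (2 * q + 2) ≡ 2 * (x * (y' + q * 0)) + (4 * (x * suc q) + (2 * (y' * suc q) + 0))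
    l1 = solve-∀
    l0 : ∀ x B F κb q z → 2 * x * (F + κb + 1) + (2 * x * (B + 2 * q + 1) + z) ≡ 2 * x * (B + F + κb + 2 * q + 2) + z
    l0 = solve-∀
    lhs = trans (l0 x B F κb q (y' * (2 * q + 2))) (trans (cong (λ z → 2 * x * (z + 2 * q + 2) + y' * (2 * q + 2)) (sym h3)) (l1 x y' q))
    r1 : ∀ x y y' q E F z → 2 * (x * (x + q * 1)) + (2 * (x * (suc q + E + 0)) + (1 * (y' * (suc q + F + z)) + (1 * (y' * (y + q * 0)) + 0)))
       ≡ 2 * x * (x + E + 2 * q + 1) + y' * (q + 1 + F + z + y)
    r1 = solve-∀
    r2 : ∀ x y' q B e κa κb' → 2 * x * (B + e + κa + 2 * q + 1) + y' * (2 * q + 2 + κb') ≡ y' * κb' + 2 * x * (e + κa) + (2 * x * (B + 2 * q + 1) + y' * (2 * q + 2))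
    r2 = solve-∀
    rhs = trans (r1 x y y' q E F (r * p)) (trans (cong₂ (λ a b → 2 * x * (a + 2 * q + 1) + y' * b) h2 h1) (r2 x y' q B e κa κb'))

  arith-strict : ∀ {x y' κ A C} → 1 ≤ κ → suc y' ≤ 2 * x → 2 * x * A ≤ y' * κ + 2 * x * C → suc A ≤ C + κ
  arith-strict {x} {y'} {suc κ} {A} {C} _ lt le with suc A ≤? C + suc κ
  ... | yes h = h
  ... | no ¬h = ⊥-elim (≤-absurd κ (le ⊕ (2 * x) ⊗ (s≤s⁻¹ (≰⇒> ¬h)) ⊕ (suc κ) ⊗ lt) (solve (x ∷ y' ∷ κ ∷ A ∷ C ∷ [])))

  arith-y'<2x : ∀ {w q e x y' F E'} p → 7 ≤ p → w + 2 * p ≡ 2 * q + 2 + e → e ≤ 2 → F ≤ 2 → 1 * y' ≤ 2 * (F + 1 * p) → E' + (2 * q + 3) ≤ w + x → suc y' ≤ 2 * x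
  arith-y'<2x {w} {q} {e} {x} {y'} {F} {E'} p 7≤p h1 h2 h3 h4 h5 =
    ≤-from-sum (7 + 2 * E') (h4 ⊕ 2 ⊗ h3 ⊕ (2 ⊗ h5 ⊕ 2 ⊗ (≤-reflexive h1)) ⊕ (2 ⊗ h2 ⊕ 2 ⊗ 7≤p))
      (solve (w ∷ q ∷ e ∷ x ∷ y' ∷ F ∷ E' ∷ p ∷ []))

  arith-cls : ∀ {w x q E κ B} → w + x ≡ E + (2 * q + 3) + κ → w + B ≡ 2 * q + 3 → x ≡ B + E + κ
  arith-cls {w} {x} {q} {E} {κ} {B} h1 h2 = +-cancelˡ-≡ w _ _ (trans h1 (trans (cong (λ z → E + z + κ) (sym h2)) (e w E κ B)))
    where
    e : ∀ w E κ B → E + (w + B) + κ ≡ w + (B + E + κ)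
    e = solve-∀

  arith-kap : ∀ {w q e x E κ} p → w + 2 * p ≡ 2 * q + 2 + e → w + x ≡ E + (2 * q + 3) + κ → 1 * x ≤ 2 * (E + 1 * p) → κ + 1 ≤ E + e
  arith-kap {w} {q} {e} {x} {E} {κ} p h1 h2 h3 = ≤-from-sum 0 (h3 ⊕ (≤-reflexive h1) ⊕ (≤-reflexive (sym h2))) (solve (w ∷ q ∷ e ∷ x ∷ E ∷ κ ∷ p ∷ []))

  arith-h1 : ∀ {q y p r B F F' κ} → p ≡ 2 + r → q ≡ p * p → B + (F + F') ≡ 2 * p + 1 → y ≡ B + F' + κ → q + 1 + F + r * p + y ≡ 2 * q + 2 + κ
  arith-h1 {q} {y} {p} {r} {B} {F} {F'} {κ} refl refl hB refl = trans (e1 (p * p) (r * p) B F F' κ) (trans (cong (λ z → p * p + 1 + r * p + κ + z) hB) (e2 r κ))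
    where
    e1 : ∀ q z B F F' κ → q + 1 + F + z + (B + F' + κ) ≡ q + 1 + z + κ + (B + (F + F'))
    e1 = solve-∀
    e2 : ∀ r κ → (2 + r) * (2 + r) + 1 + r * (2 + r) + κ + (2 * (2 + r) + 1) ≡ 2 * ((2 + r) * (2 + r)) + 2 + κ
    e2 = solve-∀

  arith-x+E : ∀ {x B e E E' κ} → x ≡ B + E' + κ → E + E' ≡ e → x + E ≡ B + e + κ
  arith-x+E {x} {B} {e} {E} {E'} {κ} refl refl = eq B E E' κ
    where
    eq : ∀ B E E' κ → B + E' + κ + E ≡ B + (E + E') + κ
    eq = solve-∀

  arith-B : ∀ {w q e p B} → w + 2 * p ≡ 2 * q + 2 + e → B + e ≡ 2 * p + 1 → w + B ≡ 2 * q + 3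
  arith-B {w} {q} {e} {p} {B} h1 h2 = +-cancelʳ-≡ e _ _ (trans (+-assoc w B e) (trans (cong (w +_) h2) (trans (sym (+-assoc w (2 * p) 1)) (trans (cong (_+ 1) h1) (eq q e)))))
    where
    eq : ∀ q e → 2 * q + 2 + e + 1 ≡ 2 * q + 3 + e
    eq = solve-∀

  -- The applicable bounds for κ and κ' are added. If both are positive the sum reads e + 4 ≤ 2e, if
  -- one is, e + 3 ≤ 2e; both contradict e ≤ 2. If none is, e + 2 ≤ 2e gives e = 2, and F, F' ≤ 1
  -- give F = 1.
  arith-K0 : ∀ {e F F' κ κ'} → e ≤ 2 → F + F' ≡ e →
    (κ' ≡ 0 → F + κ + 1 ≤ e + 0) → (1 ≤ κ' → F + κ + 2 ≤ e + 0 + κ') → (κ ≡ 0 → F' + κ' + 1 ≤ e + 0) → (1 ≤ κ → F' + κ' + 2 ≤ e + 0 + κ) →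
    κ ≡ 0 × κ' ≡ 0 × e ≡ 2 × F ≡ 1
  arith-K0 {e} {F} {F'} {zero} {zero} e≤2 refl d0 _ d0' _ = refl , refl ,
      ≤-antisym e≤2 (≤-from-sum 0 ((d0 refl) ⊕ (d0' refl)) (e1 F F')) ,
      ≤-antisym (≤-from-sum 0 ((d0 refl) ⊕ e≤2) (e2 F F')) (≤-from-sum 0 (d0' refl) (e3 F F'))
    where
    e1 : ∀ F F' → 2 + (F + F' + 0 + (F + F' + 0)) + 0 ≡ F + F' + (F + 0 + 1 + (F' + 0 + 1))
    e1 = solve-∀
    e2 : ∀ F F' → F + (F + F' + 0 + 2) + 0 ≡ 1 + (F + 0 + 1 + (F + F'))
    e2 = solve-∀
    e3 : ∀ F F' → 1 + (F + F' + 0) + 0 ≡ F + (F' + 0 + 1)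
    e3 = solve-∀
  arith-K0 {e} {F} {F'} {suc κ} {zero} e≤2 refl d0 _ _ d1' = ⊥-elim (≤-absurd 0 ((d0 refl) ⊕ (d1' (s≤s z≤n)) ⊕ e≤2) (solve (F ∷ F' ∷ κ ∷ [])))
  arith-K0 {e} {F} {F'} {zero} {suc κ} e≤2 refl _ d1 d0' _ = ⊥-elim (≤-absurd 0 ((d0' refl) ⊕ (d1 (s≤s z≤n)) ⊕ e≤2) (solve (F ∷ F' ∷ κ ∷ [])))
  arith-K0 {e} {F} {F'} {suc κ} {suc κ'} e≤2 refl _ d1 _ d1' = ⊥-elim (≤-absurd 1 ((d1 (s≤s z≤n)) ⊕ (d1' (s≤s z≤n)) ⊕ e≤2) (solve (F ∷ F' ∷ κ ∷ κ' ∷ [])))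

  arith-K2 : ∀ {F F' κa κa' κ κ'} → F + F' ≡ 2 → κa + κa' ≡ 1 → 2 ≤ κ + κ' → κ + 1 ≤ F + 2 → κ' + 1 ≤ F' + 2 →
    (κ' ≡ 0 → F + κ + 1 ≤ 2 + κa') → (1 ≤ κ' → F + κ + 2 ≤ 2 + κa' + κ') → (κ ≡ 0 → F' + κ' + 1 ≤ 2 + κa) → (1 ≤ κ → F' + κ' + 2 ≤ 2 + κa + κ) → ⊥
  arith-K2 {F} {F'} {κa} {κa'} {suc κ} {suc κ'} hF hκ _ _ _ _ d1 _ d1' =
      ≤-absurd 0 ((d1 (s≤s z≤n)) ⊕ (d1' (s≤s z≤n)) ⊕ ((≤-reflexive (sym hF)) ⊕ (≤-reflexive hκ))) (solve (F ∷ F' ∷ κa ∷ κa' ∷ κ ∷ κ' ∷ []))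
  arith-K2 {F} {F'} {κa} {κa'} {κ} {zero} hF hκ h2 b _ d0 _ _ _ =
      ≤-absurd κa ((d0 refl) ⊕ b ⊕ (2 ⊗ h2 ⊕ (≤-reflexive hκ))) (solve (F ∷ κa ∷ κa' ∷ κ ∷ []))
  arith-K2 {F} {F'} {κa} {κa'} {zero} {suc κ'} hF hκ h2 _ b _ _ d0' _ =
      ≤-absurd κa' ((d0' refl) ⊕ b ⊕ (2 ⊗ h2 ⊕ (≤-reflexive hκ))) (solve (F' ∷ κa ∷ κa' ∷ κ' ∷ []))

  arith-f-rev : ∀ {A B C D} q E w s → A ≡ suc q + E + 0 → B ≡ suc q → C ≡ w + q * 1 → D ≡ s + q * 0 → w + s ≡ E + (2 * q + 3) + 0 →
            1 * C + (1 * D + 0) ≤ 1 * A + (2 * B + 0)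
  arith-f-rev q E w s refl refl refl refl h = ≤-from-sum 0 (≤-reflexive h) (solve (q ∷ E ∷ w ∷ s ∷ []))

  arith-g-rev : ∀ {A B C D} q E x y' z → A ≡ y' + q * 0 → B ≡ suc q → C ≡ x + q * 1 → D ≡ suc q + E + 0 → x + E ≡ z + 2 → y' ≡ z + 1 →
            1 * C + (1 * D + 0) ≤ 1 * A + (2 * B + 0)
  arith-g-rev q E x y' z refl refl refl refl h refl = ≤-from-sum 0 (≤-reflexive h) (solve (q ∷ E ∷ x ∷ z ∷ []))

  arith-gline : ∀ {m n t s μ} → (1 ≤ n → s + μ ≡ 2) →
    2 * (suc m * n) + (4 * (suc m * 1) + (2 * (n * 1) + 0)) ≤ 2 * (suc m * suc m) + (2 * (suc m * t) + (1 * (n * s) + (1 * (n * μ) + 0))) →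
    1 * n + (2 * 1 + 0) ≤ 1 * suc m + (1 * t + 0)
  arith-gline {m} {n} {t} {s} {μ} h le = *-cancelˡ-≤ (2 * suc m) (+-cancelʳ-≤ (2 * n) _ _ (≤-trans (≤-reflexive (e1 m n)) (≤-trans le (≤-reflexive (trans (e2 m n t s μ) (cong (2 * suc m * (1 * suc m + (1 * t + 0)) +_) (go n h)))))))
    where
    e1 : ∀ m n → 2 * suc m * (1 * n + (2 * 1 + 0)) + 2 * n ≡ 2 * (suc m * n) + (4 * (suc m * 1) + (2 * (n * 1) + 0))
    e1 = solve-∀
    e2 : ∀ m n t s μ → 2 * (suc m * suc m) + (2 * (suc m * t) + (1 * (n * s) + (1 * (n * μ) + 0))) ≡ 2 * suc m * (1 * suc m + (1 * t + 0)) + n * (s + μ)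
    e2 = solve-∀
    go : ∀ n → (1 ≤ n → s + μ ≡ 2) → n * (s + μ) ≡ 2 * n
    go zero    _ = refl
    go (suc n) h = trans (cong (suc n *_) (h (s≤s z≤n))) (*-comm (suc n) 2)

  arith-step : ∀ {m n t t' k c} → 4 ≤ k → 1 ≤ m → t + t' ≡ k → 1 * t + (2 * 1 + 0) ≡ 1 * k + (1 * c + 0) →
    (1 ≤ c → 1 * t' + (2 * 1 + 0) ≡ 1 * k + (1 * m + 0)) → 1 * n + (2 * 1 + 0) ≡ 1 * m + (1 * t + 0) → n + 4 ≡ m + k
  arith-step {m} {n} {t} {t'} {k} {zero} 4≤k 1≤m ht h1 h2 h3 = trans (e1 n) (trans (cong (_+ 2) h3) (trans (e2 m t) (trans (cong (m +_) h1) (e3 m k))))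
    where
    e1 : ∀ n → n + 4 ≡ 1 * n + (2 * 1 + 0) + 2
    e1 = solve-∀
    e2 : ∀ m t → 1 * m + (1 * t + 0) + 2 ≡ m + (1 * t + (2 * 1 + 0))
    e2 = solve-∀
    e3 : ∀ m k → m + (1 * k + (1 * 0 + 0)) ≡ m + k
    e3 = solve-∀
  arith-step {m} {n} {t} {t'} {k} {suc c} 4≤k 1≤m ht h1 h2 h3 =
    ⊥-elim (≤-absurd (c + 1) ((≤-reflexive (sym h1)) ⊕ (≤-reflexive (sym (h2 (s≤s z≤n)))) ⊕ (4≤k ⊕ 1≤m ⊕ (≤-reflexive ht))) (solve (m ∷ t ∷ t' ∷ k ∷ c ∷ [])))

module FullWords (p : ℕ) .{{_ : NonZero p}} (pr : Prime p) (7≤p : 7 ≤ p) (Π : ProjectivePlane (p * p)) where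
  open ValueSet p pr 7≤p Π public

  negv-negv : ∀ {v} → v < p → negv (negv v) ≡ v
  negv-negv {zero}  _   = refl
  negv-negv {suc v} v<p = trans (negv-pos (m<n⇒0<n∸m v<p)) (p∸-inv v<p)

  quo-neg-neg : ∀ W ℓ → quo (neg (neg W)) ℓ ≡ quo W ℓ
  quo-neg-neg W ℓ = +-cancelˡ-≡ (quo (neg W) ℓ) _ _ (trans (quo-neg (neg W) ℓ) (trans (size-neg W ℓ) (trans (sym (quo-neg W ℓ)) (+-comm (quo W ℓ) _))))

  tot-neg-neg : ∀ W → tot (neg (neg W)) ≡ tot W
  tot-neg-neg W = sum-cong {N} (λ Q → negv-negv (val<p W Q))

  exc-neg-neg : ∀ W → exc (neg (neg W)) ≡ exc W
  exc-neg-neg W = cong (λ t → (t + q) / p ∸ suc q) (tot-neg-neg W)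

  cnt-neg-1 : ∀ W ℓ → cnt (neg W) 1 ℓ ≡ cnt W p-1 ℓ
  cnt-neg-1 W ℓ = cnt-neg W ℓ ≤-refl 1<p

  cnt-neg-p-1 : ∀ W ℓ → cnt (neg W) p-1 ℓ ≡ cnt W 1 ℓ
  cnt-neg-p-1 W ℓ = trans (cnt-neg W ℓ (<⇒≤ 1<p-1) p-1<p) (cong (λ j → cnt W j ℓ) (p∸-inv 1<p))

  cls-neg-1 : ∀ W → cls (neg W) 1 ≡ cls W p-1
  cls-neg-1 W = cls-neg W ≤-refl 1<p

  cls-neg-p-1 : ∀ W → cls (neg W) p-1 ≡ cls W 1
  cls-neg-p-1 W = trans (cls-neg W (<⇒≤ 1<p-1) p-1<p) (cong (cls W) (p∸-inv 1<p))

  record Cond (e : ℕ) (W : DualWord) : Set where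
    field
      full   : Full W
      weigh  : wt W + 2 * p ≡ 2 * q + 2 + e
      e≤2    : e ≤ 2

  open Cond public

  cond-small : ∀ {e W} → Cond e W → Small W
  cond-small {e} {W} c = ≤-trans (≤-reflexive (weigh c)) (≤-trans (+-monoʳ-≤ (2 * q + 2) (e≤2 c)) (≤-reflexive (+-assoc (2 * q) 2 2)))

  2<p : 2 < p
  2<p = ≤-trans lit 7≤p

  has-1 : ∀ {e W} → Cond e W → Has W 1
  has-1 c = full c 1 ≤-refl 1<p

  exc-e : ∀ {e W} → Cond e W → exc W + exc (neg W) ≡ e
  exc-e {e} {W} c = +-cancelˡ-≡ (2 * q + 2) _ _ (trans (sym (exc-sum {W} (cond-small c) (has-1 c))) (weigh c))

  cond-neg : ∀ {e W} → Cond e W → Cond e (neg W)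
  cond-neg {e} {W} c = record
    { full  = λ j 1≤j j<p → subst (Has (neg W)) (p∸-inv j<p) (has-neg W (m<n⇒0<n∸m j<p) (full c (p ∸ j) (m<n⇒0<n∸m j<p) (∸-monoʳ-< {p} 1≤j (<⇒≤ j<p))))
    ; weigh = trans (cong (_+ 2 * p) (wt-neg W)) (weigh c)
    ; e≤2   = e≤2 c }

  cond-scale : ∀ {e W} c → ¬ p ∣ c → Cond e W → Cond e (scale c W)
  cond-scale {e} {W} c p∤c cd = record
    { full  = hasAll
    ; weigh = trans (cong (_+ 2 * p) (wt-scale {c} W p∤c)) (weigh cd)
    ; e≤2   = e≤2 cd }
    where
    c%p-pos : 1 ≤ c % p
    c%p-pos with pos-or-0 (c % p)
    ... | inj₂ pos = pos
    ... | inj₁ z   = ⊥-elim (p∤c (m%n≡0⇒n∣m c p z))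
    inv = inverse c%p-pos (m%n<n c p)
    d = proj₁ inv
    hasAll : Full (scale c W)
    hasAll j 1≤j j<p with full cd ((d * j) % p) (nz-pos⁻¹ (≤-reflexive (sym (trans (nz-scale {d} (inverse-unit {d} {c % p} (proj₂ inv)) j<p) (nz-pos 1≤j))))) (m%n<n (d * j) p)
    ... | P , e = P , trans (cong (λ z → (c * z) % p) e) back
      where
      assoc : ∀ a b c → a * (b * c) ≡ (b * a) * c
      assoc = solve-∀
      back : (c * ((d * j) % p)) % p ≡ j
      back = trans (%-distribˡ-* c ((d * j) % p) p) (trans (cong (λ z → (c % p * z) % p) (m%n%n≡m%n (d * j) p))
        (trans (cong (λ z → (z * ((d * j) % p)) % p) (sym (m%n%n≡m%n c p)))
        (trans (sym (%-distribˡ-* (c % p) (d * j) p))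
        (trans (cong (_% p) (assoc (c % p) d j)) (trans (%-distribˡ-* (d * (c % p)) j p)
        (trans (cong (λ z → (z * (j % p)) % p) (proj₂ inv)) (trans (cong (_% p) (*-identityˡ (j % p))) (trans (m%n%n≡m%n j p) (m<n⇒m%n≡m j<p)))))))))

  -- The slack in `cls-lower`. Under `Cond e W` the class of -1 has exactly 2p + 1 - e + exc W + kap
  -- W points.
  kap : DualWord → ℕ
  kap W = (wt W + cls W p-1) ∸ (exc W + (2 * q + 3))

  kap-eq : ∀ {e W} → Cond e W → wt W + cls W p-1 ≡ exc W + (2 * q + 3) + kap W
  kap-eq {e} {W} c = sym (m+[n∸m]≡n (cls-lower W (has-1 c)))

  kap-neg-neg : ∀ W → kap (neg (neg W)) ≡ kap W
  kap-neg-neg W = cong₂ _∸_ (cong₂ _+_ (trans (wt-neg (neg W)) (wt-neg W)) (trans (cls-neg-p-1 (neg W)) (cls-neg-1 W))) (cong (_+ (2 * q + 3)) (exc-neg-neg W))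

  kap-bound : ∀ {e W} → Cond e W → kap W + 1 ≤ exc W + e
  kap-bound {e} {W} c = arith-kap {wt W} {q} {e} {cls W p-1} {exc W} p (weigh c) (kap-eq c) (cls-upper W (has-1 c) 1 (proj₂ (full c 2 (s≤s z≤n) 2<p)) 2<p-1)

  -- The total κ of a pair of opposite classes: `kap W` belongs to -1 and `kap (neg W)` to 1.
  Kap : DualWord → ℕ
  Kap W = kap W + kap (neg W)

  Kap-neg : ∀ W → Kap (neg W) ≡ Kap W
  Kap-neg W = trans (cong (kap (neg W) +_) (kap-neg-neg W)) (+-comm (kap (neg W)) (kap W))

  Double : DualWord → DualWord → Set
  Double U V = ∀ Q → val V Q ≡ (2 * val U Q) % p

  p∤2 : ¬ p ∣ 2
  p∤2 = p∤small (s≤s z≤n) 2<p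

  residues-sum : ∀ {a b} → p ∣ a + b → 1 ≤ a % p → b % p ≡ p ∸ a % p
  residues-sum {a} {b} d pos = go (quotient dr) (_∣_.equality dr)
    where
    dr : p ∣ a % p + b % p
    dr = m%n≡0⇒n∣m _ p (trans (sym (%-distribˡ-+ a b p)) (n∣m⇒m%n≡0 (a + b) p d))
    go : ∀ k → a % p + b % p ≡ k * p → b % p ≡ p ∸ a % p
    go 0 e = ⊥-elim (<⇒≢ pos (sym (m+n≡0⇒m≡0 (a % p) e)))
    go 1 e = trans (sym (m+n∸m≡n (a % p) (b % p))) (cong (_∸ a % p) (trans e (+-identityʳ p)))
    go (suc (suc k)) e = ⊥-elim (<⇒≱ (+-mono-< (m%n<n a p) (m%n<n b p)) (≤-trans (m≤m+n (p + p) (k * p)) (≤-reflexive (sym (trans e (sym (+-assoc p p (k * p))))))))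

  double-negv : ∀ {u} → u < p → negv ((2 * u) % p) ≡ (2 * negv u) % p
  double-negv {zero}  _   = trans (cong negv (m<n⇒m%n≡m 0<p)) (sym (m<n⇒m%n≡m 0<p))
  double-negv {suc u} u<p = trans (negv-pos pos) (sym (residues-sum {2 * suc u} {2 * (p ∸ suc u)}
      (divides 2 (trans (sym (*-distribˡ-+ 2 (suc u) (p ∸ suc u))) (cong (2 *_) (m+[n∸m]≡n (<⇒≤ u<p))))) pos))
    where
    pos : 1 ≤ (2 * suc u) % p
    pos = nz-pos⁻¹ (≤-reflexive (sym (nz-scale {2} p∤2 u<p)))

  double-neg : ∀ {U V} → Double U V → Double (neg U) (neg V)
  double-neg {U} d Q = trans (cong negv (d Q)) (double-negv (val<p U Q))

  2[p-1] : (2 * p-1) % p ≡ p ∸ 2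
  2[p-1] = trans (cong (_% p) eq) (trans ([m+n]%n≡m%n (p ∸ 2) p) (m<n⇒m%n≡m (∸-monoʳ-< {p} (s≤s z≤n) (<⇒≤ 2<p))))
    where
    eq : 2 * p-1 ≡ p ∸ 2 + p
    eq = +-cancelˡ-≡ 2 _ _ (trans (e p-1) (trans (cong (λ z → z + z) suc-p-1) (trans (cong (_+ p) (sym (m+[n∸m]≡n (<⇒≤ 2<p)))) (+-assoc 2 (p ∸ 2) p))))
      where
      e : ∀ z → 2 + 2 * z ≡ suc z + suc z
      e = solve-∀

  2[p-1]≢1 : (2 * p-1) % p ≢ 1
  2[p-1]≢1 e = <⇒≱ (≤-trans lit 7≤p)
    (≤-reflexive (trans (sym (m+[n∸m]≡n (<⇒≤ 2<p))) (cong (2 +_) (trans (sym 2[p-1]) e))))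

  -- Measured in V, the class 1 of V is the residue 1, the class -1 of U is -2 and the class 1 of U
  -- is 2. Keeping both words gives two line sums to work with, one lifted from each scale.
  module Doubling {e : ℕ} {U V : DualWord} (cU : Cond e U) (cV : Cond e V) (dbl : Double U V) where

    val-U≢ : ∀ {P} → val V P ≡ 1 → val U P ≢ p-1
    val-U≢ {P} e1 e2 = 2[p-1]≢1 (trans (cong (λ z → (2 * z) % p) (sym e2)) (trans (sym (dbl P)) e1))

    private
      π = p ∸ 7
      p≡ : 7 + π ≡ p
      p≡ = m+[n∸m]≡n 7≤p
      p-1≡ : 6 + π ≡ p-1
      p-1≡ = suc-injective (trans p≡ (sym suc-p-1))
      p-2≡ : 5 + π ≡ p ∸ 2
      p-2≡ = +-cancelˡ-≡ 2 _ _ (trans p≡ (sym (m+[n∸m]≡n (<⇒≤ 2<p))))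

      oth : Pt → ℕ
      oth Q = nz (val V Q) ∸ (δ (val V Q) 1 + δ (val U Q) p-1)

      isV : ∀ {Q} → val U Q ≡ p-1 → val V Q ≡ p ∸ 2
      isV {Q} e1 = trans (dbl Q) (trans (cong (λ z → (2 * z) % p) e1) 2[p-1])

      1≤p-2 : 1 ≤ p ∸ 2
      1≤p-2 = m<n⇒0<n∸m 2<p

      low : ∀ Q → 1 * δ (val V Q) 1 + ((5 + π) * δ (val U Q) p-1 + (2 * oth Q + 0)) ≤ 1 * val V Q + 0
      low Q with val U Q ≟ p-1
      ... | yes eU with isV {Q} eU
      ...   | eV rewrite δ-≡ eU | eV | δ-≢ {p ∸ 2} {1} (λ x → 2[p-1]≢1 (trans 2[p-1] x)) | nz-pos 1≤p-2 =
          ≤-reflexive (trans (e0 (5 + π)) (cong (λ z → 1 * z + 0) p-2≡))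
        where
        e0 : ∀ z → 1 * 0 + (z * 1 + (2 * 0 + 0)) ≡ 1 * z + 0
        e0 = solve-∀
      low Q | no nU rewrite δ-≢ nU | *-zeroʳ (5 + π) with val V Q
      ...   | 0 = z≤n
      ...   | 1 = ≤-refl
      ...   | suc (suc v) = lit

      low2 : ∀ Q → 1 * δ (val V Q) 1 + ((5 + π) * δ (val U Q) p-1 + 0) ≤ 1 * val V Q + 0
      low2 Q = ≤-trans (+-monoʳ-≤ (1 * δ (val V Q) 1) (+-monoʳ-≤ ((5 + π) * δ (val U Q) p-1) z≤n)) (low Q)

      up : ∀ Q → 1 * val V Q + 0 ≤ 1 * δ (val V Q) 1 + ((5 + π) * δ (val U Q) p-1 + ((7 + π) * oth Q + 0))
      up Q with val U Q ≟ p-1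
      ... | yes eU with isV {Q} eU
      ...   | eV rewrite δ-≡ eU | eV | δ-≢ {p ∸ 2} {1} (λ x → 2[p-1]≢1 (trans 2[p-1] x)) | nz-pos 1≤p-2 | *-zeroʳ (7 + π) =
          ≤-reflexive (trans (cong (λ z → 1 * z + 0) (sym p-2≡)) (e0 (5 + π)))
        where
        e0 : ∀ z → 1 * z + 0 ≡ 1 * 0 + (z * 1 + 0)
        e0 = solve-∀
      up Q | no nU rewrite δ-≢ nU | *-zeroʳ (5 + π) with val V Q | val<p V Q
      ...   | 0 | _ = z≤n
      ...   | 1 | _ = s≤s z≤n
      ...   | suc (suc v) | lt = ≤-trans (≤-reflexive (e0 (suc (suc v)))) (≤-trans (<⇒≤ lt) (≤-reflexive (trans (sym p≡) (e1 (7 + π)))))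
        where
        e0 : ∀ z → 1 * z + 0 ≡ z
        e0 = solve-∀
        e1 : ∀ z → z ≡ z * 1 + 0
        e1 = solve-∀

      -- A point of value 1 in V has value (p + 1)/2 in U; doubling avoids the fraction and produces
      -- the coefficient 8 + π = p + 1.
      half : ∀ Q → (2 * (6 + π)) * δ (val U Q) p-1 + ((8 + π) * δ (val V Q) 1 + 0) ≤ 2 * val U Q + 0
      half Q with val U Q ≟ p-1
      ... | yes eU rewrite δ-≡ eU | isV {Q} eU | δ-≢ {p ∸ 2} {1} (λ x → 2[p-1]≢1 (trans 2[p-1] x)) =
          ≤-reflexive (trans (e0 (6 + π) (8 + π)) (cong (λ z → 2 * z + 0) (trans p-1≡ (sym eU))))
        where
        e0 : ∀ a b → (2 * a) * 1 + (b * 0 + 0) ≡ 2 * a + 0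
        e0 = solve-∀
      ... | no nU rewrite δ-≢ nU | *-zeroʳ (2 * (6 + π)) with val V Q ≟ 1
      ...   | no nV rewrite δ-≢ nV | *-zeroʳ (8 + π) = z≤n
      ...   | yes eV rewrite δ-≡ eV = ≤-trans (≤-reflexive (trans (e0 (8 + π)) (cong suc p≡))) (≤-trans big (≤-reflexive (sym (+-identityʳ _))))
        where
        e0 : ∀ a → a * 1 + 0 ≡ a
        e0 = solve-∀
        big : suc p ≤ 2 * val U Q
        big with 2 * val U Q <? p
        ... | yes lt = ⊥-elim (two-≢-1 (val U Q) (trans (sym (m<n⇒m%n≡m lt)) (trans (sym (dbl Q)) eV)))
          where
          two-≢-1 : ∀ u → 2 * u ≢ 1
          two-≢-1 zero ()
          two-≢-1 (suc u) e = 1+n≢0 (suc-injective (trans (sym (e2 u)) e))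
            where
            e2 : ∀ u → 2 * suc u ≡ suc (suc (2 * u))
            e2 = solve-∀
        ... | no ge with m≤n⇒m<n∨m≡n (≮⇒≥ ge)
        ...   | inj₁ lt = lt
        ...   | inj₂ e = ⊥-elim (p-odd (val U Q) (trans e (cong (val U Q +_) (+-identityʳ (val U Q)))))

    line-V : ∀ ℓ → 1 * onLine ℓ (val V) + 0 ≡ quo V ℓ * (7 + π)
    line-V ℓ = trans (+-identityʳ _) (trans (*-identityˡ _) (trans (dual V ℓ) (cong (quo V ℓ *_) (sym p≡))))

    line-U : ∀ ℓ → 2 * onLine ℓ (val U) + 0 ≡ 2 * (quo U ℓ * (7 + π))
    line-U ℓ = trans (+-identityʳ _) (cong (2 *_) (trans (dual U ℓ) (cong (quo U ℓ *_) (sym p≡))))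

    quo-V-pos : ∀ ℓ → 1 ≤ cnt V 1 ℓ → 1 ≤ quo V ℓ
    quo-V-pos ℓ h with cnt-point V h
    ... | P , t , e1 = quo-pos V t (≤-reflexive (sym e1))

    quo-V≤3 : ∀ ℓ → 1 ≤ cnt V 1 ℓ → quo V ℓ ≤ 3
    quo-V≤3 ℓ h with cnt-point V h
    ... | P , t , e1 = ≤-trans (quo-upper V t e1) (+-monoʳ-≤ 1 (≤-trans (m≤m+n (exc V) _) (≤-trans (≤-reflexive (exc-e cV)) (e≤2 cV))))

    quo-U-opp : ∀ ℓ → 1 ≤ cnt U p-1 ℓ → 2 ≤ quo U ℓ + cnt U 1 ℓ
    quo-U-opp ℓ h with cnt-point (neg U) {1} {ℓ} (≤-trans h (≤-reflexive (sym (cnt-neg-1 U ℓ))))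
    ... | P , t , e1 = subst₂ (λ a b → 2 ≤ a + b) (quo-neg-neg U ℓ) (cnt-neg-p-1 U ℓ) (line-opposite (neg U) t e1)

    line-ineq : ∀ ℓ → 2 * (cnt V 1 ℓ * cnt U p-1 ℓ) + (4 * (cnt V 1 ℓ * 1) + (2 * (cnt U p-1 ℓ * 1) + 0)) ≤
      2 * (cnt V 1 ℓ * cnt V 1 ℓ) + (2 * (cnt V 1 ℓ * quo V ℓ) + (1 * (cnt U p-1 ℓ * quo U ℓ) + (1 * (cnt U p-1 ℓ * cnt U 1 ℓ) + 0)))
    line-ineq ℓ = arith-L π (quo-V-pos ℓ) (quo-V≤3 ℓ) (quo-U-opp ℓ)
      (≤-trans (comb-mono (pts ℓ) ((1 , (is V 1)) ∷ (5 + π , (is U p-1)) ∷ []) ((1 , val V) ∷ []) (λ Q _ → low2 Q)) (≤-reflexive (line-V ℓ)))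
      (≤-trans (comb-mono (pts ℓ) ((2 * (6 + π) , (is U p-1)) ∷ (8 + π , (is V 1)) ∷ []) ((2 , val U) ∷ []) (λ Q _ → half Q)) (≤-reflexive (line-U ℓ)))
      -- With m = n = t = 1 the two points sum to p - 1 in V, and the missing 1 cannot come from the
      -- other points, whose values are at least 2.
      (λ em en et → excl (onLine ℓ oth)
        (subst (λ m → 1 * m + ((5 + π) * 1 + (2 * onLine ℓ oth + 0)) ≤ 1 * (7 + π)) em (subst₂ (λ n t → 1 * cnt V 1 ℓ + ((5 + π) * n + (2 * onLine ℓ oth + 0)) ≤ t * (7 + π)) en et
          (≤-trans (comb-mono (pts ℓ) ((1 , (is V 1)) ∷ (5 + π , (is U p-1)) ∷ (2 , oth) ∷ []) ((1 , val V) ∷ []) (λ Q _ → low Q)) (≤-reflexive (line-V ℓ)))))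
        (subst (λ m → 1 * (7 + π) ≤ 1 * m + ((5 + π) * 1 + ((7 + π) * onLine ℓ oth + 0))) em (subst₂ (λ n t → t * (7 + π) ≤ 1 * cnt V 1 ℓ + ((5 + π) * n + ((7 + π) * onLine ℓ oth + 0))) en et
          (≤-trans (≤-reflexive (sym (line-V ℓ))) (comb-mono (pts ℓ) ((1 , val V) ∷ []) ((1 , (is V 1)) ∷ (5 + π , (is U p-1)) ∷ (7 + π , oth) ∷ []) (λ Q _ → up Q))))))
      where
      excl : ∀ o → 1 * 1 + ((5 + π) * 1 + (2 * o + 0)) ≤ 1 * (7 + π) → 1 * (7 + π) ≤ 1 * 1 + ((5 + π) * 1 + ((7 + π) * o + 0)) → ⊥
      excl zero _ h = ≤-absurd 0 h (e0 π)
        where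
        e0 : ∀ π → 1 * (7 + π) ≡ suc (1 * 1 + ((5 + π) * 1 + ((7 + π) * 0 + 0)) + 0)
        e0 = solve-∀
      excl (suc o) h _ = ≤-absurd (2 * o) h (e0 π o)
        where
        e0 : ∀ π o → 1 * 1 + ((5 + π) * 1 + (2 * suc o + 0)) ≡ suc (1 * (7 + π) + 2 * o)
        e0 = solve-∀

    -- Weighting a line by its number of points of a class amounts to summing over those points and
    -- the lines through them. Every term of the quadratic `line-ineq` has a factor `cnt V 1` or
    -- `cnt U p-1`, so its sum over all lines is known exactly.
    class-sum : ∀ W j (F : Pt → ℕ) C → (∀ P → val W P ≡ j → through P F ≡ C) → wsum (λ _ → true) (λ ℓ → cnt W j ℓ * F ℓ) ≡ cls W j * C
    class-sum W j F C h = trans (wsum-true {N} _) (trans (sum-incidence (is W j) F)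
        (trans (sum-cong {N} go) (trans (sum-*ˡ C (is W j)) (*-comm C (cls W j)))))
      where
      go : ∀ P → δ (val W P) j * through P F ≡ C * δ (val W P) j
      go P with val W P ≟ j
      ... | yes e1 = trans (cong (δ (val W P) j *_) (h P e1)) (*-comm (δ (val W P) j) C)
      ... | no ne rewrite δ-≢ ne = sym (*-zeroʳ C)

    val-V≢1 : ∀ {P} → val U P ≡ p-1 → val U P ≢ 1
    val-V≢1 e1 e2 = 1≢p-1 (trans (sym e2) e1)

    p-1≡suc : p-1 ≡ suc (p ∸ 2)
    p-1≡suc = suc-injective (trans suc-p-1 (sym (m+[n∸m]≡n (<⇒≤ 2<p))))

    global : 2 * (cls V 1 * (cls U p-1 + q * 0)) + (4 * (cls V 1 * suc q) + (2 * (cls U p-1 * suc q) + 0)) ≤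
      2 * (cls V 1 * (cls V 1 + q * 1)) + (2 * (cls V 1 * (suc q + exc V + 0)) + (1 * (cls U p-1 * (suc q + exc U + (p ∸ 2) * p)) + (1 * (cls U p-1 * (cls U 1 + q * 0)) + 0)))
    global = subst₂ _≤_
      (cong₂ _+_ (cong (2 *_) (class-sum V 1 (cnt U p-1) _ (λ P e1 → through-cnt-≢ U p-1 (val-U≢ e1))))
        (cong₂ _+_ (cong (4 *_) (class-sum V 1 (λ _ → 1) _ (λ P _ → through-1 P)))
          (cong (_+ 0) (cong (2 *_) (class-sum U p-1 (λ _ → 1) _ (λ P _ → through-1 P))))))
      (cong₂ _+_ (cong (2 *_) (class-sum V 1 (cnt V 1) _ (λ P e1 → through-cnt-≡ V 1 e1)))
        (cong₂ _+_ (cong (2 *_) (class-sum V 1 (quo V) _ (λ P e1 → exc-1 V e1)))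
          (cong₂ _+_ (cong (1 *_) (class-sum U p-1 (quo U) _ (λ P e1 → exc-quo U (has-1 cU) (trans e1 p-1≡suc))))
            (cong (_+ 0) (cong (1 *_) (class-sum U p-1 (cnt U 1) _ (λ P e1 → through-cnt-≢ U 1 (val-V≢1 e1))))))))
      (comb-mono (λ _ → true)
        ((2 , (λ ℓ → cnt V 1 ℓ * cnt U p-1 ℓ)) ∷ (4 , (λ ℓ → cnt V 1 ℓ * 1)) ∷ (2 , (λ ℓ → cnt U p-1 ℓ * 1)) ∷ [])
        ((2 , (λ ℓ → cnt V 1 ℓ * cnt V 1 ℓ)) ∷ (2 , (λ ℓ → cnt V 1 ℓ * quo V ℓ)) ∷ (1 , (λ ℓ → cnt U p-1 ℓ * quo U ℓ)) ∷ (1 , (λ ℓ → cnt U p-1 ℓ * cnt U 1 ℓ)) ∷ [])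
        (λ ℓ _ → line-ineq ℓ))

    private
      B = 2 * p + 1 ∸ e
      e≤2p+1 : e ≤ 2 * p + 1
      e≤2p+1 = ≤-trans (e≤2 cU) (≤-trans lit (≤-trans 7≤p (≤-trans (m≤m+n p (p + 0)) (m≤m+n (2 * p) 1))))
      B+e : B + e ≡ 2 * p + 1
      B+e = m∸n+n≡m e≤2p+1
      wt-B : ∀ {W} → Cond e W → wt W + B ≡ 2 * q + 3
      wt-B {W} c = arith-B {wt W} {q} {e} {p} (weigh c) B+e
      kap-eq' : ∀ {W} → Cond e W → wt W + cls W 1 ≡ exc (neg W) + (2 * q + 3) + kap (neg W)
      kap-eq' {W} c = trans (cong₂ _+_ (sym (wt-neg W)) (sym (cls-neg-p-1 W))) (kap-eq (cond-neg c))
      x≡ : cls V 1 ≡ B + exc (neg V) + kap (neg V)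
      x≡ = arith-cls {wt V} {q = q} {exc (neg V)} (kap-eq' cV) (wt-B cV)
      y≡ : cls U 1 ≡ B + exc (neg U) + kap (neg U)
      y≡ = arith-cls {wt U} {q = q} {exc (neg U)} (kap-eq' cU) (wt-B cU)
      y'≡ : cls U p-1 ≡ B + exc U + kap U
      y'≡ = arith-cls {wt U} {q = q} {exc U} (kap-eq cU) (wt-B cU)

    exc-U≤2 : exc U ≤ 2
    exc-U≤2 = ≤-trans (m≤m+n (exc U) _) (≤-trans (≤-reflexive (exc-e cU)) (e≤2 cU))

    y'<2x : suc (cls U p-1) ≤ 2 * cls V 1
    y'<2x = arith-y'<2x {wt V} {q} {e} {cls V 1} {cls U p-1} {exc U} {exc (neg V)} p 7≤p (weigh cV) (e≤2 cV) exc-U≤2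
      (cls-upper U (has-1 cU) 1 (proj₂ (full cU 2 (s≤s z≤n) 2<p)) 2<p-1) (cls-lower-1 {V} (cond-small cV) (has-1 cV))

    -- Once the class sizes are written as 2p + 1 - e plus excess plus κ, the large terms of
    -- `global` cancel and only excesses and slacks are left.
    summed : 2 * cls V 1 * (exc U + kap U + 1) ≤ cls U p-1 * kap (neg U) + 2 * cls V 1 * (e + kap (neg V))
    summed = arith-D {cls V 1} {cls U 1} {cls U p-1} {q} {p} {p ∸ 2} {e} {B} {exc V} {exc U}
      (arith-h1 {q} {cls U 1} {p} {p ∸ 2} {B} {exc U} {exc (neg U)} (sym (m+[n∸m]≡n (<⇒≤ 2<p))) refl (trans (cong (B +_) (exc-e cU)) B+e) y≡)
      (arith-x+E {cls V 1} {B} {e} {exc V} x≡ (exc-e cV)) y'≡ global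

    step-0 : kap (neg U) ≡ 0 → exc U + kap U + 1 ≤ e + kap (neg V)
    step-0 z = *-cancelˡ-≤ (2 * cls V 1) {{>-nonZero (≤-trans (s≤s z≤n) y'<2x)}} (≤-trans summed
      (≤-reflexive (cong (_+ 2 * cls V 1 * (e + kap (neg V))) (trans (cong (cls U p-1 *_) z) (*-zeroʳ (cls U p-1))))))

    -- Dividing `summed` by 2 `cls V 1` leaves less than the full `kap (neg U)`, since `cls U p-1`
    -- is smaller than the divisor; integrality turns this into a gain of 1.
    step-pos : 1 ≤ kap (neg U) → exc U + kap U + 2 ≤ e + kap (neg V) + kap (neg U)
    step-pos pos = ≤-trans (≤-reflexive (+-suc (exc U + kap U) 1)) (arith-strict {cls V 1} pos y'<2x summed)

    cls-relation : exc U ≡ 1 → e ≡ 2 → kap U ≡ 0 → kap (neg V) ≡ 0 → cls V 1 + exc V ≡ B + 2 × cls U p-1 ≡ B + 1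
    cls-relation eF e2 z z' = trans (arith-x+E {cls V 1} {B} {e} {exc V} x≡ (exc-e cV)) (trans (cong₂ (λ a b → B + a + b) e2 z') (+-identityʳ _)) ,
      trans y'≡ (trans (cong₂ (λ a b → B + a + b) eF z) (+-identityʳ _))

  -- `kap W` is the total loss of `line-quo` over the lines through any one point of value 1, so
  -- when it is zero no such line loses anything.
  tight-line-quo : ∀ {e W} → Cond e W → kap W ≡ 0 → ∀ {ℓ} → 1 ≤ cnt W 1 ℓ →
                   1 * quo W ℓ + (2 * 1 + 0) ≡ 1 * size W ℓ + (1 * cnt W p-1 ℓ + 0)
  tight-line-quo {e} {W} c z {ℓ} h with cnt-point W h
  ... | P , t , e1 = comb-eq (I P) ((1 , quo W) ∷ (2 , (λ _ → 1)) ∷ []) ((1 , size W) ∷ (1 , cnt W p-1) ∷ []) (λ m t → line-quo W t e1)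
      (arith-f-rev q (exc W) (wt W) (cls W p-1) (exc-1 W e1) (through-1 P) (through-size-1 W e1) (through-cnt-≢ W p-1 (λ x → 1≢p-1 (trans (sym e1) x)))
        (trans (kap-eq c) (cong (exc W + (2 * q + 3) +_) z))) ℓ t

  tight-line-opp : ∀ {e W} → Cond e W → kap (neg W) ≡ 0 → ∀ {ℓ} → 1 ≤ cnt W p-1 ℓ →
                   1 * quo (neg W) ℓ + (2 * 1 + 0) ≡ 1 * size W ℓ + (1 * cnt W 1 ℓ + 0)
  tight-line-opp {e} {W} c z {ℓ} h = trans (tight-line-quo (cond-neg c) z {ℓ} (≤-trans h (≤-reflexive (sym (cnt-neg-1 W ℓ)))))
    (cong₂ (λ a b → 1 * a + (1 * b + 0)) (size-neg W ℓ) (cnt-neg-p-1 W ℓ))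

  kap-0ˡ : ∀ W → Kap W ≡ 0 → kap W ≡ 0
  kap-0ˡ W z = m+n≡0⇒m≡0 (kap W) z

  kap-0ʳ : ∀ W → Kap W ≡ 0 → kap (neg W) ≡ 0
  kap-0ʳ W z = m+n≡0⇒n≡0 (kap W) z

  module Descent {e : ℕ} {U V : DualWord} (cU : Cond e U) (cV : Cond e V) (dbl : Double U V) where
    private
      module D⁺ = Doubling cU cV dbl
      module D⁻ = Doubling (cond-neg cU) (cond-neg cV) (double-neg {U} {V} dbl)

      neg-0 : kap U ≡ 0 → exc (neg U) + kap (neg U) + 1 ≤ e + kap V
      neg-0 z = ≤-trans (D⁻.step-0 (trans (kap-neg-neg U) z)) (≤-reflexive (cong (e +_) (kap-neg-neg V)))

      neg-pos : 1 ≤ kap U → exc (neg U) + kap (neg U) + 2 ≤ e + kap V + kap U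
      neg-pos h = ≤-trans (D⁻.step-pos (≤-trans h (≤-reflexive (sym (kap-neg-neg U)))))
        (≤-reflexive (cong₂ (λ a b → e + a + b) (kap-neg-neg V) (kap-neg-neg U)))

    descend : Kap V ≡ 0 → kap U ≡ 0 × kap (neg U) ≡ 0 × e ≡ 2 × exc U ≡ 1
    descend z = arith-K0 (e≤2 cU) (exc-e cU)
      (λ h → ≤-trans (D⁺.step-0 h) (≤-reflexive (cong (e +_) (kap-0ʳ V z))))
      (λ h → ≤-trans (D⁺.step-pos h) (≤-reflexive (cong (λ a → e + a + kap (neg U)) (kap-0ʳ V z))))
      (λ h → ≤-trans (neg-0 h) (≤-reflexive (cong (e +_) (kap-0ˡ V z))))
      (λ h → ≤-trans (neg-pos h) (≤-reflexive (cong (λ a → e + a + kap U) (kap-0ˡ V z))))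

    -- For the case p = 7: along the orbit of doubling a `Kap` of 2 or more is never followed by 1.
    ascend : e ≡ 2 → Kap V ≡ 1 → 2 ≤ Kap U → ⊥
    ascend refl hV hU = arith-K2 {exc U} {exc (neg U)} {kap V} {kap (neg V)} {kap U} {kap (neg U)} (exc-e cU) hV hU (kap-bound cU) (kap-bound (cond-neg cU))
      D⁺.step-0 D⁺.step-pos neg-0 neg-pos

    -- On lines with n > 0 one has s + μ = 2, so `line-ineq` divided by 2m becomes n + 2 ≤ m + t,
    -- and the class sizes make its sum through a point of value 1 an equality. A line of size k ≥ 4
    -- has no point of value -1, as both tight identities would give k < 4; hence t = k - 2.
    points-on-line : Kap V ≡ 0 → ∀ ℓ → 4 ≤ size V ℓ → 1 ≤ cnt V 1 ℓ → cnt U p-1 ℓ + 4 ≡ cnt V 1 ℓ + size V ℓ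
    points-on-line z ℓ 4≤k h = arith-step {cnt V 1 ℓ} {cnt U p-1 ℓ} {quo V ℓ} {quo (neg V) ℓ} {size V ℓ} {cnt V p-1 ℓ} 4≤k h (quo-neg V ℓ) (tight-line-quo cV (kap-0ˡ V z) h) (tight-line-opp cV (kap-0ʳ V z))
        (comb-eq (I P) ((1 , cnt U p-1) ∷ (2 , (λ _ → 1)) ∷ []) ((1 , cnt V 1) ∷ (1 , quo V) ∷ []) (λ m t → gline m (cnt-pos V t eP))
          (arith-g-rev q (exc V) (cls V 1) (cls U p-1) (2 * p + 1 ∸ e) (through-cnt-≢ U p-1 (D⁺.val-U≢ eP)) (through-1 P) (through-cnt-≡ V 1 eP) (exc-1 V eP)
            (proj₁ rel) (proj₂ rel)) ℓ tP)
      where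
      zU  = proj₁ (descend z)
      zU' = proj₁ (proj₂ (descend z))
      e≡2 = proj₁ (proj₂ (proj₂ (descend z)))
      F≡1 = proj₂ (proj₂ (proj₂ (descend z)))
      pt  = cnt-point V h
      P   = proj₁ pt
      tP  = proj₁ (proj₂ pt)
      eP  = proj₂ (proj₂ pt)
      rel = D⁺.cls-relation F≡1 e≡2 zU (kap-0ʳ V z)
      opp : ∀ m → 1 ≤ cnt U p-1 m → quo U m + cnt U 1 m ≡ 2
      opp m h = two (quo U m) (quo (neg U) m) (size U m) (cnt U 1 m) (quo-neg U m) (tight-line-opp cU zU' h)
        where
        two : ∀ a b k c → a + b ≡ k → 1 * b + (2 * 1 + 0) ≡ 1 * k + (1 * c + 0) → a + c ≡ 2
        two a b k c refl h = +-cancelˡ-≡ b _ _ (trans (e0 a b c) (trans (sym h) (e1 b)))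
          where
          e0 : ∀ a b c → b + (a + c) ≡ 1 * (a + b) + (1 * c + 0)
          e0 = solve-∀
          e1 : ∀ b → 1 * b + (2 * 1 + 0) ≡ b + 2
          e1 = solve-∀
      gline : ∀ m → 1 ≤ cnt V 1 m → 1 * cnt U p-1 m + (2 * 1 + 0) ≤ 1 * cnt V 1 m + (1 * quo V m + 0)
      gline m h = go (cnt V 1 m) h (D⁺.line-ineq m)
        where
        go : ∀ c → 1 ≤ c → 2 * (c * cnt U p-1 m) + (4 * (c * 1) + (2 * (cnt U p-1 m * 1) + 0)) ≤ 2 * (c * c) + (2 * (c * quo V m) + (1 * (cnt U p-1 m * quo U m) + (1 * (cnt U p-1 m * cnt U 1 m) + 0))) →
             1 * cnt U p-1 m + (2 * 1 + 0) ≤ 1 * c + (1 * quo V m + 0)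
        go (suc c) _ le = arith-gline {c} {cnt U p-1 m} {quo V m} {quo U m} {cnt U 1 m} (opp m) le

-- Words that take every value do not exist

private
  arith-4 : ∀ {m t t' k c} → 2 ≤ t → 1 ≤ m → t + t' ≡ k → 1 * t + (2 * 1 + 0) ≡ 1 * k + (1 * c + 0) →
    (1 ≤ c → 1 * t' + (2 * 1 + 0) ≡ 1 * k + (1 * m + 0)) → 4 ≤ k
  arith-4 {m} {t} {t'} {k} {zero} 2≤t 1≤m ht h1 h2 = ≤-from-sum 0 (2≤t ⊕ (≤-reflexive h1)) (solve (t ∷ k ∷ []))
  arith-4 {m} {t} {t'} {k} {suc c} 2≤t 1≤m ht h1 h2 = ⊥-elim (≤-absurd 0
      (2≤t ⊕ 1≤m ⊕ ((≤-reflexive (sym (h2 (s≤s z≤n)))) ⊕ (≤-reflexive ht))) (solve (m ∷ t ∷ t' ∷ k ∷ [])))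

  -- The counts increase by k - 4 from class to class, so five of them make up 5 m₄ + 10 (k - 4) >
  -- k. Four would not do: k = 4 with one point in each class is consistent.
  arith-five : ∀ {m₀ m₁ m₂ m₃ m₄ k} → 4 ≤ k → 1 ≤ m₄ → m₃ + 4 ≡ m₄ + k → m₂ + 4 ≡ m₃ + k → m₁ + 4 ≡ m₂ + k → m₀ + 4 ≡ m₁ + k →
    1 * m₀ + (1 * m₁ + (1 * m₂ + (1 * m₃ + (1 * m₄ + 0)))) ≤ 1 * k + 0 → ⊥
  arith-five {m₀} {m₁} {m₂} {m₃} {m₄} {k} 4≤k 1≤m h3 h2 h1 h0 le = ≤-absurd 0
      (le ⊕ (9 ⊗ 4≤k ⊕ 5 ⊗ 1≤m) ⊕ (4 ⊗ (≤-reflexive (sym h3)) ⊕ 3 ⊗ (≤-reflexive (sym h2)) ⊕ (2 ⊗ (≤-reflexive (sym h1)) ⊕ (≤-reflexive (sym h0)))))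
      (solve (m₀ ∷ m₁ ∷ m₂ ∷ m₃ ∷ m₄ ∷ k ∷ []))

  arith-pair : ∀ {w x x' E E' q e κ κ'} → w + x' ≡ E + (2 * q + 3) + κ → w + x ≡ E' + (2 * q + 3) + κ' → E + E' ≡ e →
               x + x' + 2 * w ≡ 4 * q + 6 + e + (κ + κ')
  arith-pair {w} {x} {x'} {E} {E'} {q} {e} {κ} {κ'} h1 h2 refl = trans (e1 w x x') (trans (cong₂ _+_ h1 h2) (e2 E E' q κ κ'))
    where
    e1 : ∀ w x x' → x + x' + 2 * w ≡ (w + x') + (w + x)
    e1 = solve-∀
    e2 : ∀ E E' q κ κ' → E + (2 * q + 3) + κ + (E' + (2 * q + 3) + κ') ≡ 4 * q + 6 + (E + E') + (κ + κ')
    e2 = solve-∀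

  arith-total : ∀ {w e} π → (6 + π) * (4 * ((7 + π) * (7 + π)) + 7 + e) ≤ w + w + (6 + π) * (2 * w) → w + 2 * (7 + π) ≡ 2 * ((7 + π) * (7 + π)) + 2 + e →
                3 * (7 + π) ≤ 7 + e * (8 + π)
  arith-total {w} {e} π h1 h2 = ≤-from-sum 0 (h1 ⊕ (2 * (7 + π)) ⊗ (≤-reflexive h2)) (solve (w ∷ e ∷ π ∷ []))

  arith-π : ∀ {e} π → e ≤ 2 → 3 * (7 + π) ≤ 7 + e * (8 + π) → π ≤ 2
  arith-π {e} π e≤2 h = ≤-from-sum 0 (h ⊕ e≤2 ⊙ (8 + π)) (solve (e ∷ π ∷ []))

  arith-e2 : ∀ {e} → e ≤ 2 → 3 * (7 + 0) ≤ 7 + e * (8 + 0) → e ≡ 2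
  arith-e2 {0} _ le = ⊥-elim (<⇒≱ lit le)
  arith-e2 {1} _ le = ⊥-elim (≤-absurd 5 le refl)
  arith-e2 {2} _ _ = refl
  arith-e2 {suc (suc (suc e))} (s≤s (s≤s ())) _

  arith-7 : ∀ {w s₁ s₂ s₃ s₄ s₅ s₆ K₁ K₂ K₄} → s₁ + (s₂ + (s₃ + (s₄ + (s₅ + (s₆ + 0))))) ≡ w → w + 2 * 7 ≡ 2 * 49 + 2 + 2 →
    s₁ + s₆ + 2 * w ≡ 4 * 49 + 6 + 2 + K₁ → s₄ + s₃ + 2 * w ≡ 4 * 49 + 6 + 2 + K₂ → s₂ + s₅ + 2 * w ≡ 4 * 49 + 6 + 2 + K₄ → K₁ + K₂ + K₄ ≡ 4
  arith-7 {w} {s₁} {s₂} {s₃} {s₄} {s₅} {s₆} {K₁} {K₂} {K₄} hs hw h1 h2 h4 = +-cancelˡ-≡ 612 _ _ (trans (e1 K₁ K₂ K₄)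
      (trans (cong₂ _+_ (cong₂ _+_ (sym h1) (sym h2)) (sym h4)) (trans (e2 s₁ s₂ s₃ s₄ s₅ s₆ w) (trans (cong (_+ 6 * w) hs) (cong (λ z → z + 6 * z) w≡)))))
    where
    w≡ : w ≡ 88
    w≡ = +-cancelʳ-≡ 14 w 88 hw
    e1 : ∀ a b c → 612 + (a + b + c) ≡ (4 * 49 + 6 + 2 + a) + (4 * 49 + 6 + 2 + b) + (4 * 49 + 6 + 2 + c)
    e1 = solve-∀
    e2 : ∀ s₁ s₂ s₃ s₄ s₅ s₆ w → s₁ + s₆ + 2 * w + (s₄ + s₃ + 2 * w) + (s₂ + s₅ + 2 * w) ≡ s₁ + (s₂ + (s₃ + (s₄ + (s₅ + (s₆ + 0))))) + 6 * w
    e2 = solve-∀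

  -- Such a triple is a rotation of (2, 1, 1), and in cyclic order its 2 is followed by a 1.
  cycle-4 : ∀ a b c → 1 ≤ a → 1 ≤ b → 1 ≤ c → a + b + c ≡ 4 → (b ≡ 1 → 2 ≤ a → ⊥) → (c ≡ 1 → 2 ≤ b → ⊥) → (a ≡ 1 → 2 ≤ c → ⊥) → ⊥
  cycle-4 1 1 (suc (suc c)) _ _ _ _ _ _ h = h refl lit
  cycle-4 1 (suc (suc b)) 1 _ _ _ _ _ h _ = h refl lit
  cycle-4 (suc (suc a)) 1 c _ _ _ _ h _ _ = h refl lit
  cycle-4 1 (suc (suc b)) (suc (suc c)) _ _ _ e _ _ h = h refl lit
  cycle-4 (suc (suc a)) (suc (suc b)) 1 _ _ _ e _ h _ = h refl lit
  cycle-4 (suc (suc a)) (suc (suc b)) (suc (suc c)) _ _ _ e _ _ _ = ≤-absurd (1 + a + b + c) (≤-reflexive e) (solve (a ∷ b ∷ c ∷ []))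
  cycle-4 1 1 1 _ _ _ () _ _ _

module NoFullWord (p : ℕ) .{{_ : NonZero p}} (pr : Prime p) (7≤p : 7 ≤ p) (Π : ProjectivePlane (p * p)) where
  open FullWords p pr 7≤p Π public

  halve : ∀ {e V} → Cond e V → ∃[ U ] (Cond e U × Double U V)
  halve {e} {V} c with inverse (s≤s z≤n) 2<p
  ... | h , inv = scale h V , cond-scale h (inverse-unit {h} {2} inv) c , dbl
    where
    dbl : ∀ Q → val V Q ≡ (2 * ((h * val V Q) % p)) % p
    dbl Q = sym (trans (%-distribˡ-* 2 ((h * v) % p) p) (trans (cong (λ z → (2 % p * z) % p) (m%n%n≡m%n (h * v) p)) (trans (sym (%-distribˡ-* 2 (h * v) p))
      (trans (cong (_% p) (assoc h v)) (trans (%-distribˡ-* (h * 2) v p) (trans (cong (λ z → (z * (v % p)) % p) inv)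
      (trans (cong (_% p) (*-identityˡ (v % p))) (trans (m%n%n≡m%n v p) (m<n⇒m%n≡m (val<p V Q))))))))))
      where
      v = val V Q
      assoc : ∀ h v → 2 * (h * v) ≡ h * 2 * v
      assoc = solve-∀

  nz-double : ∀ {U V} → Double U V → ∀ Q → nz (val V Q) ≡ nz (val U Q)
  nz-double {U} d Q = trans (cong nz (d Q)) (nz-scale {2} p∤2 (val<p U Q))

  size-double : ∀ {U V} → Double U V → ∀ ℓ → size V ℓ ≡ size U ℓ
  size-double {U} {V} d ℓ = wsum-cong (pts ℓ) (nz-double {U} {V} d)

  ∤-from : ∀ {n} a b → n ≡ a * b → 1 ≤ a → a < p → 1 ≤ b → b < p → ¬ p ∣ n
  ∤-from a b refl 1≤a a<p 1≤b b<p d with euclidsLemma a b pr d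
  ... | inj₁ x = p∤small 1≤a a<p x
  ... | inj₂ x = p∤small 1≤b b<p x

  4<p : 4 < p
  4<p = ≤-trans lit 7≤p

  -- Of the five residues, 9 separates -8 from 1 and 16 from -2, and 15 separates 16 from 1.
  p∤9 : ¬ p ∣ 9
  p∤9 = ∤-from 3 3 refl (s≤s z≤n) (<-trans lit 4<p) (s≤s z≤n) (<-trans lit 4<p)

  p∤15 : ¬ p ∣ 15
  p∤15 = ∤-from 3 5 refl (s≤s z≤n) (<-trans lit 4<p) (s≤s z≤n) (≤-trans lit 7≤p)

  dbl : ℕ → ℕ
  dbl u = (2 * u) % p

  dbl-small : ∀ {u} → 2 * u < p → dbl u ≡ 2 * u
  dbl-small = m<n⇒m%n≡m

  p∸ : ∀ {i} → i < p → i + (p ∸ i) ≡ p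
  p∸ lt = m+[n∸m]≡n (<⇒≤ lt)

  dbl-p∸2 : dbl (p ∸ 2) ≡ p ∸ 4
  dbl-p∸2 = residues-sum' {4} {p ∸ 2} 4<p (s≤s z≤n) (trans (sym (*-distribˡ-+ 2 2 (p ∸ 2))) (cong (2 *_) (p∸ 2<p)))
    where
    residues-sum' : ∀ {a u} → a < p → 1 ≤ a → a + 2 * u ≡ 2 * p → dbl u ≡ p ∸ a
    residues-sum' {a} {u} a<p 1≤a e = trans (residues-sum {a} {2 * u} (divides 2 e) (≤-trans 1≤a (≤-reflexive (sym (m<n⇒m%n≡m a<p))))) (cong (p ∸_) (m<n⇒m%n≡m a<p))

  dbl-p-1 : dbl p-1 ≡ p ∸ 2
  dbl-p-1 = 2[p-1]

  p∸i≢1 : ∀ i → i < 6 → p ∸ i ≢ 1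
  p∸i≢1 i i<6 e = <⇒≱ (<-≤-trans (s≤s i<6) 7≤p) (≤-reflexive (trans (sym (p∸ (<-trans i<6 7≤p))) (trans (cong (i +_) e) (+-comm i 1))))

  p∸i≢p-1 : ∀ i → 2 ≤ i → i < 7 → p ∸ i ≢ p-1
  p∸i≢p-1 i 2≤i i<7 e = <⇒≢ 2≤i (sym (∸-cancelˡ-≡ (<⇒≤ (<-≤-trans i<7 7≤p)) (<⇒≤ 1<p) e))

  small≢p-1 : ∀ i → suc i < 7 → i ≢ p-1
  small≢p-1 i lt e = <⇒≢ (<-≤-trans lt 7≤p) (trans (cong suc e) suc-p-1)

  8%p≢p-1 : dbl 4 ≢ p-1
  8%p≢p-1 e = p∤9 (m%n≡0⇒n∣m 9 p (trans (%-distribˡ-+ 8 1 p) (trans (cong₂ (λ a b → (a + b) % p) e (m<n⇒m%n≡m 1<p))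
    (trans (cong (_% p) (trans (+-comm p-1 1) suc-p-1)) (n%n≡0 p)))))

  16%p≢1 : dbl (dbl 4) ≢ 1
  16%p≢1 e = p∤15 (%-≡⇒∣∸ {1} {16} p (trans (m<n⇒m%n≡m 1<p) (sym (trans (trans (%-distribˡ-* 2 8 p)
    (trans (cong (λ z → (2 % p * z) % p) (sym (m%n%n≡m%n 8 p))) (sym (%-distribˡ-* 2 (8 % p) p)))) e))))

  dbl[p∸4]≢1 : dbl (p ∸ 4) ≢ 1
  dbl[p∸4]≢1 e = p∤9 (m%n≡0⇒n∣m 9 p (trans (cong (λ z → (8 + z) % p) (sym e))
      (trans (trans (%-distribˡ-+ 8 (dbl (p ∸ 4)) p) (trans (cong (λ z → (8 % p + z) % p) (m%n%n≡m%n (2 * (p ∸ 4)) p)) (sym (%-distribˡ-+ 8 (2 * (p ∸ 4)) p))))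
      (trans (cong (_% p) (trans (sym (*-distribˡ-+ 2 4 (p ∸ 4))) (cong (2 *_) (p∸ 4<p)))) (m*n%n≡0 2 p)))))

  -- The residues 1, -2, 4, -8, 16 are distinct.
  five-classes : ∀ {d₀ d₁ d₂ d₃ d₄} → d₀ < p → d₁ ≡ dbl d₀ → d₂ ≡ dbl d₁ → d₃ ≡ dbl d₂ → d₄ ≡ dbl d₃ →
    1 * δ d₀ 1 + (1 * δ d₁ p-1 + (1 * δ d₂ 1 + (1 * δ d₃ p-1 + (1 * δ d₄ 1 + 0)))) ≤ 1 * nz d₀ + 0
  five-classes {d₀} {d₁} {d₂} {d₃} {d₄} lt h1 h2 h3 h4 = ≤-trans
      (add (δ≤1 d₀ 1) (λ o → let e = δ-pos o ; e1 = from1 e h1 ; e2 = from2 e1 h2 ; e3 = trans h3 (cong dbl e2) ; e4 = trans h4 (cong dbl e3) in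
           zero-∷ (λ x → small≢p-1 2 3<7 (trans (sym e1) x)) (zero-∷ (λ x → 4≢1 (trans (sym e2) x)) (zero-∷ (λ x → 8%p≢p-1 (trans (sym e3) x)) (zero-∷ (λ x → 16%p≢1 (trans (sym e4) x)) refl)))
           , subst (λ d → 1 ≤ nz d) (sym e) ≤-refl)
      (add (δ≤1 d₁ p-1) (λ o → let e = δ-pos o ; e2 = from-1 e h2 ; e3 = trans h3 (trans (cong dbl e2) dbl-p∸2) ; e4 = trans h4 (cong dbl e3) in
           zero-∷ (λ x → p∸i≢1 2 lit (trans (sym e2) x)) (zero-∷ (λ x → p∸i≢p-1 4 lit lit (trans (sym e3) x)) (zero-∷ (λ x → dbl[p∸4]≢1 (trans (sym e4) x)) refl))
           , subst (1 ≤_) n1 (subst (λ d → 1 ≤ nz d) (sym e) (≤-reflexive (sym (nz-pos (<⇒≤ 1<p-1))))))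
      (add (δ≤1 d₂ 1) (λ o → let e = δ-pos o ; e3 = from1 e h3 ; e4 = from2 e3 h4 in
           zero-∷ (λ x → small≢p-1 2 3<7 (trans (sym e3) x)) (zero-∷ (λ x → 4≢1 (trans (sym e4) x)) refl)
           , subst (1 ≤_) n2 (subst (λ d → 1 ≤ nz d) (sym e) ≤-refl))
      (add (δ≤1 d₃ p-1) (λ o → let e = δ-pos o ; e4 = from-1 e h4 in
           zero-∷ (λ x → p∸i≢1 2 lit (trans (sym e4) x)) refl
           , subst (1 ≤_) n3 (subst (λ d → 1 ≤ nz d) (sym e) (≤-reflexive (sym (nz-pos (<⇒≤ 1<p-1))))))
      (add (δ≤1 d₄ 1) (λ o → refl , subst (1 ≤_) n4 (subst (λ d → 1 ≤ nz d) (sym (δ-pos o)) ≤-refl)) z≤n)))))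
      (≤-reflexive (sym (trans (+-identityʳ _) (*-identityˡ _))))
    where
    add : ∀ {x y n} → x ≤ 1 → (1 ≤ x → y ≡ 0 × 1 ≤ n) → y ≤ n → 1 * x + y ≤ n
    add {zero} _ _ y≤n = y≤n
    add {suc zero} {y} _ h _ with h ≤-refl
    ... | refl , 1≤n = 1≤n
    add {suc (suc x)} (s≤s ()) _ _
    zero-∷ : ∀ {d c y} → d ≢ c → y ≡ 0 → 1 * δ d c + y ≡ 0
    zero-∷ {d} {c} ne refl = trans (+-identityʳ _) (trans (*-identityˡ _) (δ-≢ ne))
    3<7 : 3 < 7
    3<7 = lit
    4≢1 : 4 ≢ 1
    4≢1 ()
    from1 : ∀ {d d'} → d ≡ 1 → d' ≡ dbl d → d' ≡ 2
    from1 e h = trans h (trans (cong dbl e) (dbl-small {1} 2<p))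
    from2 : ∀ {d d'} → d ≡ 2 → d' ≡ dbl d → d' ≡ 4
    from2 e h = trans h (trans (cong dbl e) (dbl-small {2} 4<p))
    from-1 : ∀ {d d'} → d ≡ p-1 → d' ≡ dbl d → d' ≡ p ∸ 2
    from-1 e h = trans h (trans (cong dbl e) dbl-p-1)
    lt' : ∀ {d d'} → d' ≡ dbl d → d' < p
    lt' {d} h = subst (_< p) (sym h) (m%n<n (2 * d) p)
    nz-dbl : ∀ {d d'} → d < p → d' ≡ dbl d → nz d' ≡ nz d
    nz-dbl l h = trans (cong nz h) (nz-scale {2} p∤2 l)
    n1 = nz-dbl {d₀} {d₁} lt h1
    n2 = trans (nz-dbl {d₁} {d₂} (lt' {d₀} h1) h2) n1
    n3 = trans (nz-dbl {d₂} {d₃} (lt' {d₁} h2) h3) n2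
    n4 = trans (nz-dbl {d₃} {d₄} (lt' {d₂} h3) h4) n3

  chain-absurd : ∀ {e} {D₀ D₁ D₂ D₃ D₄ D₅} → Cond e D₀ → Cond e D₁ → Cond e D₂ → Cond e D₃ → Cond e D₄ → Cond e D₅ →
    Double D₀ D₁ → Double D₁ D₂ → Double D₂ D₃ → Double D₃ D₄ → Double D₄ D₅ → Kap D₅ ≡ 0 → ⊥
  chain-absurd {e} {D₀} {D₁} {D₂} {D₃} {D₄} {D₅} c₀ c₁ c₂ c₃ c₄ c₅ d₀₁ d₁₂ d₂₃ d₃₄ d₄₅ z₅ =
      arith-five {cnt D₀ 1 ℓ} {cnt D₁ p-1 ℓ} {cnt D₂ 1 ℓ} {cnt D₃ p-1 ℓ} {cnt D₄ 1 ℓ} {size D₄ ℓ} 4≤k 1≤m₄ m₃ m₂ m₁ m₀ total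
    where
    s₄ = Descent.descend c₄ c₅ d₄₅ z₅
    Kap-0 : ∀ {W} → kap W ≡ 0 → kap (neg W) ≡ 0 → Kap W ≡ 0
    Kap-0 a b = cong₂ _+_ a b
    z₄ : Kap D₄ ≡ 0
    z₄ = Kap-0 {D₄} (proj₁ s₄) (proj₁ (proj₂ s₄))
    s₃ = Descent.descend c₃ c₄ d₃₄ z₄
    z₃ : Kap D₃ ≡ 0
    z₃ = Kap-0 {D₃} (proj₁ s₃) (proj₁ (proj₂ s₃))
    s₂ = Descent.descend c₂ c₃ d₂₃ z₃
    z₂ : Kap D₂ ≡ 0
    z₂ = Kap-0 {D₂} (proj₁ s₂) (proj₁ (proj₂ s₂))
    s₁ = Descent.descend c₁ c₂ d₁₂ z₂
    z₁ : Kap D₁ ≡ 0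
    z₁ = Kap-0 {D₁} (proj₁ s₁) (proj₁ (proj₂ s₁))
    P = proj₁ (has-1 c₄)
    eP = proj₂ (has-1 c₄)
    -- The descent from D₅ gives `exc D₄` = 1, so some line through P has quotient at least 2;
    -- tightness then puts at least four support points on it.
    bad-line = wsum-pos (I P) (λ m → quo D₄ m ∸ 1) (≤-reflexive (sym (trans (through-excess D₄ eP) (proj₂ (proj₂ (proj₂ s₄))))))
    ℓ = proj₁ bad-line
    1≤m₄ : 1 ≤ cnt D₄ 1 ℓ
    1≤m₄ = cnt-pos D₄ (proj₁ (proj₂ bad-line)) eP
    2≤quo : 2 ≤ quo D₄ ℓ
    2≤quo = m<n∸o⇒o+m<n (quo D₄ ℓ) (proj₂ (proj₂ bad-line))
      where
      m<n∸o⇒o+m<n : ∀ n → 1 ≤ n ∸ 1 → 2 ≤ n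
      m<n∸o⇒o+m<n (suc n) h = s≤s h
    4≤k : 4 ≤ size D₄ ℓ
    4≤k = arith-4 {cnt D₄ 1 ℓ} {quo D₄ ℓ} {quo (neg D₄) ℓ} {size D₄ ℓ} {cnt D₄ p-1 ℓ} 2≤quo 1≤m₄ (quo-neg D₄ ℓ)
            (tight-line-quo c₄ (kap-0ˡ D₄ z₄) 1≤m₄) (tight-line-opp c₄ (kap-0ʳ D₄ z₄))
    k₃ : size D₃ ℓ ≡ size D₄ ℓ
    k₃ = sym (size-double {D₃} {D₄} d₃₄ ℓ)
    k₂ : size D₂ ℓ ≡ size D₄ ℓ
    k₂ = trans (sym (size-double {D₂} {D₃} d₂₃ ℓ)) k₃
    k₁ : size D₁ ℓ ≡ size D₄ ℓ
    k₁ = trans (sym (size-double {D₁} {D₂} d₁₂ ℓ)) k₂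
    k₀ : size D₀ ℓ ≡ size D₄ ℓ
    k₀ = trans (sym (size-double {D₀} {D₁} d₀₁ ℓ)) k₁
    grow : ∀ {m n k} → 4 ≤ k → 1 ≤ m → n + 4 ≡ m + k → 1 ≤ n
    grow {m} {n} {k} h4 h1 eq = +-cancelʳ-≤ 4 1 n (≤-trans (h1 ⊕ h4) (≤-reflexive (sym eq)))
    m₃ : cnt D₃ p-1 ℓ + 4 ≡ cnt D₄ 1 ℓ + size D₄ ℓ
    m₃ = Descent.points-on-line c₃ c₄ d₃₄ z₄ ℓ 4≤k 1≤m₄
    neg-step : ∀ {U V} → Cond e U → Cond e V → Double U V → Kap V ≡ 0 → size V ℓ ≡ size D₄ ℓ → 1 ≤ cnt V p-1 ℓ → cnt U 1 ℓ + 4 ≡ cnt V p-1 ℓ + size D₄ ℓ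
    neg-step {U} {V} cU cV d z k h = trans (cong (_+ 4) (sym (cnt-neg-p-1 U ℓ)))
      (trans (Descent.points-on-line (cond-neg cU) (cond-neg cV) (double-neg {U} {V} d) (trans (Kap-neg V) z) ℓ
               (≤-trans 4≤k (≤-reflexive (sym (trans (size-neg V ℓ) k)))) (≤-trans h (≤-reflexive (sym (cnt-neg-1 V ℓ)))))
             (cong₂ _+_ (cnt-neg-1 V ℓ) (trans (size-neg V ℓ) k)))
    1≤m₃ : 1 ≤ cnt D₃ p-1 ℓ
    1≤m₃ = grow {cnt D₄ 1 ℓ} 4≤k 1≤m₄ m₃
    m₂ : cnt D₂ 1 ℓ + 4 ≡ cnt D₃ p-1 ℓ + size D₄ ℓ
    m₂ = neg-step {D₂} {D₃} c₂ c₃ d₂₃ z₃ k₃ 1≤m₃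
    1≤m₂ : 1 ≤ cnt D₂ 1 ℓ
    1≤m₂ = grow {cnt D₃ p-1 ℓ} 4≤k 1≤m₃ m₂
    m₁ : cnt D₁ p-1 ℓ + 4 ≡ cnt D₂ 1 ℓ + size D₄ ℓ
    m₁ = trans (Descent.points-on-line c₁ c₂ d₁₂ z₂ ℓ (≤-trans 4≤k (≤-reflexive (sym k₂))) 1≤m₂) (cong (cnt D₂ 1 ℓ +_) k₂)
    m₀ : cnt D₀ 1 ℓ + 4 ≡ cnt D₁ p-1 ℓ + size D₄ ℓ
    m₀ = neg-step {D₀} {D₁} c₀ c₁ d₀₁ z₁ k₁ (grow {cnt D₂ 1 ℓ} 4≤k 1≤m₂ m₁)
    total : 1 * cnt D₀ 1 ℓ + (1 * cnt D₁ p-1 ℓ + (1 * cnt D₂ 1 ℓ + (1 * cnt D₃ p-1 ℓ + (1 * cnt D₄ 1 ℓ + 0)))) ≤ 1 * size D₄ ℓ + 0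
    total = ≤-trans (comb-mono (pts ℓ) ((1 , (is D₀ 1)) ∷ (1 , (is D₁ p-1)) ∷ (1 , (is D₂ 1)) ∷ (1 , (is D₃ p-1)) ∷ (1 , (is D₄ 1)) ∷ [])
        ((1 , (supp D₀)) ∷ []) (λ Q _ → five-classes (val<p D₀ Q) (d₀₁ Q) (d₁₂ Q) (d₂₃ Q) (d₃₄ Q)))
      (≤-reflexive (cong (λ z → 1 * z + 0) k₀))

  Kap-pos : ∀ {e V} → Cond e V → 1 ≤ Kap V
  Kap-pos {e} {V} c₅ with pos-or-0 (Kap V)
  ... | inj₂ pos = pos
  ... | inj₁ z = ⊥-elim (chain-absurd c₀ c₁ c₂ c₃ c₄ c₅ d₀₁ d₁₂ d₂₃ d₃₄ d₄₅ z)
    where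
    h₄ = halve c₅
    c₄ = proj₁ (proj₂ h₄)
    d₄₅ = proj₂ (proj₂ h₄)
    h₃ = halve c₄
    c₃ = proj₁ (proj₂ h₃)
    d₃₄ = proj₂ (proj₂ h₃)
    h₂ = halve c₃
    c₂ = proj₁ (proj₂ h₂)
    d₂₃ = proj₂ (proj₂ h₂)
    h₁ = halve c₂
    c₁ = proj₁ (proj₂ h₁)
    d₁₂ = proj₂ (proj₂ h₁)
    h₀ = halve c₁
    c₀ = proj₁ (proj₂ h₀)
    d₀₁ = proj₂ (proj₂ h₀)

  pair-sum : ∀ {e W} → Cond e W → cls W 1 + cls W p-1 + 2 * wt W ≡ 4 * q + 6 + e + Kap W
  pair-sum {e} {W} c = arith-pair {wt W} {cls W 1} {cls W p-1} {exc W} {exc (neg W)} {q} (kap-eq c)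
    (trans (cong₂ _+_ (sym (wt-neg W)) (sym (cls-neg-p-1 W))) (kap-eq (cond-neg c))) (exc-e c)

  pair-lower : ∀ {e W j} → Cond e W → 1 ≤ j → j < p → 4 * q + 7 + e ≤ cls W j + cls W (p ∸ j) + 2 * wt W
  pair-lower {e} {W} {j} c 1≤j j<p with inverse 1≤j j<p
  ... | i , inv = ≤-trans (≤-trans (≤-reflexive (eq q e)) (+-monoʳ-≤ (4 * q + 6 + e) (Kap-pos c')))
      (≤-reflexive (trans (sym (pair-sum c')) (cong₂ _+_ (cong₂ _+_ (cls-scale {i} W unit j<p inv) (cls-scale {i} W unit (∸-monoʳ-< {p} 1≤j (<⇒≤ j<p)) (scale-opposite {i} j<p inv)))
        (cong (2 *_) (wt-scale {i} W unit)))))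
    where
    unit = inverse-unit {i} {j} inv
    c' = cond-scale i unit c
    eq : ∀ q e → 4 * q + 7 + e ≡ 4 * q + 6 + e + 1
    eq = solve-∀

  class-total : ∀ W → sumFin {p-1} (λ j → cls W (suc (toℕ j))) ≡ wt W
  class-total W = trans (sum-swap {p-1} (λ j Q → δ (val W Q) (suc (toℕ j)))) (sum-cong {N} (λ Q → go (val W Q) (val<p W Q)))
    where
    go : ∀ v → v < p → sumFin {p-1} (λ j → δ v (suc (toℕ j))) ≡ nz v
    go zero    _  = sum-zero {p-1} (λ j → refl)
    go (suc v) lt = sum-δ p-1 (s≤s⁻¹ (≤-trans lt (≤-reflexive (sym suc-p-1))))

  private
    weighted : ∀ {e W} → Cond e W → p-1 * (4 * q + 7 + e) ≤ wt W + wt W + p-1 * (2 * wt W)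
    weighted {e} {W} c = subst₂ _≤_ (sum-const p-1 (4 * q + 7 + e)) total
      (sum-mono {p-1} (λ j → pair-lower {e} {W} c (s≤s z≤n) (≤-trans (s≤s (FinP.toℕ<n j)) (≤-reflexive suc-p-1))))
      where
      total : sumFin {p-1} (λ j → cls W (suc (toℕ j)) + cls W (p ∸ suc (toℕ j)) + 2 * wt W) ≡ wt W + wt W + p-1 * (2 * wt W)
      total = trans (sum-+ {p-1} (λ j → cls W (suc (toℕ j)) + cls W (p ∸ suc (toℕ j))) (λ _ → 2 * wt W))
        (cong₂ _+_ (trans (sum-+ {p-1} (λ j → cls W (suc (toℕ j))) (λ j → cls W (p ∸ suc (toℕ j))))
          (cong₂ _+_ (class-total W) (trans (sum-cong {p-1} (λ j → sym (cls-neg W (s≤s z≤n) (≤-trans (s≤s (FinP.toℕ<n j)) (≤-reflexive suc-p-1)))))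
            (trans (class-total (neg W)) (wt-neg W))))) (sum-const p-1 (2 * wt W)))

    -- Modulo 7 doubling has order 3, and the pairs ±1, ±2, ±4 exhaust the nonzero residues. The
    -- weight is 88 and a pair of classes has 28 + `Kap` points, so the three values of `Kap` add up
    -- to 88 - 84 = 4.
    no-full-7 : p ≡ 7 → ∀ {W} → Cond 2 W → ⊥
    no-full-7 p≡7 {W} c = cycle-4 (Kap W) (Kap V) (Kap X) (Kap-pos c) (Kap-pos cV) (Kap-pos cX) four
        (Descent.ascend c cV (λ Q → refl) refl) (Descent.ascend cV cX (λ Q → refl) refl) (Descent.ascend cX c back refl)
      where
      V X : DualWord
      V = scale 2 W
      X = scale 2 V
      cV : Cond 2 V
      cV = cond-scale 2 p∤2 c
      cX : Cond 2 X
      cX = cond-scale 2 p∤2 cV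
      %-absorb : ∀ a → (2 * (a % p)) % p ≡ (2 * a) % p
      %-absorb a = trans (%-distribˡ-* 2 (a % p) p) (trans (cong (λ z → (2 % p * z) % p) (m%n%n≡m%n a p)) (sym (%-distribˡ-* 2 a p)))
      back : ∀ Q → val W Q ≡ (2 * ((2 * ((2 * val W Q) % p)) % p)) % p
      back Q = sym (trans (cong (λ z → (2 * z) % p) (%-absorb (2 * v))) (trans (%-absorb (2 * (2 * v)))
          (trans (cong (_% p) (trans (eight v) (cong (λ z → v + v * z) (sym p≡7)))) (trans ([m+kn]%n≡m%n v v p) (m<n⇒m%n≡m (val<p W Q))))))
        where
        v = val W Q
        eight : ∀ v → 2 * (2 * (2 * v)) ≡ v + v * 7
        eight = solve-∀
      p-1≡6 : p-1 ≡ 6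
      p-1≡6 = cong (_∸ 1) p≡7
      lt : ∀ {i} → i < 7 → i < p
      lt h = <-≤-trans h 7≤p
      wrap : ∀ a → a < p → (a + 7) % p ≡ a
      wrap a h = trans (cong (λ z → (a + z) % p) (sym p≡7)) (trans ([m+n]%n≡m%n a p) (m<n⇒m%n≡m h))
      V1 : cls V 1 ≡ cls W 4
      V1 = cls-scale {2} W p∤2 4<p (wrap 1 1<p)
      V4 : cls V 4 ≡ cls W 2
      V4 = cls-scale {2} W p∤2 2<p (m<n⇒m%n≡m 4<p)
      V3 : cls V 3 ≡ cls W 5
      V3 = cls-scale {2} W p∤2 (lt lit) (wrap 3 (lt lit))
      V6 : cls V 6 ≡ cls W 3
      V6 = cls-scale {2} W p∤2 (lt lit) (m<n⇒m%n≡m (lt ≤-refl))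
      X1 : cls X 1 ≡ cls W 2
      X1 = trans (cls-scale {2} V p∤2 4<p (wrap 1 1<p)) V4
      X6 : cls X 6 ≡ cls W 5
      X6 = trans (cls-scale {2} V p∤2 (lt lit) (m<n⇒m%n≡m (lt ≤-refl))) V3
      wV : wt V ≡ wt W
      wV = wt-scale {2} W p∤2
      wX : wt X ≡ wt W
      wX = trans (wt-scale {2} V p∤2) wV
      four : Kap W + Kap V + Kap X ≡ 4
      four = arith-7 {wt W} {cls W 1} {cls W 2} {cls W 3} {cls W 4} {cls W 5} {cls W 6}
        (subst (λ n → sumFin {n} (λ j → cls W (suc (toℕ j))) ≡ wt W) p-1≡6 (class-total W))
        (subst (λ z → wt W + 2 * z ≡ 2 * (z * z) + 2 + 2) p≡7 (weigh c))
        (trans (cong (λ z → cls W 1 + cls W z + 2 * wt W) (sym p-1≡6)) (trans (pair-sum c) (cong (λ z → 4 * (z * z) + 6 + 2 + Kap W) p≡7)))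
        (trans (cong₂ _+_ (cong₂ _+_ (sym V1) (trans (sym V6) (cong (cls V) (sym p-1≡6)))) (cong (2 *_) (sym wV))) (trans (pair-sum cV) (cong (λ z → 4 * (z * z) + 6 + 2 + Kap V) p≡7)))
        (trans (cong₂ _+_ (cong₂ _+_ (sym X1) (trans (sym X6) (cong (cls X) (sym p-1≡6)))) (cong (2 *_) (sym wX))) (trans (pair-sum cX) (cong (λ z → 4 * (z * z) + 6 + 2 + Kap X) p≡7)))

  -- `Kap` ≥ 1 for every pair ±j; adding over all j gives 3p ≤ 7 + e (p + 1). So p ≤ 9 for e ≤ 2,
  -- and p = 7 requires e = 2.
  no-full : ∀ {e W} → Cond e W → ⊥
  no-full {e} {W} c = cases (p ∸ 7) (m+[n∸m]≡n 7≤p) bound (arith-π (p ∸ 7) (e≤2 c) bound)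
    where
    π = p ∸ 7
    p≡ : p ≡ 7 + π
    p≡ = sym (m+[n∸m]≡n 7≤p)
    p-1≡ : p-1 ≡ 6 + π
    p-1≡ = suc-injective (trans suc-p-1 p≡)
    bound : 3 * (7 + π) ≤ 7 + e * (8 + π)
    bound = arith-total {wt W} {e} π (subst₂ (λ a b → a * (4 * (b * b) + 7 + e) ≤ wt W + wt W + a * (2 * wt W)) p-1≡ p≡ (weighted c))
      (subst (λ b → wt W + 2 * b ≡ 2 * (b * b) + 2 + e) p≡ (weigh c))
    cases : ∀ π → 7 + π ≡ p → 3 * (7 + π) ≤ 7 + e * (8 + π) → π ≤ 2 → ⊥
    cases 0 eq b _ = no-full-7 (sym eq) {W} (subst (λ e → Cond e W) (arith-e2 (e≤2 c) b) c)
    cases 1 eq _ _ = p-odd 4 (sym eq)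
    cases 2 eq _ _ = p∤9 (divides 1 (trans eq (sym (+-identityʳ p))))
    cases (suc (suc (suc π))) _ _ (s≤s (s≤s ()))

  two-values : ∀ W → Small W → Has W 1 → ∀ Q → val W Q ≡ 0 ⊎ (val W Q ≡ 1 ⊎ val W Q ≡ p-1)
  two-values W s h with two-values-or-full W s h
  ... | inj₁ two = two
  ... | inj₂ f   = ⊥-elim (no-full {exc W + exc (neg W)} {W} (record { full = f ; weigh = exc-sum {W} s h ; e≤2 = exc-sum≤2 {W} s h }))

-- Enumerating a subset of Fin N

record Enumeration {N : ℕ} (S : Fin N → Bool) (n : ℕ) : Set where
  field
    at   : Fin n → Fin N
    inj  : ∀ {x y} → at x ≡ at y → x ≡ y
    mem  : ∀ x → T (S (at x))
    onto : ∀ P → T (S P) → ∃[ x ] at x ≡ P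
    sums : ∀ h → sumFin (λ x → h (at x)) ≡ wsum S h

enumerate : ∀ {N} (S : Fin N → Bool) → Enumeration S (countFin S)
enumerate {zero} S = record { at = λ () ; inj = λ { {()} } ; mem = λ () ; onto = λ () ; sums = λ _ → refl }
enumerate {suc N} S with S fzero in eq | enumerate (λ i → S (fsuc i))
... | false | E = record
  { at   = λ x → fsuc (at x)
  ; inj  = λ e → inj (FinP.suc-injective e)
  ; mem  = mem
  ; onto = λ { fzero t → ⊥-elim (subst T eq t) ; (fsuc P) t → let (x , e) = onto P t in x , cong fsuc e }
  ; sums = λ h → trans (sums (λ i → h (fsuc i))) (cong (λ b → bit b * h fzero + wsum (λ i → S (fsuc i)) (λ i → h (fsuc i))) (sym eq)) }
  where open Enumeration E
... | true | E = record
  { at   = at'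
  ; inj  = inj'
  ; mem  = λ { fzero → subst T (sym eq) tt ; (fsuc x) → mem x }
  ; onto = λ { fzero t → fzero , refl ; (fsuc P) t → let (x , e) = onto P t in fsuc x , cong fsuc e }
  ; sums = λ h → trans (cong₂ _+_ (sym (*-identityˡ (h fzero))) (sums (λ i → h (fsuc i))))
                       (cong (λ b → bit b * h fzero + wsum (λ i → S (fsuc i)) (λ i → h (fsuc i))) (sym eq)) }
  where
  open Enumeration E
  at' : Fin (suc (countFin (λ i → S (fsuc i)))) → Fin (suc N)
  at' fzero    = fzero
  at' (fsuc x) = fsuc (at x)
  inj' : ∀ {x y} → at' x ≡ at' y → x ≡ y
  inj' {fzero}  {fzero}  _ = refl
  inj' {fsuc x} {fsuc y} e = cong fsuc (inj (FinP.suc-injective e))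

pick-avoiding : ∀ {N} (S : Fin N → Bool) i j → 3 ≤ countFin S → ∃[ k ] (T (S k) × k ≢ i × k ≢ j)
pick-avoiding {N} S i j h = k , bit-pos (subst (1 ≤_) (trans (proj₂ w1) (proj₂ w2)) (proj₂ found)) , proj₁ w2 , proj₁ w1
  where
  f = λ k → bit (S k)
  two : 2 ≤ sumFin (without i f)
  two = +-cancelˡ-≤ 1 _ _ (≤-trans h (≤-trans (≤-reflexive (sym (sum-without i f))) (+-monoˡ-≤ _ (bit≤1 (S i)))))
  one : 1 ≤ sumFin (without j (without i f))
  one = +-cancelˡ-≤ 1 _ _ (≤-trans two (≤-trans (≤-reflexive (sym (sum-without j (without i f)))) (+-monoˡ-≤ _ (≤-trans (without≤ i f j) (bit≤1 (S j))))))
  found = sum-pos (without j (without i f)) one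
  k = proj₁ found
  w1 = without-pos j (without i f) k (proj₂ found)
  w2 = without-pos i f k (subst (1 ≤_) (proj₂ w1) (proj₂ found))

-- Words with values ±1: line types and secants

private
  -- e₁, e₂: the equations x + p₁x' + q = (q+1+E)p and p₁x + x' + q = (q+1+E')p for p = 1 + p₁ = 7 + π.
  arith-balance-< : ∀ π {x x' q E} d → 1 ≤ d → d ≤ 2 → x + (6 + π) * x' + q ≡ (suc q + E) * (7 + π) →
    (6 + π) * x + x' + q ≡ (suc q + (E + d)) * (7 + π) → ⊥
  arith-balance-< π {x} {x'} {q} {E} (suc d) 1≤d d≤2 e1 e2 with x ≤? x' + suc d
  ... | yes le = ≤-absurd (2 * d + 1) ((≤-reflexive (sym e2)) ⊕ (≤-reflexive e1) ⊕ (5 + π) ⊗ le) (solve (x ∷ x' ∷ q ∷ E ∷ d ∷ π ∷ []))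
  ... | no ¬le = ≤-absurd π ((≤-reflexive e2) ⊕ (≤-reflexive (sym e1)) ⊕ ((5 + π) ⊗ (≰⇒> ¬le) ⊕ 2 ⊗ d≤2)) (solve (x ∷ x' ∷ q ∷ E ∷ d ∷ π ∷ []))

  -- The difference of the equations is (p - 2)(x - x') = (E' - E) p. For d = 1 or 2 the quotient d
  -- p / (p - 2) lies strictly between d and d + 1, so E = E'.
  arith-balance : ∀ π {x x' q E E'} → E + E' ≤ 2 → x + (6 + π) * x' + q ≡ (suc q + E) * (7 + π) → (6 + π) * x + x' + q ≡ (suc q + E') * (7 + π) → E ≡ E' × x ≡ x'
  arith-balance π {x} {x'} {q} {E} {E'} s e1 e2 with <-cmp E E'
  ... | tri< lt _ _ = ⊥-elim (arith-balance-< π {x} {x'} {q} {E} (E' ∸ E) (m<n⇒0<n∸m lt) (≤-trans (m∸n≤m E' E) (≤-trans (m≤n+m E' E) s)) e1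
                        (trans e2 (cong (λ z → (suc q + z) * (7 + π)) (sym (m+[n∸m]≡n (<⇒≤ lt))))))
  ... | tri> _ _ gt = ⊥-elim (arith-balance-< π {x'} {x} {q} {E'} (E ∸ E') (m<n⇒0<n∸m gt) (≤-trans (m∸n≤m E E') (≤-trans (m≤m+n E E') s))
                        (trans (cong (_+ q) (+-comm x' _)) e2)
                        (trans (cong (_+ q) (+-comm _ x)) (trans e1 (cong (λ z → (suc q + z) * (7 + π)) (sym (m+[n∸m]≡n (<⇒≤ gt)))))))
  ... | tri≈ _ refl _ = refl , *-cancelˡ-≡ x x' (5 + π) (+-cancelˡ-≡ (x + x' + q) _ _ (trans (e3 x x' q π) (trans e2 (trans (sym e1) (e4 x x' q π)))))
    where
    e3 : ∀ x x' q π → x + x' + q + (5 + π) * x ≡ (6 + π) * x + x' + q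
    e3 = solve-∀
    e4 : ∀ x x' q π → x + (6 + π) * x' + q ≡ x + x' + q + (5 + π) * x'
    e4 = solve-∀

  -- A line with a ≥ 1 points of value 1 and b of value -1; t and t' are the quotients of the word and its negative, p = 7 + π.
  data LineType (π a b t : ℕ) : Set where
    mixed  : a ≡ 1 → b ≡ 1 → t ≡ 1 → LineType π a b t
    secant : a ≡ 7 + π → b ≡ 0 → t ≡ 1 → LineType π a b t
    double : a ≡ 2 → b ≡ 2 → t ≡ 2 → LineType π a b t
    long   : a ≡ 2 * (7 + π) → b ≡ 0 → t ≡ 2 → LineType π a b t

  line-type : ∀ π {a b t t'} → 1 ≤ a → a + (6 + π) * b ≡ t * (7 + π) → t ≤ 2 → t + t' ≡ a + b → (1 ≤ b → t' ≤ 2) → LineType π a b t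
  line-type π {a} {b} {0} 1≤a e _ _ _ = ⊥-elim (<⇒≢ 1≤a (sym (m+n≡0⇒m≡0 a e)))
  line-type π {a} {0} {1} 1≤a e _ _ _ = secant (trans (e0 a π) (trans e (+-identityʳ _))) refl refl
    where
    e0 : ∀ a π → a ≡ a + (6 + π) * 0
    e0 = solve-∀
  line-type π {a} {0} {2} 1≤a e _ _ _ = long (trans (e0 a π) e) refl refl
    where
    e0 : ∀ a π → a ≡ a + (6 + π) * 0
    e0 = solve-∀
  line-type π {a} {1} {1} 1≤a e _ _ _ = mixed (+-cancelʳ-≡ (6 + π) a 1 (trans (e0 a π) (trans e (e1 π)))) refl refl
    where
    e0 : ∀ a π → a + (6 + π) ≡ a + (6 + π) * 1
    e0 = solve-∀
    e1 : ∀ π → 1 * (7 + π) ≡ 1 + (6 + π)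
    e1 = solve-∀
  -- Here a = p + 1, so the quotient t' of the negated word would be p, far above 2.
  line-type π {a} {1} {2} {t'} 1≤a e _ s h = ⊥-elim (≤-absurd (4 + π) ((≤-reflexive (sym s)) ⊕ ((h ≤-refl) ⊕ (≤-reflexive (sym e)))) (solve (a ∷ π ∷ t' ∷ [])))
  line-type π {a} {2} {2} 1≤a e _ _ _ = double (+-cancelʳ-≡ ((6 + π) * 2) a 2 (trans e (e1 π))) refl refl
    where
    e1 : ∀ π → 2 * (7 + π) ≡ 2 + (6 + π) * 2
    e1 = solve-∀
  line-type π {a} {suc (suc b)} {1} 1≤a e _ _ _ = ⊥-elim (≤-absurd (5 + π + (6 + π) * b) (1≤a ⊕ (≤-reflexive e)) (solve (a ∷ π ∷ b ∷ [])))
  line-type π {a} {suc (suc (suc b))} {2} 1≤a e _ _ _ = ⊥-elim (≤-absurd (4 + π + (6 + π) * b) (1≤a ⊕ (≤-reflexive e)) (solve (a ∷ π ∷ b ∷ [])))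
  line-type π {t = suc (suc (suc t))} _ _ (s≤s (s≤s ())) _ _
private
  arith-x : ∀ {w x x' q p E} → w ≡ x + x' → x ≡ x' → w + 2 * p ≡ 2 * q + 2 + (E + E) → x + p ≡ suc q + E
  arith-x {w} {x} {x'} {q} {p} {E} refl refl h = *-cancelˡ-≡ _ _ 2 (trans (e1 x p) (trans h (e2 q E)))
    where
    e1 : ∀ x p → 2 * (x + p) ≡ x + x + 2 * p
    e1 = solve-∀
    e2 : ∀ q E → 2 * q + 2 + (E + E) ≡ 2 * (suc q + E)
    e2 = solve-∀

  -- No line carries 2p points of value 1: a point of value 1 off the line would see them on too many lines.
  arith-no-long : ∀ {A B C D x E} π → A ≡ 2 * (7 + π) → B ≡ suc ((7 + π) * (7 + π)) → C ≡ x + (7 + π) * (7 + π) * 1 → D ≡ suc ((7 + π) * (7 + π)) + E + 0 → E ≤ 1 →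
    x + (7 + π) ≡ suc ((7 + π) * (7 + π)) + E → (6 + π) * A + ((7 + π) * B + 0) ≤ 1 * C + ((6 + π) * D + 0) → ⊥
  arith-no-long {x = x} {E} π refl refl refl refl E≤1 hx le = ≤-absurd (34 + 12 * π + π * π) (le ⊕ (≤-reflexive hx) ⊕ (7 + π) ⊗ E≤1) (solve (π ∷ x ∷ E ∷ []))

  arith-many : ∀ π x E → x + (7 + π) ≡ suc ((7 + π) * (7 + π)) + E → 2 * (7 + π) < x
  arith-many π x E h = ≤-from-sum (28 + 11 * π + π * π + E) (≤-reflexive (sym h)) (solve (π ∷ x ∷ E ∷ []))

  -- Here c counts the points of value 1 shared with a supposed long line. The weights p - 1 and p
  -- make mixed lines and secants with c = 1 exactly tight.
  arith-meets : ∀ π {c a b t} → LineType π a b t → c ≤ 1 → (1 ≤ c → 2 ≤ a) → (6 + π) * c + ((7 + π) * 1 + 0) ≤ 1 * a + ((6 + π) * t + 0)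
  arith-meets π {zero} (mixed refl refl refl) _ _ = ≤-reflexive (e π)
    where
    e : ∀ π → (6 + π) * 0 + ((7 + π) * 1 + 0) ≡ 1 * 1 + ((6 + π) * 1 + 0)
    e = solve-∀
  arith-meets π {suc c} (mixed refl refl refl) _ h = ⊥-elim (1+n≰n (h (s≤s z≤n)))
  arith-meets π {c} (secant refl refl refl) c≤1 _ = ≤-from-sum 0 ((6 + π) ⊗ c≤1) (solve (π ∷ c ∷ []))
  arith-meets π {c} (double refl refl refl) c≤1 _ = ≤-from-sum 1 ((6 + π) ⊗ c≤1) (solve (π ∷ c ∷ []))
  arith-meets π {c} (long refl refl refl) c≤1 _ = ≤-from-sum (13 + 2 * π) ((6 + π) ⊗ c≤1) (solve (π ∷ c ∷ []))

module TwoValuedWords (p : ℕ) .{{_ : NonZero p}} (pr : Prime p) (7≤p : 7 ≤ p) (Π : ProjectivePlane (p * p)) where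
  open NoFullWord p pr 7≤p Π public

  π : ℕ
  π = p ∸ 7

  p≡ : p ≡ 7 + π
  p≡ = sym (m+[n∸m]≡n 7≤p)

  p-1≡ : p-1 ≡ 6 + π
  p-1≡ = suc-injective (trans suc-p-1 p≡)

  TwoValued : DualWord → Set
  TwoValued W = ∀ Q → val W Q ≡ 0 ⊎ (val W Q ≡ 1 ⊎ val W Q ≡ p-1)

  nz-two : ∀ v → v ≡ 0 ⊎ (v ≡ 1 ⊎ v ≡ p-1) → δ v 1 + δ v p-1 ≡ nz v
  nz-two v (inj₁ refl)        = δ-≢ (<⇒≢ (<⇒≤ 1<p-1))
  nz-two v (inj₂ (inj₁ refl)) = cong suc (δ-≢ 1≢p-1)
  nz-two v (inj₂ (inj₂ refl)) = trans (cong₂ _+_ (δ-≢ (λ e → 1≢p-1 (sym e))) (δ-≡ {p-1} refl)) (sym (nz-pos (<⇒≤ 1<p-1)))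

  val-two : ∀ v → v ≡ 0 ⊎ (v ≡ 1 ⊎ v ≡ p-1) → δ v 1 + p-1 * δ v p-1 ≡ v
  val-two v (inj₁ refl)        = trans (cong (p-1 *_) (δ-≢ (<⇒≢ (<⇒≤ 1<p-1)))) (*-zeroʳ p-1)
  val-two v (inj₂ (inj₁ refl)) = cong suc (trans (cong (p-1 *_) (δ-≢ 1≢p-1)) (*-zeroʳ p-1))
  val-two v (inj₂ (inj₂ refl)) = trans (cong₂ (λ a b → a + p-1 * b) (δ-≢ (λ e → 1≢p-1 (sym e))) (δ-≡ {p-1} refl)) (*-identityʳ p-1)

  two-neg : ∀ {W} → TwoValued W → TwoValued (neg W)
  two-neg {W} two Q with two Q
  ... | inj₁ e        = inj₁ (cong negv e)
  ... | inj₂ (inj₁ e) = inj₂ (inj₂ (cong negv e))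
  ... | inj₂ (inj₂ e) = inj₂ (inj₁ (trans (cong negv e) (trans (negv-pos (<⇒≤ 1<p-1)) (p∸-inv 1<p))))

  tot-two : ∀ {W} → TwoValued W → tot W ≡ cls W 1 + p-1 * cls W p-1
  tot-two {W} two = trans (sum-cong {N} (λ Q → sym (val-two (val W Q) (two Q))))
    (trans (sum-+ (is W 1) (λ Q → p-1 * δ (val W Q) p-1)) (cong (cls W 1 +_) (sum-*ˡ p-1 (is W p-1))))

  wt-two : ∀ {W} → TwoValued W → wt W ≡ cls W 1 + cls W p-1
  wt-two {W} two = trans (sum-cong {N} (λ Q → sym (nz-two (val W Q) (two Q)))) (sum-+ (is W 1) (is W p-1))

  line-two : ∀ {W} → TwoValued W → ∀ ℓ → cnt W 1 ℓ + p-1 * cnt W p-1 ℓ ≡ quo W ℓ * p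
  line-two {W} two ℓ = trans (cong (cnt W 1 ℓ +_) (sym (wsum-*ˡ (pts ℓ) p-1 (is W p-1))))
    (trans (sym (wsum-+ (pts ℓ) (is W 1) (λ Q → p-1 * δ (val W Q) p-1)))
    (trans (wsum-cong (pts ℓ) (λ Q → val-two (val W Q) (two Q))) (dual W ℓ)))

  size-two : ∀ {W} → TwoValued W → ∀ ℓ → size W ℓ ≡ cnt W 1 ℓ + cnt W p-1 ℓ
  size-two {W} two ℓ = trans (wsum-cong (pts ℓ) (λ Q → sym (nz-two (val W Q) (two Q)))) (wsum-+ (pts ℓ) (is W 1) (is W p-1))

  record Balanced (E : ℕ) (W : DualWord) : Set where
    field
      two   : TwoValued W
      E≤1   : E ≤ 1
      exc≡  : exc W ≡ E
      exc≡' : exc (neg W) ≡ E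
      cls≡  : cls W 1 + p ≡ suc q + E
      cls≡' : cls W p-1 + p ≡ suc q + E
      hasW  : Has W 1

  open Balanced

  balanced-neg : ∀ {E W} → Small W → Balanced E W → Balanced E (neg W)
  balanced-neg {E} {W} s b = record
    { two   = two-neg {W} (two b)
    ; E≤1   = E≤1 b
    ; exc≡  = exc≡' b
    ; exc≡' = trans (exc-neg-neg W) (exc≡ b)
    ; cls≡  = trans (cong (_+ p) (cls-neg-1 W)) (cls≡' b)
    ; cls≡' = trans (cong (_+ p) (cls-neg-p-1 W)) (cls≡ b)
    ; hasW  = has-neg-1 {W} s (hasW b) }

  balance : ∀ W → Small W → Has W 1 → ∃[ E ] (Balanced E W × wt W + 2 * p ≡ 2 * q + 2 + (E + E))
  balance W s h = exc W , record { two = tw ; E≤1 = half (exc W) (subst (λ z → exc W + z ≤ 2) (sym (proj₁ eqs)) (exc-sum≤2 {W} s h))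
      ; exc≡ = refl ; exc≡' = sym (proj₁ eqs) ; cls≡ = x≡ ; cls≡' = trans (cong (_+ p) (sym (proj₂ eqs))) x≡ ; hasW = h } , weq
    where
    tw : TwoValued W
    tw = two-values W s h
    half : ∀ E → E + E ≤ 2 → E ≤ 1
    half 0 _ = z≤n
    half 1 _ = ≤-refl
    half (suc (suc E)) (s≤s (s≤s le)) = ⊥-elim (1+n≰n (≤-trans (m≤n+m 1 E) (≤-trans (+-monoʳ-≤ E (s≤s z≤n)) le)))
    eqs : exc W ≡ exc (neg W) × cls W 1 ≡ cls W p-1
    eqs = arith-balance π {cls W 1} {cls W p-1} {q} (exc-sum≤2 {W} s h)
      (subst₂ (λ a b → cls W 1 + a * cls W p-1 + q ≡ (suc q + exc W) * b) p-1≡ p≡ (trans (cong (_+ q) (sym (tot-two {W} tw))) (exc-tot W h)))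
      (subst₂ (λ a b → a * cls W 1 + cls W p-1 + q ≡ (suc q + exc (neg W)) * b) p-1≡ p≡
        (trans (cong (_+ q) (trans (+-comm _ (cls W p-1)) (sym (trans (tot-two {neg W} (two-neg {W} tw)) (cong₂ (λ a b → a + p-1 * b) (cls-neg-1 W) (cls-neg-p-1 W))))))
          (exc-tot (neg W) (has-neg-1 {W} s h))))
    weq : wt W + 2 * p ≡ 2 * q + 2 + (exc W + exc W)
    weq = trans (exc-sum {W} s h) (cong (λ z → 2 * q + 2 + (exc W + z)) (sym (proj₁ eqs)))
    x≡ : cls W 1 + p ≡ suc q + exc W
    x≡ = arith-x {wt W} {cls W 1} {cls W p-1} {q} (wt-two {W} tw) (proj₂ eqs) weq

  meetCount : ∀ {ℓ m} → ℓ ≢ m → onLine m (λ Q → bit (I Q ℓ)) ≡ 1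
  meetCount {ℓ} {m} ℓ≢m with meetExists ℓ m ℓ≢m
  ... | P , Pℓ , Pm = trans (sum-cong {N} (λ Q → bit-∧ (I Q m) (I Q ℓ)))
    (countFin≡1 (λ Q → I Q m ∧ I Q ℓ) P (∧-intro Pm Pℓ)
      (λ Q t → meetUnique ℓ m ℓ≢m Q P (proj₂ (∧-elim {I Q m} t)) (proj₁ (∧-elim t)) Pℓ Pm))

  module Secants {E : ℕ} {W : DualWord} (small : Small W) (b : Balanced E W) where

    inS : Pt → Bool
    inS Q = val W Q ≡ᵇ 1

    isSec : Pt → Bool
    isSec ℓ = cnt W 1 ℓ ≡ᵇ p

    inS-val : ∀ {Q} → T (inS Q) → val W Q ≡ 1
    inS-val {Q} = ≡ᵇ⇒≡ (val W Q) 1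

    val-inS : ∀ {Q} → val W Q ≡ 1 → T (inS Q)
    val-inS {Q} = ≡⇒≡ᵇ (val W Q) 1

    common : Pt → Pt → ℕ
    common ℓ m = onLine m (λ Q → bit (I Q ℓ) * δ (val W Q) 1)

    common≤1 : ∀ {ℓ m} → ℓ ≢ m → common ℓ m ≤ 1
    common≤1 {ℓ} {m} ne = ≤-trans (wsum-mono (pts m) (λ Q _ → ≤-trans ((bit (I Q ℓ)) ⊗ (δ≤1 (val W Q) 1)) (≤-reflexive (*-identityʳ _)))) (≤-reflexive (meetCount ne))

    common-point : ∀ {ℓ m} → 1 ≤ common ℓ m → ∃[ Q ] (T (I Q m) × T (I Q ℓ) × val W Q ≡ 1)
    common-point {ℓ} {m} h with wsum-pos (pts m) (λ Q → bit (I Q ℓ) * δ (val W Q) 1) h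
    ... | Q , t , pos with bit*-pos (I Q ℓ) (δ (val W Q) 1) pos
    ...   | t' , e = Q , t , t' , δ-pos (subst (1 ≤_) e pos)

    two-points : ∀ {P Q m} → P ≢ Q → T (I P m) → T (I Q m) → val W P ≡ 1 → val W Q ≡ 1 → 2 ≤ cnt W 1 m
    two-points {P} {Q} {m} ne tP tQ eP eQ = ≤-trans (one ⊕ (≤-trans (≤-trans one' (≤-reflexive (sym (without-other g (λ e → ne (sym e)))))) (term≤sum (without P g) Q))) (≤-reflexive (sum-without P g))
      where
      g : Pt → ℕ
      g R = bit (I R m) * δ (val W R) 1
      one : 1 ≤ g P
      one = ≤-reflexive (sym (cong₂ _*_ (bit-T tP) (δ-≡ eP)))
      one' : 1 ≤ g Q
      one' = ≤-reflexive (sym (cong₂ _*_ (bit-T tQ) (δ-≡ eQ)))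

    through-common : ∀ {P ℓ} → ¬ T (I P ℓ) → through P (common ℓ) ≡ cnt W 1 ℓ
    through-common {P} {ℓ} off = trans (through-onLine P (λ Q → bit (I Q ℓ) * δ (val W Q) 1))
      (trans (cong (λ z → cnt W 1 ℓ + q * (z * δ (val W P) 1)) (bit-¬T off)) (trans (cong (cnt W 1 ℓ +_) (*-zeroʳ q)) (+-identityʳ _)))

    raw-type : ∀ {P ℓ} → T (I P ℓ) → val W P ≡ 1 → LineType π (cnt W 1 ℓ) (cnt W p-1 ℓ) (quo W ℓ)
    raw-type {P} {ℓ} t e = line-type π {t' = quo (neg W) ℓ} (cnt-pos W t e)
      (subst₂ (λ x y → cnt W 1 ℓ + x * cnt W p-1 ℓ ≡ quo W ℓ * y) p-1≡ p≡ (line-two {W} (two b) ℓ))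
      (≤-trans (quo-upper W t e) (+-monoʳ-≤ 1 (≤-trans (≤-reflexive (exc≡ b)) (E≤1 b))))
      (trans (quo-neg W ℓ) (size-two {W} (two b) ℓ)) opp
      where
      opp : 1 ≤ cnt W p-1 ℓ → quo (neg W) ℓ ≤ 2
      opp h with cnt-point (neg W) {1} {ℓ} (≤-trans h (≤-reflexive (sym (cnt-neg-1 W ℓ))))
      ... | Q , tQ , eQ = ≤-trans (quo-upper (neg W) tQ eQ) (+-monoʳ-≤ 1 (≤-trans (≤-reflexive (exc≡' b)) (E≤1 b)))

    off-point : ∀ ℓ → cnt W 1 ℓ < cls W 1 → ∃[ P ] (¬ T (I P ℓ) × val W P ≡ 1)
    off-point ℓ lt with sum-pos (λ Q → (1 ∸ bit (I Q ℓ)) * δ (val W Q) 1) pos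
      where
      split : ∀ b x → bit b * x + (1 ∸ bit b) * x ≡ x
      split true  x = trans (+-identityʳ _) (*-identityˡ x)
      split false x = *-identityˡ x
      sum≡ : cnt W 1 ℓ + sumFin (λ Q → (1 ∸ bit (I Q ℓ)) * δ (val W Q) 1) ≡ cls W 1
      sum≡ = trans (sym (sum-+ (λ Q → bit (I Q ℓ) * δ (val W Q) 1) (λ Q → (1 ∸ bit (I Q ℓ)) * δ (val W Q) 1))) (sum-cong {N} (λ Q → split (I Q ℓ) (δ (val W Q) 1)))
      pos : 1 ≤ sumFin (λ Q → (1 ∸ bit (I Q ℓ)) * δ (val W Q) 1)
      pos = +-cancelˡ-≤ (cnt W 1 ℓ) _ _ (≤-trans (≤-reflexive (+-comm _ 1)) (≤-trans lt (≤-reflexive (sym sum≡))))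
    ... | P , h = P , off (I P ℓ) h , δ-pos (eq (I P ℓ) h)
      where
      off : ∀ c → 1 ≤ (1 ∸ bit c) * δ (val W P) 1 → ¬ T c
      off true () _
      off false _ ()
      eq : ∀ c → 1 ≤ (1 ∸ bit c) * δ (val W P) 1 → 1 ≤ δ (val W P) 1
      eq false h = ≤-trans h (≤-reflexive (*-identityˡ _))

    private
      many-points : 2 * (7 + π) < cls W 1
      many-points = arith-many π (cls W 1) E (subst (λ z → cls W 1 + z ≡ suc (z * z) + E) p≡ (cls≡ b))

      meets-bound : ∀ {P ℓ} → ¬ T (I P ℓ) → val W P ≡ 1 → ∀ m → T (I P m) →
                    (6 + π) * common ℓ m + ((7 + π) * 1 + 0) ≤ 1 * cnt W 1 m + ((6 + π) * quo W m + 0)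
      meets-bound {P} {ℓ} off eP m t = arith-meets π {common ℓ m} {cnt W 1 m} {cnt W p-1 m} {quo W m} (raw-type t eP) (common≤1 ℓ≢m) 2≤
        where
        ℓ≢m : ℓ ≢ m
        ℓ≢m refl = off t
        2≤ : 1 ≤ common ℓ m → 2 ≤ cnt W 1 m
        2≤ pos = two-points {P} {proj₁ cp} (λ e → off (subst (λ R → T (I R ℓ)) (sym e) (proj₁ (proj₂ (proj₂ cp))))) t (proj₁ (proj₂ cp)) eP (proj₂ (proj₂ (proj₂ cp)))
          where cp = common-point pos

      no-long-from : ∀ {P} ℓ → cnt W 1 ℓ ≡ 2 * (7 + π) → ¬ T (I P ℓ) → val W P ≡ 1 → ⊥
      no-long-from {P} ℓ e off eP = arith-no-long {through P (common ℓ)} {through P (λ _ → 1)} {through P (cnt W 1)} {through P (quo W)} {cls W 1} {E} π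
        (trans (through-common off) e) (trans (through-1 P) (cong (λ z → suc (z * z)) p≡))
        (trans (through-cnt-≡ W 1 eP) (cong (λ z → cls W 1 + z * z * 1) p≡))
        (trans (exc-1 W eP) (cong₂ (λ z w → suc (z * z) + w + 0) p≡ (exc≡ b))) (E≤1 b)
        (trans (cong (cls W 1 +_) (sym p≡)) (trans (cls≡ b) (cong (λ z → suc (z * z) + E) p≡)))
        (comb-mono (I P) ((6 + π , common ℓ) ∷ (7 + π , (λ _ → 1)) ∷ []) ((1 , cnt W 1) ∷ (6 + π , quo W) ∷ []) (meets-bound off eP))

    not-long : ∀ ℓ → cnt W 1 ℓ ≡ 2 * (7 + π) → ⊥
    not-long ℓ e = no-long-from ℓ e (proj₁ (proj₂ off)) (proj₂ (proj₂ off))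
      where off = off-point ℓ (≤-trans (s≤s (≤-reflexive e)) many-points)

    sec-≡ : ∀ {ℓ} → cnt W 1 ℓ ≡ p → T (isSec ℓ)
    sec-≡ {ℓ} = ≡⇒≡ᵇ (cnt W 1 ℓ) p

    ≡-sec : ∀ {ℓ} → T (isSec ℓ) → cnt W 1 ℓ ≡ p
    ≡-sec {ℓ} = ≡ᵇ⇒≡ (cnt W 1 ℓ) p

    not-sec : ∀ {ℓ} → cnt W 1 ℓ < 7 → bit (isSec ℓ) ≡ 0
    not-sec lt = bit-¬T (λ t → <⇒≢ (<-≤-trans lt 7≤p) (≡-sec t))

    -- The three surviving types read 1 + 0 = 1, 0 + 1 = 1 and 2 + 0 = 2. This linear identity
    -- counts the secants through a point without counting the other types: summed, it gives
    -- `cls W p-1` plus their number equal to q + 1 + E.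
    sec-opp : ∀ {P} ℓ → T (I P ℓ) → val W P ≡ 1 → cnt W p-1 ℓ + bit (isSec ℓ) ≡ quo W ℓ
    sec-opp ℓ t e = go (raw-type t e)
      where
      go : LineType π (cnt W 1 ℓ) (cnt W p-1 ℓ) (quo W ℓ) → cnt W p-1 ℓ + bit (isSec ℓ) ≡ quo W ℓ
      go (mixed ea eb et) = trans (cong₂ _+_ eb (not-sec {ℓ} (subst (_< 7) (sym ea) lit))) (sym et)
      go (secant ea eb et) = trans (cong₂ _+_ eb (bit-T (sec-≡ {ℓ} (trans ea (sym p≡))))) (sym et)
      go (double ea eb et) = trans (cong₂ _+_ eb (not-sec {ℓ} (subst (_< 7) (sym ea) lit))) (sym et)
      go (long ea eb et) = ⊥-elim (not-long ℓ ea)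

    secants-through : ∀ {P} → val W P ≡ 1 → through P (λ ℓ → bit (isSec ℓ)) ≡ p
    secants-through {P} e = +-cancelˡ-≡ (cls W p-1) _ _ (trans (cong (_+ through P (λ ℓ → bit (isSec ℓ))) (sym
        (trans (through-cnt-≢ W p-1 (λ x → 1≢p-1 (trans (sym e) x))) (trans (cong (cls W p-1 +_) (*-zeroʳ q)) (+-identityʳ _)))))
      (trans (sym (wsum-+ (I P) (cnt W p-1) (λ ℓ → bit (isSec ℓ))))
      (trans (≤-antisym (wsum-mono (I P) (λ ℓ t → ≤-reflexive (sec-opp ℓ t e))) (wsum-mono (I P) (λ ℓ t → ≤-reflexive (sym (sec-opp ℓ t e)))))
      (trans (exc-1 W e) (trans (+-identityʳ _) (trans (cong (suc q +_) (exc≡ b)) (sym (cls≡' b))))))))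

    secant-count : countFin isSec ≡ cls W 1
    secant-count = *-cancelˡ-≡ _ _ p (trans (sym (sum-*ˡ p (λ ℓ → bit (isSec ℓ)))) (trans (sum-cong {N} line)
        (trans (sum-incidence (is W 1) (λ ℓ → bit (isSec ℓ))) (trans (sum-cong {N} point) (sum-*ˡ p (is W 1))))))
      where
      line : ∀ ℓ → p * bit (isSec ℓ) ≡ cnt W 1 ℓ * bit (isSec ℓ)
      line ℓ with T? (isSec ℓ)
      ... | yes t = cong (_* bit (isSec ℓ)) (sym (≡-sec {ℓ} t))
      ... | no ¬t = trans (cong (p *_) (bit-¬T ¬t)) (trans (*-zeroʳ p) (sym (trans (cong (cnt W 1 ℓ *_) (bit-¬T ¬t)) (*-zeroʳ (cnt W 1 ℓ)))))
      point : ∀ P → δ (val W P) 1 * through P (λ ℓ → bit (isSec ℓ)) ≡ p * δ (val W P) 1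
      point P with val W P ≟ 1
      ... | yes e = trans (cong (δ (val W P) 1 *_) (secants-through e)) (*-comm (δ (val W P) 1) p)
      ... | no ne = trans (cong (_* through P (λ ℓ → bit (isSec ℓ))) (δ-≢ ne)) (sym (trans (cong (p *_) (δ-≢ ne)) (*-zeroʳ p)))

    points-on-secant : ∀ {ℓ} → T (isSec ℓ) → wsum inS (λ P → bit (I P ℓ)) ≡ p
    points-on-secant {ℓ} t = trans (sum-cong {N} (λ P → *-comm (bit (inS P)) (bit (I P ℓ)))) (≡-sec {ℓ} t)

    secant-degree : ∀ {P} → T (inS P) → wsum isSec (λ ℓ → bit (I P ℓ)) ≡ p
    secant-degree {P} t = trans (sum-cong {N} (λ ℓ → *-comm (bit (isSec ℓ)) (bit (I P ℓ)))) (secants-through (inS-val t))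

-- The projective or antipodal plane formed by the secants

private
  arith-plane : ∀ {x p} r → p ≡ suc r → x + p ≡ suc (p * p) + 0 → x ≡ r * r + r + 1
  arith-plane {x} r refl h = +-cancelʳ-≡ (suc r) _ _ (trans h (e r))
    where
    e : ∀ r → suc (suc r * suc r) + 0 ≡ r * r + r + 1 + suc r
    e = solve-∀

  arith-antipodal : ∀ {x p} r → p ≡ suc r → x + p ≡ suc (p * p) + 1 → x ≡ r * r + r + 2
  arith-antipodal {x} r refl h = +-cancelʳ-≡ (suc r) _ _ (trans h (e r))
    where
    e : ∀ r → suc (suc r * suc r) + 1 ≡ r * r + r + 2 + suc r
    e = solve-∀

module EmbeddedPlanes (p : ℕ) .{{_ : NonZero p}} (pr : Prime p) (7≤p : 7 ≤ p) (Π : ProjectivePlane (p * p)) where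
  open TwoValuedWords p pr 7≤p Π public
  open Balanced public

  module Structure {E : ℕ} {W : DualWord} (small : Small W) (b : Balanced E W) (n : ℕ) (n≡ : cls W 1 ≡ n) where
    open Secants {E} {W} small b public

    points : Enumeration inS n
    points = subst (Enumeration inS) n≡ (enumerate inS)

    lines : Enumeration isSec n
    lines = subst (Enumeration isSec) (trans secant-count n≡) (enumerate isSec)

    module Pts = Enumeration points
    module Lns = Enumeration lines

    inc : Fin n → Fin n → Bool
    inc x y = I (Pts.at x) (Lns.at y)

    inc-line : ∀ y → countFin (λ x → inc x y) ≡ suc p-1
    inc-line y = trans (Pts.sums (λ P → bit (I P (Lns.at y)))) (trans (points-on-secant (Lns.mem y)) (sym suc-p-1))

    inc-point : ∀ x → countFin (λ y → inc x y) ≡ suc p-1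
    inc-point x = trans (Lns.sums (λ ℓ → bit (I (Pts.at x) ℓ))) (trans (secant-degree (Pts.mem x)) (sym suc-p-1))

    inc-joinUnique : ∀ x x' → x ≢ x' → ∀ y y' → T (inc x y) → T (inc x' y) → T (inc x y') → T (inc x' y') → y ≡ y'
    inc-joinUnique x x' ne y y' a b c d = Lns.inj (joinUnique (Pts.at x) (Pts.at x') (λ e → ne (Pts.inj e)) (Lns.at y) (Lns.at y') a b c d)

    inc-meetUnique : ∀ y y' → y ≢ y' → ∀ x x' → T (inc x y) → T (inc x y') → T (inc x' y) → T (inc x' y') → x ≡ x'
    inc-meetUnique y y' ne x x' a b c d = Pts.inj (meetUnique (Lns.at y) (Lns.at y') (λ e → ne (Lns.inj e)) (Pts.at x) (Pts.at x') a b c d)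

    embedding : Embedding inc I
    embedding = record { pt = Pts.at ; ln = Lns.at ; ptInj = Pts.inj ; lnInj = Lns.inj ; incid = λ _ _ → refl }

    pointSet : IsPointSetOf embedding inS
    pointSet = Pts.onto , Pts.mem

  module PlaneOfSecants {W : DualWord} (small : Small W) (b : Balanced 0 W) where
    cls≡plane : cls W 1 ≡ planeSize p-1
    cls≡plane = arith-plane {cls W 1} p-1 (sym suc-p-1) (cls≡ b)

    open Structure {0} {W} small b (planeSize p-1) cls≡plane public

    -- For E = 0 the quotient is 1 on each line through a point of value 1. If such a line is no
    -- secant, it has one point of value -1, and the sum p leaves room for a single point of value
    -- 1.
    join-secant : ∀ {P Q ℓ} → P ≢ Q → T (I P ℓ) → T (I Q ℓ) → val W P ≡ 1 → val W Q ≡ 1 → T (isSec ℓ)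
    join-secant {P} {Q} {ℓ} ne tP tQ eP eQ with T? (isSec ℓ)
    ... | yes t = t
    ... | no ¬t = ⊥-elim (<⇒≢ (two-points ne tP tQ eP eQ) (sym one))
      where
      quo1 : quo W ℓ ≡ 1
      quo1 = ≤-antisym (≤-trans (quo-upper W tP eP) (≤-reflexive (cong suc (exc≡ b)))) (quo-pos W tP (≤-reflexive (sym eP)))
      opp1 : cnt W p-1 ℓ ≡ 1
      opp1 = trans (sym (+-identityʳ _)) (trans (cong (cnt W p-1 ℓ +_) (sym (bit-¬T ¬t))) (trans (sec-opp ℓ tP eP) quo1))
      one : cnt W 1 ℓ ≡ 1
      one = +-cancelʳ-≡ p-1 _ _ (trans (cong (cnt W 1 ℓ +_) (trans (sym (*-identityʳ p-1)) (cong (p-1 *_) (sym opp1))))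
        (trans (line-two {W} (two b) ℓ) (trans (cong (_* p) quo1) (trans (*-identityˡ p) (sym suc-p-1)))))

    points-count : ∀ {m} → T (isSec m) → countFin (λ Q → inS Q ∧ I Q m) ≡ p
    points-count {m} t = trans (sum-cong {N} (λ Q → sym (bit-∧ (inS Q) (I Q m)))) (points-on-secant t)

    3≤p : 3 ≤ p
    3≤p = ≤-trans lit 7≤p

    secant-points : ∀ {m} → T (isSec m) → ∀ R R' → ∃[ Q ] (val W Q ≡ 1 × T (I Q m) × Q ≢ R × Q ≢ R')
    secant-points {m} t R R' with pick-avoiding (λ Q → inS Q ∧ I Q m) R R' (≤-trans 3≤p (≤-reflexive (sym (points-count t))))
    ... | Q , tQ , ne , ne' = Q , inS-val (proj₁ (∧-elim tQ)) , proj₂ (∧-elim {inS Q} tQ) , ne , ne'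

    -- Let P be a point of value 1 on m and off ℓ. Joining P to the p points of value 1 on ℓ yields
    -- p secants, and P lies on only p; hence m is one of them.
    meet-secant : ∀ {ℓ m} → ℓ ≢ m → T (isSec ℓ) → T (isSec m) → ∃[ Q ] (T (I Q m) × T (I Q ℓ) × val W Q ≡ 1)
    meet-secant {ℓ} {m} ne sℓ sm = common-point {ℓ} {m} (≤-reflexive (sym (trans (wsum-eq (I P) bound total m tP) (bit-T sm))))
      where
      R = meetExists ℓ m ne
      pick = secant-points sm (proj₁ R) (proj₁ R)
      P = proj₁ pick
      eP : val W P ≡ 1
      eP = proj₁ (proj₂ pick)
      tP : T (I P m)
      tP = proj₁ (proj₂ (proj₂ pick))
      off : ¬ T (I P ℓ)
      off t = proj₁ (proj₂ (proj₂ (proj₂ pick))) (meetUnique ℓ m ne P (proj₁ R) t tP (proj₁ (proj₂ R)) (proj₂ (proj₂ R)))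
      bound : ∀ m' → T (I P m') → common ℓ m' ≤ bit (isSec m')
      bound m' t with pos-or-0 (common ℓ m')
      ... | inj₁ z   = ≤-trans (≤-reflexive z) z≤n
      ... | inj₂ pos = ≤-trans (common≤1 {ℓ} {m'} (λ e → off (subst (λ k → T (I P k)) (sym e) t)))
          (≤-reflexive (sym (bit-T (join-secant {P} {proj₁ cp} {m'} (λ e → off (subst (λ Q → T (I Q ℓ)) (sym e) (proj₁ (proj₂ (proj₂ cp))))) t (proj₁ (proj₂ cp)) eP (proj₂ (proj₂ (proj₂ cp)))))))
        where cp = common-point {ℓ} {m'} pos
      total : through P (λ m' → bit (isSec m')) ≤ through P (common ℓ)
      total = ≤-reflexive (trans (secants-through eP) (trans (sym (≡-sec {ℓ} sℓ)) (sym (through-common off))))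

    inc-joinExists : ∀ x x' → x ≢ x' → ∃[ y ] (T (inc x y) × T (inc x' y))
    inc-joinExists x x' ne = proj₁ idx , subst (λ k → T (I (Pts.at x) k)) (sym (proj₂ idx)) (proj₁ (proj₂ line)) ,
                                         subst (λ k → T (I (Pts.at x') k)) (sym (proj₂ idx)) (proj₂ (proj₂ line))
      where
      line = joinExists (Pts.at x) (Pts.at x') (λ e → ne (Pts.inj e))
      idx : ∃[ y ] Lns.at y ≡ proj₁ line
      idx = Lns.onto (proj₁ line) (join-secant (λ e → ne (Pts.inj e)) (proj₁ (proj₂ line)) (proj₂ (proj₂ line)) (inS-val (Pts.mem x)) (inS-val (Pts.mem x')))

    inc-meetExists : ∀ y y' → y ≢ y' → ∃[ x ] (T (inc x y) × T (inc x y'))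
    inc-meetExists y y' ne = proj₁ idx , subst (λ k → T (I k (Lns.at y))) (sym (proj₂ idx)) (proj₁ (proj₂ (proj₂ point))) ,
                                         subst (λ k → T (I k (Lns.at y'))) (sym (proj₂ idx)) (proj₁ (proj₂ point))
      where
      point = meet-secant {Lns.at y} {Lns.at y'} (λ e → ne (Lns.inj e)) (Lns.mem y) (Lns.mem y')
      idx : ∃[ x ] Pts.at x ≡ proj₁ point
      idx = Pts.onto (proj₁ point) (val-inS (proj₂ (proj₂ (proj₂ point))))

    -- Two points on each of two secants through P, none of them P.
    inc-quadrangle : ∃[ A ] ∃[ B ] ∃[ C ] ∃[ D ]
      (A ≢ B × A ≢ C × A ≢ D × B ≢ C × B ≢ D × C ≢ D ×
       ¬ Collinear inc A B C × ¬ Collinear inc A B D × ¬ Collinear inc A C D × ¬ Collinear inc B C D)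
    inc-quadrangle = A , B , C , D , A≢B , off-ℓ A C tA tC nC , off-ℓ A D tA tD nD , off-ℓ B C tB tC nC , off-ℓ B D tB tD nD , C≢D ,
        (λ { (z , a , b , c) → nC (both C (subst (λ k → T (inc C k)) (inc-joinUnique A B A≢B z ℓ a b tA tB) c) tC) }) ,
        (λ { (z , a , b , c) → nD (both D (subst (λ k → T (inc D k)) (inc-joinUnique A B A≢B z ℓ a b tA tB) c) tD) }) ,
        (λ { (z , a , c , d) → nA (both A tA (subst (λ k → T (inc A k)) (inc-joinUnique C D C≢D z m c d tC tD) a)) }) ,
        (λ { (z , a , c , d) → nB (both B tB (subst (λ k → T (inc B k)) (inc-joinUnique C D C≢D z m c d tC tD) a)) })
      where
      big : ∀ (S : Fin (planeSize p-1) → Bool) → countFin S ≡ suc p-1 → 3 ≤ countFin S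
      big S e = ≤-trans 3≤p (≤-reflexive (sym (trans e suc-p-1)))
      x₀ : Fin (planeSize p-1)
      x₀ = proj₁ (Pts.onto (proj₁ (hasW b)) (val-inS (proj₂ (hasW b))))
      first = sum-pos (λ y → bit (inc x₀ y)) (≤-trans (s≤s z≤n) (big (inc x₀) (inc-point x₀)))
      ℓ = proj₁ first
      t₀ : T (inc x₀ ℓ)
      t₀ = bit-pos (proj₂ first)
      second = pick-avoiding (inc x₀) ℓ ℓ (big (inc x₀) (inc-point x₀))
      m = proj₁ second
      t₀' : T (inc x₀ m)
      t₀' = proj₁ (proj₂ second)
      ℓ≢m : ℓ ≢ m
      ℓ≢m e = proj₁ (proj₂ (proj₂ second)) (sym e)
      on : ∀ y k → ∃[ x ] (T (inc x y) × x ≢ x₀ × x ≢ k)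
      on y k = pick-avoiding (λ x → inc x y) x₀ k (big (λ x → inc x y) (inc-line y))
      A = proj₁ (on ℓ x₀)
      B = proj₁ (on ℓ A)
      C = proj₁ (on m x₀)
      D = proj₁ (on m C)
      tA = proj₁ (proj₂ (on ℓ x₀))
      tB = proj₁ (proj₂ (on ℓ A))
      tC = proj₁ (proj₂ (on m x₀))
      tD = proj₁ (proj₂ (on m C))
      nA = proj₁ (proj₂ (proj₂ (on ℓ x₀)))
      nB = proj₁ (proj₂ (proj₂ (on ℓ A)))
      nC = proj₁ (proj₂ (proj₂ (on m x₀)))
      nD = proj₁ (proj₂ (proj₂ (on m C)))
      A≢B : A ≢ B
      A≢B e = proj₂ (proj₂ (proj₂ (on ℓ A))) (sym e)
      C≢D : C ≢ D
      C≢D e = proj₂ (proj₂ (proj₂ (on m C))) (sym e)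
      both : ∀ x → T (inc x ℓ) → T (inc x m) → x ≡ x₀
      both x t t' = inc-meetUnique ℓ m ℓ≢m x x₀ t t' t₀ t₀'
      off-ℓ : ∀ x y → T (inc x ℓ) → T (inc y m) → y ≢ x₀ → x ≢ y
      off-ℓ x y tx ty ny e = ny (both y (subst (λ k → T (inc k ℓ)) e tx) ty)

    plane : ProjectivePlane p-1
    plane = record
      { I = inc ; joinExists = inc-joinExists ; joinUnique = inc-joinUnique
      ; meetExists = inc-meetExists ; meetUnique = inc-meetUnique
      ; quadrangle = inc-quadrangle ; lineSize = inc-line }

  module AntipodalOfSecants {W : DualWord} (small : Small W) (b : Balanced 1 W) where
    cls≡antipodal : cls W 1 ≡ antipodalSize p-1
    cls≡antipodal = arith-antipodal {cls W 1} p-1 (sym suc-p-1) (cls≡ b)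

    open Structure {1} {W} small b (antipodalSize p-1) cls≡antipodal public

    antipodal : AntipodalPlane p-1
    antipodal = record { I = inc ; lineSize = inc-line ; pointDeg = inc-point ; partialLinear = inc-joinUnique }

-- Return to code words; the word of a Baer subplane

private
  arith-weight : ∀ {d q p} k → 2 * p ≤ 2 * q → d + 2 * p ≡ 2 * q + k → d ≡ 2 * q ∸ 2 * p + k
  arith-weight {d} {q} {p} k le h = +-cancelʳ-≡ (2 * p) _ _ (trans h (trans (cong (_+ k) (sym (m∸n+n≡m le))) (e (2 * q ∸ 2 * p) (2 * p) k)))
    where
    e : ∀ a b k → a + b + k ≡ a + k + b
    e = solve-∀

  arith-weight-≤ : ∀ {d q p} k → 2 * p ≤ 2 * q → 2 * q + k ≤ d + 2 * p → 2 * q ∸ 2 * p + k ≤ d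
  arith-weight-≤ {d} {q} {p} k le h = +-cancelʳ-≤ (2 * p) _ _ (≤-trans (≤-reflexive (trans (e (2 * q ∸ 2 * p) (2 * p) k) (cong (_+ k) (m∸n+n≡m le)))) h)
    where
    e : ∀ a b k → a + k + b ≡ a + b + k
    e = solve-∀

  arith-Baer-lines : ∀ p → (p * p * (p * p) + p * p + 1) * 1 + p * (p * p + p + 1) ≡ (p * p + p + 1) * suc (p * p)
  arith-Baer-lines = solve-∀

  arith-Baer-weight : ∀ {w A B C p} → A ≡ suc p → B ≡ p * p + p + 1 → C ≡ suc (p * p) → w + 2 * A ≤ B + C → w + p ≤ 2 * (p * p)
  arith-Baer-weight {w} {p = p} refl refl refl le = ≤-from-sum 0 le (solve (w ∷ p ∷ []))


if-bit : ∀ b x → (if b then x else 0) ≡ bit b * x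
if-bit true  x = sym (*-identityˡ x)
if-bit false x = refl

summand : ∀ {N} {f : Fin N → ℕ} {s} → s ≡ sumFin f → Fin N → ℕ
summand {f = f} _ = f

weight-nz : ∀ {p N} (c : Word p N) → weight c ≡ sumFin (λ P → nz (toℕ (c P)))
weight-nz {p} {N} c = sum-cong {N} go
  where
  -- The summand in weight c mentions a function local to the definition of weight, so it is inferred.
  go : ∀ P → summand {N} {s = weight c} refl P ≡ nz (toℕ (c P))
  go P with toℕ (c P)
  ... | zero  = refl
  ... | suc _ = refl

¬T⇒false : ∀ {b} → ¬ T b → b ≡ false
¬T⇒false {true}  h = ⊥-elim (h tt)
¬T⇒false {false} _ = refl

module CodeWords (p : ℕ) .{{_ : NonZero p}} (pr : Prime p) (7≤p : 7 ≤ p) (Π : ProjectivePlane (p * p)) where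
  open EmbeddedPlanes p pr 7≤p Π
  open Fp p

  fromCode : (c : Word p (planeSize q)) → InDual p Π c → DualWord
  fromCode c d = mkWord (λ Q → toℕ (c Q)) (λ Q → FinP.toℕ<n (c Q))
    (λ ℓ → subst (p ∣_) (sum-cong {N} (λ P → if-bit (I P ℓ) (toℕ (c P)))) (d ℓ))

  record Normalised (c : Word p (planeSize q)) : Set where
    field
      inDual : InDual p Π c
      lam    : Fin p
      lam≢0  : toℕ lam ≢ 0
      mult   : ℕ
      inv    : (mult * toℕ lam) % p ≡ 1
      occurs : ∃[ P ] c P ≡ lam

    1≤lam : 1 ≤ toℕ lam
    1≤lam = n≢0⇒n>0 lam≢0

    unit : ¬ p ∣ mult
    unit = inverse-unit {mult} {toℕ lam} inv

    word : DualWord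
    word = scale mult (fromCode c inDual)

    weight≡ : wt word ≡ weight c
    weight≡ = trans (wt-scale {mult} (fromCode c inDual) unit) (sym (weight-nz c))

    has1 : Has word 1
    has1 = proj₁ occurs , trans (cong (λ z → (mult * toℕ z) % p) (proj₂ occurs)) inv

  normalise : ∀ c → InDual p Π c → NonZeroWord c → Normalised c
  normalise c d (P , ne) = record { inDual = d ; lam = c P ; lam≢0 = ne ; mult = proj₁ i ; inv = proj₂ i ; occurs = P , refl }
    where i = inverse (n≢0⇒n>0 ne) (FinP.toℕ<n (c P))

  2p≤2q : 2 * p ≤ 2 * q
  2p≤2q = *-monoʳ-≤ 2 (m≤m*n p p)

  toℕ-mod : ∀ m → toℕ (m mod p) ≡ m % p
  toℕ-mod m = FinP.toℕ-fromℕ< (m%n<n m p)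

  module _ {c : Word p (planeSize q)} (norm : Normalised c) where
    open Normalised norm

    λ̂ : ℕ
    λ̂ = toℕ lam

    λ̂<p : λ̂ < p
    λ̂<p = FinP.toℕ<n lam

    private
      ·-val : ∀ b b' v → (bit b % p + (p ∸ bit b' % p)) % p ≡ v → toℕ (lam ·ₚ (indic b -ₚ indic b')) ≡ (λ̂ * v) % p
      ·-val b b' v e = trans (toℕ-mod _) (cong (λ z → (λ̂ * z) % p) (trans (toℕ-mod _)
        (trans (cong₂ (λ x y → (x + (p ∸ y)) % p) (toℕ-mod (bit b)) (toℕ-mod (bit b'))) e)))

      0%p : 0 % p ≡ 0
      0%p = m<n⇒m%n≡m 0<p

      1%p : 1 % p ≡ 1
      1%p = m<n⇒m%n≡m 1<p

      diff-10 : toℕ (lam ·ₚ (indic true -ₚ indic false)) ≡ λ̂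
      diff-10 = trans (·-val true false 1 (trans (cong₂ (λ x y → (x + (p ∸ y)) % p) 1%p 0%p) (trans ([m+n]%n≡m%n 1 p) 1%p)))
                      (trans (cong (_% p) (*-identityʳ λ̂)) (m<n⇒m%n≡m λ̂<p))

      diff-00 : toℕ (lam ·ₚ (indic false -ₚ indic false)) ≡ 0
      diff-00 = trans (·-val false false 0 (trans (cong₂ (λ x y → (x + (p ∸ y)) % p) 0%p 0%p) (n%n≡0 p)))
                      (trans (cong (_% p) (*-zeroʳ λ̂)) 0%p)

      diff-01 : toℕ (lam ·ₚ (indic false -ₚ indic true)) ≡ p ∸ λ̂
      diff-01 = trans (·-val false true p-1 (trans (cong₂ (λ x y → (x + (p ∸ y)) % p) 0%p 1%p) (m<n⇒m%n≡m p-1<p)))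
        (trans (residues-sum {λ̂} {λ̂ * p-1} (divides λ̂ (trans (sym (*-suc λ̂ p-1)) (cong (λ̂ *_) suc-p-1))) (≤-trans 1≤lam (≤-reflexive (sym (m<n⇒m%n≡m λ̂<p)))))
               (cong (p ∸_) (m<n⇒m%n≡m λ̂<p)))

    scaled-difference : TwoValued word → IsScaledDifference p c lam (λ P → val word P ≡ᵇ 1) (λ P → val (neg word) P ≡ᵇ 1)
    scaled-difference two P = FinP.toℕ-injective (go (two P))
      where
      S₁ S₂ : Bool
      S₁ = val word P ≡ᵇ 1
      S₂ = val (neg word) P ≡ᵇ 1
      x<p : toℕ (c P) < p
      x<p = FinP.toℕ<n (c P)
      via : ∀ {b b' v} → S₁ ≡ b → S₂ ≡ b' → toℕ (c P) ≡ v → toℕ (lam ·ₚ (indic b -ₚ indic b')) ≡ v → toℕ (c P) ≡ toℕ (lam ·ₚ (indic S₁ -ₚ indic S₂))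
      via e1 e2 ec ed = trans ec (sym (trans (cong₂ (λ b b' → toℕ (lam ·ₚ (indic b -ₚ indic b'))) e1 e2) ed))
      go : val word P ≡ 0 ⊎ (val word P ≡ 1 ⊎ val word P ≡ p-1) → toℕ (c P) ≡ toℕ (lam ·ₚ (indic S₁ -ₚ indic S₂))
      go (inj₁ e) = via (cong (_≡ᵇ 1) e) (cong (λ v → negv v ≡ᵇ 1) e) zero-val diff-00
        where
        zero-val : toℕ (c P) ≡ 0
        zero-val = *-inj {mult} unit x<p 0<p (trans e (sym (trans (cong (_% p) (*-zeroʳ mult)) 0%p)))
      go (inj₂ (inj₁ e)) = via (cong (_≡ᵇ 1) e) (trans (cong (λ v → negv v ≡ᵇ 1) e) (¬T⇒false (λ t → 1≢p-1 (sym (≡ᵇ⇒≡ p-1 1 t)))))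
        (*-inj {mult} unit x<p λ̂<p (trans e (sym inv))) diff-10
      go (inj₂ (inj₂ e)) = via (trans (cong (_≡ᵇ 1) e) (¬T⇒false (λ t → 1≢p-1 (sym (≡ᵇ⇒≡ p-1 1 t)))))
        (trans (cong (λ v → negv v ≡ᵇ 1) e) (cong (_≡ᵇ 1) (trans (negv-pos (<⇒≤ 1<p-1)) (p∸-inv 1<p))))
        (*-inj {mult} unit x<p (∸-monoʳ-< {p} 1≤lam (<⇒≤ λ̂<p)) (trans e (sym (scale-opposite {mult} λ̂<p inv)))) diff-01

    disjoint : ∀ P → ¬ (T (val word P ≡ᵇ 1) × T (val (neg word) P ≡ᵇ 1))
    disjoint P (t , t') = 1≢p-1 (sym (trans (cong negv (sym (≡ᵇ⇒≡ (val word P) 1 t))) (≡ᵇ⇒≡ (val (neg word) P) 1 t')))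

    small : weight c + 2 * p ≤ 2 * q + 4 → Small word
    small h = ≤-trans (≤-reflexive (cong (_+ 2 * p) weight≡)) h

    planes : Small word → Balanced 0 word → FormDisjointProjPlanes p Π p-1 c
    planes s b = lam , A.plane , B.plane , A.embedding , B.embedding , A.inS , B.inS ,
        lam≢0 , A.pointSet , B.pointSet , disjoint , scaled-difference (two b)
      where
      module A = PlaneOfSecants {word} s b
      module B = PlaneOfSecants {neg word} (small-neg {word} s) (balanced-neg {0} {word} s b)

    antipodals : Small word → Balanced 1 word → FormDisjointAntipodal p Π p-1 c
    antipodals s b = lam , A.antipodal , B.antipodal , A.embedding , B.embedding , A.inS , B.inS ,
        lam≢0 , A.pointSet , B.pointSet , disjoint , scaled-difference (two b)
      where
      module A = AntipodalOfSecants {word} s b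
      module B = AntipodalOfSecants {neg word} (small-neg {word} s) (balanced-neg {1} {word} s b)

    -- The excess of the weight over 2q - 2p + 2 is E + E with E ≤ 1, which leaves 0 and 2 as the
    -- only cases.
    light : weight c + 2 * p ≤ 2 * q + 4 →
      (weight c + 2 * p ≡ 2 * q + 2 × FormDisjointProjPlanes p Π p-1 c) ⊎ (weight c + 2 * p ≡ 2 * q + 4 × FormDisjointAntipodal p Π p-1 c)
    light h = go (proj₁ bal) (E≤1 (proj₁ (proj₂ bal))) (proj₁ (proj₂ bal)) (trans (cong (_+ 2 * p) (sym weight≡)) (proj₂ (proj₂ bal)))
      where
      bal = balance word (small h) has1
      go : ∀ E → E ≤ 1 → Balanced E word → weight c + 2 * p ≡ 2 * q + 2 + (E + E) →
        (weight c + 2 * p ≡ 2 * q + 2 × FormDisjointProjPlanes p Π p-1 c) ⊎ (weight c + 2 * p ≡ 2 * q + 4 × FormDisjointAntipodal p Π p-1 c)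
      go 0 _ b e = inj₁ (trans e (+-identityʳ _) , planes (small h) b)
      go 1 _ b e = inj₂ (trans e (+-assoc (2 * q) 2 2) , antipodals (small h) b)
      go (suc (suc E)) (s≤s ()) _ _


  mod-dual : ∀ (f : Pt → ℕ) ℓ → p ∣ onLine ℓ f → p ∣ onLine ℓ (λ Q → f Q % p)
  mod-dual f ℓ d = ∣m+n∣m⇒∣n (subst (p ∣_) split d) (n∣m*n (onLine ℓ (λ Q → f Q / p)))
    where
    split : onLine ℓ f ≡ onLine ℓ (λ Q → f Q / p) * p + onLine ℓ (λ Q → f Q % p)
    split = trans (wsum-cong (pts ℓ) (λ Q → trans (m≡m%n+[m/n]*n (f Q) p) (trans (+-comm (f Q % p) _) (cong (_+ f Q % p) (*-comm (f Q / p) p)))))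
      (trans (wsum-+ (pts ℓ) (λ Q → p * (f Q / p)) (λ Q → f Q % p)) (cong (_+ onLine ℓ (λ Q → f Q % p))
        (trans (wsum-*ˡ (pts ℓ) p (λ Q → f Q / p)) (*-comm p _))))

  module BaerSubplane (B : ProjectivePlane p) (emb : Embedding (ProjectivePlane.I B) I) where
    module B = ProjectivePlane B
    open Embedding emb

    n : ℕ
    n = planeSize p

    onB : Pt → ℕ
    onB P = sumFin {n} (λ x → δF P (pt x))

    lineB : Pt → ℕ
    lineB ℓ = sumFin {n} (λ y → δF ℓ (ln y))

    hits : Pt → ℕ
    hits ℓ = sumFin {n} (λ x → bit (I (pt x) ℓ))

    onLine-onB : ∀ ℓ → onLine ℓ onB ≡ hits ℓ
    onLine-onB ℓ = trans (sum-cong {N} (λ P → sym (sum-*ˡ {n} (bit (I P ℓ)) (λ x → δF P (pt x)))))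
      (trans (sum-swap {N} {n} (λ P x → bit (I P ℓ) * δF P (pt x)))
      (sum-cong {n} (λ x → trans (sum-cong {N} (λ P → *-comm (bit (I P ℓ)) (δF P (pt x)))) (sum-δF (pt x) (λ P → bit (I P ℓ))))))

    sum-image : ∀ {f : Fin n → Pt} → sumFin (λ P → sumFin {n} (λ x → δF P (f x))) ≡ n
    sum-image {f} = trans (sum-swap {N} {n} (λ P x → δF P (f x))) (trans (sum-cong {n} (λ x → sum-δF1 (f x))) (trans (sum-const n 1) (*-identityʳ n)))

    hits-line : ∀ y → hits (ln y) ≡ suc p
    hits-line y = trans (sum-cong {n} (λ x → cong bit (incid x y))) (B.lineSize y)

    onB-pt : ∀ x → onB (pt x) ≡ 1
    onB-pt x = trans (sum-cong {n} (λ x' → δ-cong (λ e → cong toℕ (sym (ptInj (FinP.toℕ-injective e)))) (λ e → cong (λ z → toℕ (pt z)) (sym (FinP.toℕ-injective {i = x'} {j = x} e)))))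
      (sum-δF1 x)

    onB≤1 : ∀ P → onB P ≤ 1
    onB≤1 P with pos-or-0 (onB P)
    ... | inj₁ z   = ≤-trans (≤-reflexive z) z≤n
    ... | inj₂ pos = ≤-reflexive (trans (cong onB (sym eq)) (onB-pt (proj₁ found)))
      where
      found = sum-pos {n} (λ x → δF P (pt x)) pos
      eq : pt (proj₁ found) ≡ P
      eq = sym (FinP.toℕ-injective (δ-pos {toℕ P} (proj₂ found)))

    hits-bound : ∀ ℓ → hits ℓ ≤ 1 + p * lineB ℓ
    hits-bound ℓ with pos-or-0 (lineB ℓ)
    ... | inj₂ pos = ≤-trans (≤-reflexive (trans (cong hits eq) (hits-line y))) (s≤s (≤-trans (≤-reflexive (sym (*-identityʳ p))) (p ⊗ pos)))
      where
      found = sum-pos {n} (λ y → δF ℓ (ln y)) pos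
      y = proj₁ found
      eq : ℓ ≡ ln y
      eq = FinP.toℕ-injective (δ-pos {toℕ ℓ} (proj₂ found))
    ... | inj₁ z with hits ℓ ≤? 1
    ...   | yes le = ≤-trans le (m≤m+n 1 _)
    ...   | no ¬le = ⊥-elim (1+n≰n (≤-trans on-ℓ (≤-reflexive z)))
      where
      f : Fin n → ℕ
      f x = bit (I (pt x) ℓ)
      first = sum-pos {n} f (<⇒≤ (≰⇒> ¬le))
      x = proj₁ first
      second = sum-pos {n} (without x f) (+-cancelˡ-≤ 1 _ _ (≤-trans (≰⇒> ¬le) (≤-trans (≤-reflexive (sym (sum-without x f))) (+-monoˡ-≤ _ (bit≤1 (I (pt x) ℓ))))))
      x' = proj₁ second
      w = without-pos x f x' (proj₂ second)
      x≢x' : x ≢ x'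
      x≢x' e = proj₁ w (sym e)
      t : T (I (pt x) ℓ)
      t = bit-pos (proj₂ first)
      t' : T (I (pt x') ℓ)
      t' = bit-pos (subst (1 ≤_) (proj₂ w) (proj₂ second))
      join = B.joinExists x x' x≢x'
      y = proj₁ join
      eq : ℓ ≡ ln y
      eq = joinUnique (pt x) (pt x') (λ e → x≢x' (ptInj e)) ℓ (ln y) t t' (subst T (sym (incid x y)) (proj₁ (proj₂ join))) (subst T (sym (incid x' y)) (proj₂ (proj₂ join)))
      on-ℓ : 1 ≤ lineB ℓ
      on-ℓ = ≤-trans (≤-reflexive (sym (δ-≡ (cong toℕ eq)))) (term≤sum {n} (λ y → δF ℓ (ln y)) y)

    -- That every line meets the subplane follows by counting: summed over all lines, `hits-bound`
    -- has the same total on both sides, namely p² + p + 1 points on p² + 1 lines each, so it is an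
    -- equality everywhere.
    hits≡ : ∀ ℓ → hits ℓ ≡ 1 + p * lineB ℓ
    hits≡ = ≤-sum-eq {N} hits-bound (≤-reflexive (trans lhs (trans (arith-Baer-lines p) (sym rhs))))
      where
      lhs : sumFin (λ ℓ → 1 + p * lineB ℓ) ≡ planeSize q * 1 + p * n
      lhs = trans (sum-+ {N} (λ _ → 1) (λ ℓ → p * lineB ℓ)) (cong₂ _+_ (sum-const (planeSize q) 1) (trans (sum-*ˡ p lineB) (cong (p *_) (sum-image {ln}))))
      rhs : sumFin hits ≡ n * suc q
      rhs = trans (sum-swap {N} {n} (λ ℓ x → bit (I (pt x) ℓ))) (trans (sum-cong {n} (λ x → pointDegree (pt x))) (sum-const n (suc q)))

    A₀ = proj₁ B.quadrangle
    B₀ = proj₁ (proj₂ B.quadrangle)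
    C₀ = proj₁ (proj₂ (proj₂ B.quadrangle))
    A≢B : A₀ ≢ B₀
    A≢B = proj₁ (proj₂ (proj₂ (proj₂ (proj₂ B.quadrangle))))
    notColl : ¬ Collinear B.I A₀ B₀ C₀
    notColl = proj₁ (proj₂ (proj₂ (proj₂ (proj₂ (proj₂ (proj₂ (proj₂ (proj₂ (proj₂ (proj₂ B.quadrangle))))))))))
    y₀ = proj₁ (B.joinExists A₀ B₀ A≢B)
    m₀ = ln y₀

    -- The incidence vector of the subplane minus that of m₀, one of its lines.
    value : Pt → ℕ
    value P = onB P + p-1 * bit (I P m₀)

    onLine-m₀ : ∀ ℓ → ∃[ k ] onLine ℓ (λ P → bit (I P m₀)) ≡ 1 + p * k
    onLine-m₀ ℓ with m₀ FinP.≟ ℓ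
    ... | yes refl = p , trans (sum-cong {N} (λ P → bit-idem (I P m₀))) (lineSize m₀)
    ... | no ne    = 0 , trans (meetCount ne) (cong suc (sym (*-zeroʳ p)))

    value-dual : ∀ ℓ → p ∣ onLine ℓ value
    value-dual ℓ = divides (1 + lineB ℓ + p-1 * k) (trans (wsum-+ (pts ℓ) onB (λ P → p-1 * bit (I P m₀)))
        (trans (cong₂ _+_ (trans (onLine-onB ℓ) (hits≡ ℓ)) (trans (wsum-*ˡ (pts ℓ) p-1 (λ P → bit (I P m₀))) (cong (p-1 *_) (proj₂ (onLine-m₀ ℓ)))))
          (subst (λ z → 1 + z * lineB ℓ + p-1 * (1 + z * k) ≡ (1 + lineB ℓ + p-1 * k) * z) suc-p-1 (e p-1 (lineB ℓ) k))))
      where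
      k = proj₁ (onLine-m₀ ℓ)
      e : ∀ r l k → 1 + suc r * l + r * (1 + suc r * k) ≡ (1 + l + r * k) * suc r
      e = solve-∀

    code : Word p (planeSize q)
    code P = value P mod p

    code-dual : InDual p Π code
    code-dual ℓ = subst (p ∣_) (sum-cong {N} (λ P → trans (cong (bit (I P ℓ) *_) (sym (toℕ-mod (value P)))) (sym (if-bit (I P ℓ) (toℕ (code P))))))
      (mod-dual value ℓ (value-dual ℓ))

    code-nonzero : NonZeroWord code
    code-nonzero = pt C₀ , λ e → 1+n≢0 (trans (sym (m<n⇒m%n≡m 1<p)) (trans (cong (_% p) (sym val1)) (trans (sym (toℕ-mod (value (pt C₀)))) e)))
      where
      off : ¬ T (I (pt C₀) m₀)
      off t = notColl (y₀ , proj₁ (proj₂ (B.joinExists A₀ B₀ A≢B)) , proj₂ (proj₂ (B.joinExists A₀ B₀ A≢B)) , subst T (incid C₀ y₀) t)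
      val1 : value (pt C₀) ≡ 1
      val1 = trans (cong₂ (λ a b → a + p-1 * b) (onB-pt C₀) (bit-¬T off)) (cong suc (*-zeroʳ p-1))

    -- At a common point of subplane and line the value 1 + (p - 1) vanishes modulo p, so each of
    -- the p + 1 common points lowers the weight by 2.
    pointwise : ∀ v b → v ≤ 1 → nz ((v + p-1 * bit b) % p) + 2 * (bit b * v) ≤ v + bit b
    pointwise 0 false _ = ≤-reflexive (cong (λ z → nz z + 0) (trans (cong (_% p) (*-zeroʳ p-1)) (m<n⇒m%n≡m 0<p)))
    pointwise 0 true  _ = ≤-trans (≤-reflexive (+-identityʳ _)) (nz≤1 _)
    pointwise 1 false _ = ≤-trans (≤-reflexive (+-identityʳ _)) (nz≤1 _)
    pointwise 1 true  _ = ≤-reflexive (cong (λ z → nz z + 2) (trans (cong (_% p) (trans (cong suc (*-identityʳ p-1)) suc-p-1)) (n%n≡0 p)))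
    pointwise (suc (suc v)) _ (s≤s ())

    code-weight : weight code ≤ 2 * q ∸ p
    code-weight = m+n≤o⇒m≤o∸n (weight code) (arith-Baer-weight {weight code} {p = p} (trans (onLine-onB m₀) (hits-line y₀)) (sum-image {pt}) (lineSize m₀)
      (subst₂ _≤_ lhs (sum-+ onB (λ P → bit (I P m₀))) (sum-mono {N} (λ P → pointwise (onB P) (I P m₀) (onB≤1 P)))))
      where
      lhs : sumFin (λ P → nz (value P % p) + 2 * (bit (I P m₀) * onB P)) ≡ weight code + 2 * onLine m₀ onB
      lhs = trans (sum-+ (λ P → nz (value P % p)) (λ P → 2 * (bit (I P m₀) * onB P)))
        (cong₂ _+_ (trans (sum-cong {N} (λ P → cong nz (sym (toℕ-mod (value P))))) (sym (weight-nz code)))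
                   (sum-*ˡ 2 (λ P → bit (I P m₀) * onB P)))

mainTheorem1 : (p : ℕ) .{{_ : NonZero p}} → Prime p → 7 ≤ p →
    (Π : ProjectivePlane (p * p)) → (d : ℕ) → IsMinDualWeight p Π d →
    (d ≡ 2 * (p * p) ∸ 2 * p + 2 ⊎ d ≡ 2 * (p * p) ∸ 2 * p + 4 ⊎ 2 * (p * p) ∸ 2 * p + 5 ≤ d)
    × (d ≡ 2 * (p * p) ∸ 2 * p + 2 →
    ∀ c → IsMinWordOfWeight p Π d c → FormDisjointProjPlanes p Π (p ∸ 1) c)
    × (d ≡ 2 * (p * p) ∸ 2 * p + 4 →
    ∀ c → IsMinWordOfWeight p Π d c → FormDisjointAntipodal p Π (p ∸ 1) c)
    × (HasSubplaneOfOrder Π p → d ≤ 2 * (p * p) ∸ p)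
mainTheorem1 p pr 7≤p Π d ((c₀ , dual₀ , nonzero₀ , weight₀) , minimal) = trichotomy , projective , antipodal , baer
  where
  open CodeWords p pr 7≤p Π

  recover : ∀ {k w} → w ≡ 2 * (p * p) ∸ 2 * p + k → w + 2 * p ≡ 2 * (p * p) + k
  recover {k} e = trans (cong (_+ 2 * p) e) (trans (eq (2 * (p * p) ∸ 2 * p) k (2 * p)) (cong (_+ k) (m∸n+n≡m 2p≤2q)))
    where
    eq : ∀ a k b → a + k + b ≡ a + b + k
    eq = solve-∀

  trichotomy : d ≡ 2 * (p * p) ∸ 2 * p + 2 ⊎ d ≡ 2 * (p * p) ∸ 2 * p + 4 ⊎ 2 * (p * p) ∸ 2 * p + 5 ≤ d
  trichotomy with weight c₀ + 2 * p ≤? 2 * (p * p) + 4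
  ... | no ¬le = inj₂ (inj₂ (arith-weight-≤ {d} {p * p} {p} 5 2p≤2q
          (≤-trans (≤-reflexive (+-suc (2 * (p * p)) 4)) (≤-trans (≰⇒> ¬le) (≤-reflexive (cong (_+ 2 * p) weight₀))))))
  ... | yes le = [ (λ l → inj₁ (weight-d 2 (proj₁ l))) , (λ l → inj₂ (inj₁ (weight-d 4 (proj₁ l)))) ]′ (light (normalise c₀ dual₀ nonzero₀) le)
    where
    weight-d : ∀ k → weight c₀ + 2 * p ≡ 2 * (p * p) + k → d ≡ 2 * (p * p) ∸ 2 * p + k
    weight-d k e = arith-weight {d} {p * p} {p} k 2p≤2q (trans (cong (_+ 2 * p) (sym weight₀)) e)

  different : ∀ {w k k'} → k ≢ k' → w ≡ 2 * (p * p) ∸ 2 * p + k → w + 2 * p ≡ 2 * (p * p) + k' → ⊥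
  different {w} {k} {k'} ne e e' = ne (+-cancelˡ-≡ (2 * (p * p)) k k' (trans (sym (recover e)) e'))

  projective : d ≡ 2 * (p * p) ∸ 2 * p + 2 → ∀ c → IsMinWordOfWeight p Π d c → FormDisjointProjPlanes p Π (p ∸ 1) c
  projective e c (dual , nonzero , w) = [ proj₂ , (λ l → ⊥-elim (different (λ ()) (trans w e) (proj₁ l))) ]′
    (light (normalise c dual nonzero) (≤-trans (≤-reflexive (recover (trans w e))) (+-monoʳ-≤ (2 * (p * p)) lit)))

  antipodal : d ≡ 2 * (p * p) ∸ 2 * p + 4 → ∀ c → IsMinWordOfWeight p Π d c → FormDisjointAntipodal p Π (p ∸ 1) c
  antipodal e c (dual , nonzero , w) = [ (λ l → ⊥-elim (different (λ ()) (trans w e) (proj₁ l))) , proj₂ ]′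
    (light (normalise c dual nonzero) (≤-reflexive (recover (trans w e))))

  baer : HasSubplaneOfOrder Π p → d ≤ 2 * (p * p) ∸ p
  baer (B , emb) = ≤-trans (minimal code code-dual code-nonzero) code-weight
    where open BaerSubplane B emb
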